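{- Let $r\geq 4$ and let $\mathcal{H}$ be an $r$-graph that is embeddable in a $2$-reducible $r$-tree. Let $\sigma=\sigma(\mathcal{H})$ and define $\beta:=1/((r-2)(\sigma+1)+1)$. Then, as $n\to\infty$ (with $\mathcal{H}$ fixed), $$(\sigma-1)\binom{n}{r-1}+O(n^{r-2})\leq \mathrm{ex}(n,\mathcal{H})\leq (\sigma-1)\binom{n}{r-1}+O(n^{r-1-\beta}).$$ Moreover, in the case $\sigma=1$ one has $\mathrm{ex}(n,\mathcal{H})=O(n^{r-2})$.
   Context: An $r$-graph is an $r$-uniform hypergraph. A (multi-)hypergraph with edges $E_1,\dots,E_m$ is a hypergraph tree if the edges can be ordered so that for every $i>1$ there is $\alpha(i)<i$ with $E_i\cap\bigcup_{j<i}E_j\subseteq E_{\alpha(i)}$; an $r$-uniform hypergraph tree is an $r$-tree. A hypergraph is $k$-reducible if each of its edges contains at least $k$ vertices of degree $1$. $\mathcal{H}$ is embeddable in $\mathcal{T}$ if there is an injective map $f:V(\mathcal{H})\to V(\mathcal{T})$ with $f(E)\in\mathcal{T}$ for all $E\in\mathcal{H}$. A cross-cut of $\mathcal{H}$ is a vertex set containing exactly one vertex of each edge; $\sigma(\mathcal{H})$ is the minimum size of a cross-cut (every $r$-graph embeddable in an $r$-tree has one). $\mathrm{ex}(n,\mathcal{H})$ is the maximum number of edges of an $r$-graph on $n$ vertices not containing $\mathcal{H}$ as a subgraph. -}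

module Defs where

open import Data.Nat using (ℕ; zero; suc; _+_; _*_; _∸_; _^_; _≤_; _<_; _≡ᵇ_)
open import Data.Nat.Combinatorics using (_C_)
open import Data.Fin using (Fin; toℕ)
open import Data.Fin.Subset using (Subset; _∈_; _∩_; ∣_∣)
open import Data.Fin.Permutation using (Permutation′; _⟨$⟩ʳ_)
open import Data.Vec using (tabulate; lookup)
open import Data.Product using (Σ; ∃; ∃-syntax; _×_)
open import Function.Bundles using (_⇔_)
open import Function.Definitions using (Injective)
open import Relation.Binary.PropositionalEquality using (_≡_)
open import Relation.Nullary using (¬_)

record Hypergraph (v : ℕ) : Set where
  field
    m    : ℕ
    edge : Fin m → Subset v
    edge-inj : Injective _≡_ _≡_ edge
open Hypergraph public

Uniform : ∀ {v} → ℕ → Hypergraph v → Set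
Uniform r H = ∀ i → ∣ edge H i ∣ ≡ r

IsEdge : ∀ {v} → Hypergraph v → Subset v → Set
IsEdge H S = ∃[ i ] (edge H i ≡ S)

ImageIs : ∀ {a b} → (Fin a → Fin b) → Subset a → Subset b → Set
ImageIs f S S' = ∀ y → (y ∈ S' ⇔ (∃[ x ] (x ∈ S × f x ≡ y)))

-- H is embeddable in T: an injective vertex map sending every edge of H
-- to an edge of T.  (Containment of H as a subgraph of G is the same notion.)
Embeds : ∀ {a b} → Hypergraph a → Hypergraph b → Set
Embeds {a} {b} H T =
  Σ (Fin a → Fin b) λ f → Injective _≡_ _≡_ f ×
    (∀ i → ∃[ S' ] (ImageIs f (edge H i) S' × IsEdge T S'))

IsHypergraphTree : ∀ {v} → Hypergraph v → Set
IsHypergraphTree H =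
  Σ (Permutation′ (m H)) λ π →
    ∀ (i : Fin (m H)) → 0 < toℕ i →
      ∃[ α ] (toℕ α < toℕ i ×
        (∀ x → x ∈ edge H (π ⟨$⟩ʳ i) →
               (∃[ j ] (toℕ j < toℕ i × x ∈ edge H (π ⟨$⟩ʳ j))) →
               x ∈ edge H (π ⟨$⟩ʳ α)))

degree : ∀ {v} → Hypergraph v → Fin v → ℕ
degree H x = ∣ tabulate (λ i → lookup (edge H i) x) ∣

degOne : ∀ {v} → Hypergraph v → Subset v
degOne H = tabulate (λ x → degree H x ≡ᵇ 1)

Reducible : ∀ {v} → ℕ → Hypergraph v → Set
Reducible k H = ∀ i → k ≤ ∣ edge H i ∩ degOne H ∣

IsRTree : ∀ {v} → ℕ → Hypergraph v → Set
IsRTree r T = Uniform r T × IsHypergraphTree T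

EmbeddableIn2RedRTree : ∀ {v} → ℕ → Hypergraph v → Set
EmbeddableIn2RedRTree r H =
  ∃[ t ] Σ (Hypergraph t) λ T → IsRTree r T × Reducible 2 T × Embeds H T

CrossCut : ∀ {v} → Hypergraph v → Subset v → Set
CrossCut H S = ∀ i → ∣ S ∩ edge H i ∣ ≡ 1

IsSigma : ∀ {v} → Hypergraph v → ℕ → Set
IsSigma H s = (∃[ S ] (CrossCut H S × ∣ S ∣ ≡ s)) ×
              (∀ S → CrossCut H S → s ≤ ∣ S ∣)

HFree : ∀ {v} → ℕ → (n : ℕ) → Hypergraph v → Hypergraph n → Set
HFree r n H G = Uniform r G × ¬ Embeds H G

-- ex(n,H) is the maximum number of edges of an H-free r-graph on n vertices;
-- since the set of such r-graphs is finite, "k ≤ ex(n,H)" and "ex(n,H) ≤ k"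
-- unfold to the following.
ExAtLeast : ∀ {v} → ℕ → Hypergraph v → ℕ → ℕ → Set
ExAtLeast r H n k = Σ (Hypergraph n) λ G → HFree r n H G × k ≤ m G

ExAtMost : ∀ {v} → ℕ → Hypergraph v → ℕ → ℕ → Set
ExAtMost r H n k = ∀ (G : Hypergraph n) → HFree r n H G → m G ≤ k

{-# OPTIONS --safe #-}

-- Upper bound. Order the vertices of each edge of an H-free graph G. By repeated cleaning, any family of more than
-- C n^(r-2) ordered edges has a nonempty part P in which one of the following holds, "kernel" meaning the common
-- part of a large star in P: (i) for some positions y ≠ y′, each restriction that omits both y and y′ is a kernel;
-- (ii) for some position z, each restriction that retains z is a kernel. In case (i) a 2-reducible r-tree embeds
-- greedily, two degree-1 vertices of each edge being coloured y and y′; in case (ii) a σ = 1 graph embeds, its common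
-- vertex being coloured z. This settles σ = 1.
-- In general let Q z be the largest part of type (ii). The shadow of Q z omitting y ≠ z has O(n^(r-2)) members, since
-- a fully rich part of it would lift to type (i). Hence, after discarding O(t n^(r-2)) edges, each vertex still
-- occurring in position z lies in at least t^(r-2) shadow members, so that there are O((n / t)^(r-2)) such centres.
-- A given σ-set of centres is joined to only O(n^(r-2)) common (r-1)-sets, because otherwise H embeds with its
-- cross-cut on these centres. All other (r-1)-sets are joined to at most σ - 1 centres, and t ≈ n^(1-β) balances
-- the errors t n^(r-2) and (n / t)^((r-2)(σ+1)) n^(r-2).

module Submission where

open import Defs
import Data.Bool
open import Data.Bool using (true; false)
open import Data.Bool.Properties using (T-≡)
open import Data.Empty using (⊥; ⊥-elim)
open import Data.Fin as Fin using (Fin; zero; suc; toℕ; fromℕ<; _↑ˡ_; punchIn; punchOut)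
open import Data.Fin.Permutation using (_⟨$⟩ʳ_; _⟨$⟩ˡ_; inverseʳ)
import Data.Fin.Properties as Fin
import Data.Fin.Subset as Sub
open Sub using (Subset; ∣_∣)
open import Data.Fin.Subset.Properties using (_∈?_; drop-there; ⊆-antisym; ∣⊥∣≡0; ∣⁅x⁆∣≡1; x∈⁅x⁆; x∈⁅y⁆⇒x≡y; x∈p∩q⁺; x∈p∩q⁻)
open import Data.List as List using (List; []; _∷_; _++_; length; map; filter; allFin; concatMap; cartesianProduct; cartesianProductWith; deduplicate; take)
open import Data.List.Membership.Propositional using (_∈_; _∉_; find; lose)
open import Data.List.Membership.Propositional.Properties
open import Data.List.Properties using (filter-notAll; length-++; length-map; length-tabulate; length-take; length-upTo; take++drop≡id)
open import Data.List.Relation.Unary.All as All using ([]; _∷_)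
open import Data.List.Relation.Unary.AllPairs using ([]; _∷_)
open import Data.List.Relation.Unary.Any as Any using (any?; here; there)
open import Data.List.Relation.Unary.Any.Properties using (lookup-index)
import Data.List.Relation.Unary.Unique.DecPropositional.Properties as DecUniq
open import Data.List.Relation.Unary.Unique.Propositional using (Unique)
open import Data.List.Relation.Unary.Unique.Propositional.Properties as Uniq using (Unique[x∷xs]⇒x∉xs)
open import Data.Maybe using (Maybe; just; nothing)
import Data.Maybe.Properties as Maybe
open import Data.Nat using (ℕ; zero; suc; _+_; _*_; _∸_; _^_; _≤_; _<_; z≤n; s≤s; >-nonZero)
open import Data.Nat.Combinatorics using (_C_; nCk≡nC[n∸k]; nCn≡1; nCk+nC[k+1]≡[n+1]C[k+1]; k>n⇒nCk≡0)
open import Data.Nat.Properties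
open import Data.Nat.Tactic.RingSolver using (solve-∀)
open import Data.Product using (∃-syntax; _×_; _,_; proj₁; proj₂)
import Data.Product.Properties as Prod
open import Data.Sum using (_⊎_; inj₁; inj₂)
open import Data.Vec as Vec using (Vec; []; _∷_; lookup; removeAt; tabulate; toList)
import Data.Vec.Properties as Vec
open import Data.Vec.Properties using (removeAt-punchOut)
open import Algebra.Properties.CommutativeSemigroup +-commutativeSemigroup using (x∙yz≈y∙xz)
open import Function using (_∘_; id)
open import Function.Bundles using (mk⇔; Equivalence; Injection)
open import Function.Properties.Inverse using (↔⇒↣)
open import Relation.Binary.Definitions using (DecidableEquality)
open import Relation.Binary.PropositionalEquality using (_≡_; _≢_; refl; sym; trans; cong; cong₂; subst; subst₂)
open import Relation.Nullary using (¬_; Dec; yes; no; contradiction; ¬?)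
open import Relation.Nullary.Decidable as Dec using (_→-dec_; _⊎-dec_; _×-dec_; decidable-stable)
open import Relation.Unary using (Decidable)

-- Counting duplicate-free lists

-- Richness for two sets of positions gives richness for their union, so cleaning need only consider
-- single positions and pairs. The obstacle is that richness is lost in subfamilies. What persists
-- is a functional dependency: a deleted fibre is covered by s vertices, so after splitting into
-- boundedly many bins one position of the pair is a function of the positions outside it. Each bin
-- is therefore cleaned again for the remaining pairs only, until every pair is rich or carries a
-- dependency. Two dependencies that can be resolved one after the other leave at most n^(r-2)
-- tuples; in a larger part the positions that are not rich on their own are thus rich in pairs, and
-- whether there are at least two of them or at most one decides between (i) and (ii). The second
-- cleaning, with threshold t in place of the constant s, is affordable because it has only O(t)
-- bins and each bin injects into a shadow. Real powers of n are avoided: t is an integer root, and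
-- errors are compared after raising them to the power D = 1/β.

all-or-any : ∀ {A : Set} {P Q : A → Set} (xs : List A) → (∀ x → P x ⊎ Q x) →
  (∀ x → x ∈ xs → P x) ⊎ (∃[ x ] (x ∈ xs × Q x))
all-or-any []       dec = inj₁ λ _ ()
all-or-any (x ∷ xs) dec with dec x | all-or-any xs dec
... | inj₂ q | _                   = inj₂ (x , here refl , q)
... | inj₁ p | inj₂ (y , y∈xs , q) = inj₂ (y , there y∈xs , q)
... | inj₁ p | inj₁ ps             = inj₁ λ where
  _ (here refl)  → p
  y (there y∈xs) → ps y y∈xs

∉-unique : ∀ {A : Set} {x : A} {xs} → x ∉ xs → Unique xs → Unique (x ∷ xs)
∉-unique x∉xs u = All.tabulate (λ { y∈xs refl → x∉xs y∈xs }) ∷ u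

unique-⊆-length : ∀ {A : Set} {xs ys : List A} → Unique xs → (∀ {x} → x ∈ xs → x ∈ ys) →
  length xs ≤ length ys
unique-⊆-length {xs = []} u xs⊆ys = z≤n
unique-⊆-length {xs = x ∷ xs} u@(_ ∷ u′) xs⊆ys with ∈-∃++ (xs⊆ys (here refl))
... | ys₁ , ys₂ , refl = begin
  suc (length xs)             ≤⟨ s≤s (unique-⊆-length u′ rest) ⟩
  suc (length (ys₁ ++ ys₂))   ≡⟨ cong suc (length-++ ys₁) ⟩
  suc (length ys₁ + length ys₂) ≡⟨ sym (+-suc (length ys₁) (length ys₂)) ⟩
  length ys₁ + suc (length ys₂) ≡⟨ sym (length-++ ys₁) ⟩
  length (ys₁ ++ x ∷ ys₂)     ∎
  where
  open ≤-Reasoning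
  rest : ∀ {y} → y ∈ xs → y ∈ ys₁ ++ ys₂
  rest {y} y∈xs with ∈-++⁻ ys₁ (xs⊆ys (there y∈xs))
  ... | inj₁ y∈ys₁           = ∈-++⁺ˡ y∈ys₁
  ... | inj₂ (here refl)     = contradiction y∈xs (Unique[x∷xs]⇒x∉xs u)
  ... | inj₂ (there y∈ys₂)   = ∈-++⁺ʳ ys₁ y∈ys₂

map-unique : ∀ {A B : Set} (f : A → B) {xs} → (∀ {x y} → x ∈ xs → y ∈ xs → f x ≡ f y → x ≡ y) →
  Unique xs → Unique (map f xs)
map-unique f {[]}     inj u        = []
map-unique f {x ∷ xs} inj u@(_ ∷ u′) =
  ∉-unique fx∉ (map-unique f (λ p q → inj (there p) (there q)) u′)
  where
  fx∉ : f x ∉ map f xs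
  fx∉ fx∈ with ∈-map⁻ f fx∈
  ... | y , y∈xs , eq with inj (here refl) (there y∈xs) eq
  ... | refl = Unique[x∷xs]⇒x∉xs u y∈xs

injection-length : ∀ {A B : Set} (f : A → B) {xs ys} → Unique xs →
  (∀ {x y} → x ∈ xs → y ∈ xs → f x ≡ f y → x ≡ y) → (∀ {x} → x ∈ xs → f x ∈ ys) →
  length xs ≤ length ys
injection-length f {xs} {ys} u inj into = subst (_≤ length ys) (length-map f xs)
  (unique-⊆-length (map-unique f inj u) λ y∈ → let x , x∈xs , eq = ∈-map⁻ f y∈ in
    subst (_∈ ys) (sym eq) (into x∈xs))

∈-dec : ∀ {A : Set} → DecidableEquality A → (x : A) (xs : List A) → Dec (x ∈ xs)
∈-dec _≟_ x = any? (x ≟_)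

⊆-unique-length⇒⊇ : ∀ {A : Set} → DecidableEquality A → {xs ys : List A} → Unique xs →
  (∀ {x} → x ∈ xs → x ∈ ys) → length ys ≤ length xs → ∀ {y} → y ∈ ys → y ∈ xs
⊆-unique-length⇒⊇ _≟_ {xs} {ys} u xs⊆ys le {y} y∈ys with ∈-dec _≟_ y xs
... | yes y∈xs = y∈xs
... | no  y∉xs = contradiction le (<⇒≱ (unique-⊆-length (∉-unique y∉xs u) λ where
  (here refl)  → y∈ys
  (there x∈xs) → xs⊆ys x∈xs))

length-filter-split : ∀ {A : Set} {P : A → Set} (P? : Decidable P) (xs : List A) →
  length xs ≡ length (filter P? xs) + length (filter (¬? ∘ P?) xs)
length-filter-split P? [] = refl
length-filter-split P? (x ∷ xs) with P? x
... | yes _ = cong suc (length-filter-split P? xs)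
... | no  _ = trans (cong suc (length-filter-split P? xs))
  (sym (+-suc (length (filter P? xs)) _))

-- Fibres are quantified over all duplicate-free lists contained in them, which spares mentioning filters.
fibre-upper : ∀ {A B : Set} → DecidableEquality B → (f : A → B) {c : ℕ} (bs : List B) {xs : List A} →
  Unique xs → (∀ {x} → x ∈ xs → f x ∈ bs) →
  (∀ b → b ∈ bs → ∀ ys → Unique ys → (∀ {y} → y ∈ ys → y ∈ xs × f y ≡ b) → length ys ≤ c) →
  length xs ≤ length bs * c
fibre-upper _≟_ f [] {[]} u into small = z≤n
fibre-upper _≟_ f [] {x ∷ xs} u into small with () ← into (here refl)
fibre-upper _≟_ f {c} (b ∷ bs) {xs} u into small = begin
  length xs ≡⟨ length-filter-split b? xs ⟩
  length (filter b? xs) + length (filter (¬? ∘ b?) xs)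
    ≤⟨ +-mono-≤ (small b (here refl) _ (Uniq.filter⁺ b? u) (∈-filter⁻ b? {xs = xs}))
                (fibre-upper _≟_ f bs (Uniq.filter⁺ (¬? ∘ b?) u) into′
                  λ b′ b′∈ ys uy sub → small b′ (there b′∈) ys uy
                    λ y∈ → let y∈f , eq = sub y∈ in proj₁ (∈-filter⁻ (¬? ∘ b?) {xs = xs} y∈f) , eq) ⟩
  c + length bs * c ∎
  where
  open ≤-Reasoning
  b? : ∀ x → Dec (f x ≡ b)
  b? x = f x ≟ b
  into′ : ∀ {x} → x ∈ filter (¬? ∘ b?) xs → f x ∈ bs
  into′ x∈ with ∈-filter⁻ (¬? ∘ b?) {xs = xs} x∈
  ... | x∈xs , fx≢b with into x∈xs
  ... | here eq   = contradiction eq fx≢b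
  ... | there fx∈ = fx∈

-- The map `f` separates the fibres, so their concatenation is duplicate-free. A predicate `Q`
-- instead of an ambient list lets `grow` collect tuples that are described only by a property.
fibre-collect : ∀ {A B : Set} (f : A → B) {Q : A → Set} {c : ℕ} (bs : List B) → Unique bs →
  (∀ {b} → b ∈ bs → ∃[ ys ] (Unique ys × (∀ {y} → y ∈ ys → Q y × f y ≡ b) × c ≤ length ys)) →
  ∃[ zs ] (Unique zs × (∀ {z} → z ∈ zs → Q z × f z ∈ bs) × length bs * c ≤ length zs)
fibre-collect f [] u large = [] , [] , (λ ()) , z≤n
fibre-collect f {Q} {c} (b ∷ bs) u@(_ ∷ u′) large
  with large (here refl) | fibre-collect f {Q} {c} bs u′ (large ∘ there)
... | ys , uy , suby , ley | zs , uz , subz , lez =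
  ys ++ zs ,
  Uniq.++⁺ uy uz (λ { (z∈ys , z∈zs) →
    Unique[x∷xs]⇒x∉xs u (subst (_∈ bs) (proj₂ (suby z∈ys)) (proj₂ (subz z∈zs))) }) ,
  (λ z∈ → split (∈-++⁻ ys z∈)) ,
  subst (c + length bs * c ≤_) (sym (length-++ ys)) (+-mono-≤ ley lez)
  where
  split : ∀ {z} → z ∈ ys ⊎ z ∈ zs → Q z × f z ∈ b ∷ bs
  split (inj₁ z∈ys) = proj₁ (suby z∈ys) , here (proj₂ (suby z∈ys))
  split (inj₂ z∈zs) = proj₁ (subz z∈zs) , there (proj₂ (subz z∈zs))

fibre-lower : ∀ {A B : Set} (f : A → B) {c : ℕ} (bs : List B) {xs : List A} → Unique bs →
  (∀ {b} → b ∈ bs → ∃[ ys ] (Unique ys × (∀ {y} → y ∈ ys → y ∈ xs × f y ≡ b) × c ≤ length ys)) →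
  length bs * c ≤ length xs
fibre-lower f {c} bs {xs} u large =
  let zs , uz , sub , le = fibre-collect f {Q = _∈ xs} {c} bs u large in
  ≤-trans le (unique-⊆-length uz (λ z∈ → proj₁ (sub z∈)))

length-allFin : ∀ n → length (allFin n) ≡ n
length-allFin n = length-tabulate {n = n} (λ i → i)

fresh : ∀ {k} (xs : List (Fin k)) → length xs < k → ∃[ c ] (c ∉ xs)
fresh {k} xs lt with all-or-any {P = _∈ xs} {Q = _∉ xs} (allFin k) dec
  where
  dec : ∀ c → c ∈ xs ⊎ c ∉ xs
  dec c with ∈-dec Fin._≟_ c xs
  ... | yes p = inj₁ p
  ... | no ¬p = inj₂ ¬p
... | inj₂ (c , _ , c∉xs) = c , c∉xs
... | inj₁ covers = contradiction
  (subst (_≤ length xs) (length-allFin k)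
    (unique-⊆-length (Uniq.allFin⁺ k) (λ {c} _ → covers c (∈-allFin c))))
  (<⇒≱ lt)

vectors : ∀ {A : Set} → List A → (k : ℕ) → List (Vec A k)
vectors xs zero    = [] ∷ []
vectors xs (suc k) = cartesianProductWith _∷_ xs (vectors xs k)

length-cartesianProductWith : ∀ {A B D : Set} (f : A → B → D) xs ys →
  length (cartesianProductWith f xs ys) ≡ length xs * length ys
length-cartesianProductWith f []       ys = refl
length-cartesianProductWith f (x ∷ xs) ys = trans (length-++ (map (f x) ys))
  (cong₂ _+_ (length-map (f x) ys) (length-cartesianProductWith f xs ys))

length-vectors : ∀ {A : Set} (xs : List A) k → length (vectors xs k) ≡ length xs ^ k
length-vectors xs zero    = refl
length-vectors xs (suc k) = trans (length-cartesianProductWith _∷_ xs (vectors xs k))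
  (cong (length xs *_) (length-vectors xs k))

∈-vectors : ∀ {A : Set} {xs : List A} {k} (F : Vec A k) → (∀ i → lookup F i ∈ xs) → F ∈ vectors xs k
∈-vectors []      _   = here refl
∈-vectors (x ∷ F) F⊆xs = ∈-cartesianProductWith⁺ _∷_ (F⊆xs zero) (∈-vectors F (F⊆xs ∘ suc))

∈-all-vectors : ∀ {n k} (F : Vec (Fin n) k) → F ∈ vectors (allFin n) k
∈-all-vectors F = ∈-vectors F λ i → ∈-allFin (lookup F i)

length-all-vectors : ∀ n k → length (vectors (allFin n) k) ≡ n ^ k
length-all-vectors n k = trans (length-vectors (allFin n) k) (cong (_^ k) (length-allFin n))

-- Richness speaks of vectors of length exactly s, whereas the vertices to be avoided arise as lists
-- of length at most s; the default `d` fills the gap.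
pad : ∀ {A : Set} → A → List A → (s : ℕ) → Vec A s
pad d xs       zero    = []
pad d []       (suc s) = d ∷ pad d [] s
pad d (x ∷ xs) (suc s) = x ∷ pad d xs s

∈-pad : ∀ {A : Set} (d : A) {x xs} s → x ∈ xs → length xs ≤ s → ∃[ j ] (lookup (pad d xs s) j ≡ x)
∈-pad d (suc s) (here refl) (s≤s le) = zero , refl
∈-pad d (suc s) (there x∈) (s≤s le)  = let j , eq = ∈-pad d s x∈ le in suc j , eq

lookup-ext : ∀ {A : Set} {k} {F F′ : Vec A k} → (∀ i → lookup F i ≡ lookup F′ i) → F ≡ F′
lookup-ext {F = []}    {[]}     eq = refl
lookup-ext {F = x ∷ F} {y ∷ F′} eq = cong₂ _∷_ (eq zero) (lookup-ext (eq ∘ suc))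

-- Stars, functional dependencies and the cleaning process

Tuple : ℕ → ℕ → Set
Tuple n k = Vec (Fin n) k

record AgreeOff {n k : ℕ} (X : Fin k → Set) (F F′ : Tuple n k) : Set where
  constructor agreeing
  field agree : ∀ c → ¬ X c → lookup F c ≡ lookup F′ c
open AgreeOff public

Avoids : ∀ {n k s} → (Fin k → Set) → Tuple n k → Vec (Fin n) s → Set
Avoids X F W = ∀ c → X c → ∀ j → lookup F c ≢ lookup W j

-- "The restriction of F to the complement of X is the kernel of a large star in P":
-- the star with more than s petals is replaced by the ability to avoid any s vertices.
RichAt : ∀ {n k} → ℕ → (Tuple n k → Set) → (Fin k → Set) → Tuple n k → Set
RichAt s P X F = ∀ (W : Vec _ s) → ∃[ F′ ] (P F′ × AgreeOff X F F′ × Avoids X F′ W)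

Rich : ∀ {n k} → ℕ → (Tuple n k → Set) → (Fin k → Set) → Set
Rich s P X = ∀ F → P F → RichAt s P X F

Pair : ∀ {k} → Fin k → Fin k → Fin k → Set
Pair x y c = c ≡ x ⊎ c ≡ y

pair? : ∀ {k} (x y : Fin k) → Decidable (Pair x y)
pair? x y c = (c Fin.≟ x) ⊎-dec (c Fin.≟ y)

-- A functional dependency in the sense of relational databases. It passes to subfamilies, which
-- `Rich` does not.
Dep : ∀ {n k} → (Tuple n k → Set) → Fin k → Fin k → Fin k → Set
Dep P x y b = ∀ F F′ → P F → P F′ → AgreeOff (Pair x y) F F′ → lookup F b ≡ lookup F′ b

agree? : ∀ {n k} {X : Fin k → Set} → Decidable X → (F F′ : Tuple n k) → Dec (AgreeOff X F F′)
agree? X? F F′ = Dec.map′ agreeing agree (Fin.all? λ c → ¬? (X? c) →-dec (lookup F c Fin.≟ lookup F′ c))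

agree-refl : ∀ {n k} {X : Fin k → Set} {F : Tuple n k} → AgreeOff X F F
agree-refl = agreeing λ c _ → refl

agree-sym : ∀ {n k} {X : Fin k → Set} {F F′ : Tuple n k} → AgreeOff X F F′ → AgreeOff X F′ F
agree-sym ag = agreeing λ c ¬Xc → sym (agree ag c ¬Xc)

agree-trans : ∀ {n k} {X : Fin k → Set} {F F′ F″ : Tuple n k} →
  AgreeOff X F F′ → AgreeOff X F′ F″ → AgreeOff X F F″
agree-trans ag ag′ = agreeing λ c ¬Xc → trans (agree ag c ¬Xc) (agree ag′ c ¬Xc)

Hits : ∀ {n k s} → (Fin k → Set) → Vec (Fin n) s → Tuple n k → Set
Hits {k = k} {s} X W F = ∃[ c ] ∃[ j ] (X c × lookup F c ≡ lookup W j)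

hits? : ∀ {n k s} {X : Fin k → Set} → Decidable X → (W : Vec (Fin n) s) → Decidable (Hits X W)
hits? X? W F = Fin.any? λ c → Fin.any? λ j → X? c ×-dec (lookup F c Fin.≟ lookup W j)

-- There are only n^s vectors and finitely many tuples, so a failure of richness can be searched for
-- and yields an actual covering vector.
rich-or-covered : ∀ {n k} s {X : Fin k → Set} → Decidable X → (P : List (Tuple n k)) → (F : Tuple n k) →
  RichAt s (_∈ P) X F ⊎ (∃[ W ] (∀ F′ → F′ ∈ P → AgreeOff X F F′ → Hits {s = s} X W F′))
rich-or-covered {n} {k} s {X} X? P F with all-or-any (vectors (allFin n) s) petal
  where
  Petal : Vec (Fin n) s → Tuple n k → Set
  Petal W F′ = AgreeOff X F F′ × Avoids X F′ W
  test : ∀ W F′ → (AgreeOff X F F′ → Hits {s = s} X W F′) ⊎ Petal W F′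
  test W F′ with agree? X? F F′ | hits? X? W F′
  ... | yes ag | no ¬hit = inj₂ (ag , λ c Xc j eq → ¬hit (c , j , Xc , eq))
  ... | yes _  | yes hit = inj₁ λ _ → hit
  ... | no ¬ag | _       = inj₁ λ ag → contradiction ag ¬ag
  petal : ∀ W → (∃[ F′ ] (F′ ∈ P × Petal W F′)) ⊎ (∀ F′ → F′ ∈ P → AgreeOff X F F′ → Hits {s = s} X W F′)
  petal W with all-or-any P (test W)
  ... | inj₁ covered = inj₂ covered
  ... | inj₂ found   = inj₁ found
... | inj₁ rich             = inj₁ λ W → rich W (∈-all-vectors W)
... | inj₂ (W , _ , covered) = inj₂ (W , covered)

-- A label `((x , y) , (b , j))` says that the tuple was deleted on account of the pair x, y and
-- that its coordinate b is entry j of the covering vector.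
Bin : ℕ → ℕ → Set
Bin k s = (Fin k × Fin k) × (Fin k × Fin s)

record Cleaning {n k} (s : ℕ) (J : List (Fin k × Fin k)) (P : List (Tuple n k)) : Set₁ where
  field
    label : Tuple n k → Maybe (Bin k s)
  Core : Tuple n k → Set
  Core F = F ∈ P × label F ≡ nothing
  field
    core-rich    : ∀ {x y} → (x , y) ∈ J → Rich s Core (Pair x y)
    bin-dep      : ∀ {x y b j} →
                   Dep (λ F → F ∈ P × label F ≡ just ((x , y) , (b , j))) x y b
    bin-valid    : ∀ {F x y b j} → F ∈ P → label F ≡ just ((x , y) , (b , j)) →
                   (x , y) ∈ J × Pair x y b
    core-maximal : ∀ (R : Tuple n k → Set) → (∀ {F} → R F → F ∈ P) →
                   (∀ {x y} → (x , y) ∈ J → Rich s R (Pair x y)) → ∀ {F} → R F → label F ≡ nothing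

-- Repeatedly delete the fibre {F ∈ P : F = F₀ off {x, y}} of a tuple F₀ that is not rich; the covering set W
-- of that fibre tells, up to s choices j, one of the coordinates of each deleted tuple.
clean : ∀ {n k} s (J : List (Fin k × Fin k)) ℓ (P : List (Tuple n k)) → length P ≤ ℓ → Cleaning s J P
clean {n} {k} s J ℓ P le with all-or-any J closed
  where
  closed : ∀ xy → (∀ F → F ∈ P → RichAt s (_∈ P) (Pair (proj₁ xy) (proj₂ xy)) F) ⊎
    (∃[ F ] (F ∈ P × ∃[ W ] (∀ F′ → F′ ∈ P → AgreeOff (Pair (proj₁ xy) (proj₂ xy)) F F′ →
      Hits {s = s} (Pair (proj₁ xy) (proj₂ xy)) W F′)))
  closed (x , y) = all-or-any P (rich-or-covered s (pair? x y) P)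
clean {n} {k} s J ℓ P le | inj₁ closed = record
  { label        = λ _ → nothing
  ; core-rich    = λ xy∈J F F∈ W → let F′ , F′∈P , rest = closed _ xy∈J F (proj₁ F∈) W in F′ , (F′∈P , refl) , rest
  ; bin-dep      = λ { _ _ (_ , ()) }
  ; bin-valid    = λ _ ()
  ; core-maximal = λ _ _ _ _ → refl
  }
clean {n} {k} s J zero    [] le | inj₂ (_ , _ , _ , () , _)
clean {n} {k} s J (suc ℓ) P le | inj₂ ((x , y) , xy∈J , F₀ , F₀∈P , W , covered) = record
  { label        = label
  ; core-rich    = core-rich
  ; bin-dep      = bin-dep
  ; bin-valid    = bin-valid
  ; core-maximal = core-maximal
  }
  where
  X : Fin k → Set
  X = Pair x y
  Fibre : Tuple n k → Set
  Fibre F = AgreeOff X F₀ F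
  fibre? : Decidable Fibre
  fibre? = agree? (pair? x y) F₀
  P′ : List (Tuple n k)
  P′ = filter (¬? ∘ fibre?) P
  -- The fibre contains `F₀` itself, so the list shrinks; ℓ is the bound on which the recursion
  -- descends.
  shorter : length P′ ≤ ℓ
  shorter = ≤-pred (≤-trans (filter-notAll (¬? ∘ fibre?) P (lose F₀∈P λ ¬f → ¬f agree-refl)) le)
  module R = Cleaning (clean s J ℓ P′ shorter)
  P′⊆P : ∀ {F} → F ∈ P′ → F ∈ P
  P′⊆P F∈ = proj₁ (∈-filter⁻ (¬? ∘ fibre?) {xs = P} F∈)
  P′⁺ : ∀ {F} → F ∈ P → ¬ Fibre F → F ∈ P′
  P′⁺ = ∈-filter⁺ (¬? ∘ fibre?)

  hitLabel : ∀ F → Dec (Hits {s = s} X W F) → Maybe (Bin k s)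
  hitLabel F (yes (c , j , _)) = just ((x , y) , (c , j))
  hitLabel F (no _)            = nothing

  labelBy : ∀ F → Dec (Fibre F) → Maybe (Bin k s)
  labelBy F (yes _) = hitLabel F (hits? (pair? x y) W F)
  labelBy F (no _)  = R.label F

  label : Tuple n k → Maybe (Bin k s)
  label F = labelBy F (fibre? F)

  hit-label : ∀ F (d : Dec (Hits {s = s} X W F)) → Hits {s = s} X W F →
    ∃[ c ] ∃[ j ] (hitLabel F d ≡ just ((x , y) , (c , j)) × X c × lookup F c ≡ lookup W j)
  hit-label F (yes (c , j , Xc , eq)) _   = c , j , refl , Xc , eq
  hit-label F (no ¬hit)               hit = contradiction hit ¬hit

  fibre-hit : ∀ {F} → F ∈ P → Fibre F →
    ∃[ c ] ∃[ j ] (label F ≡ just ((x , y) , (c , j)) × X c × lookup F c ≡ lookup W j)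
  fibre-hit {F} F∈P f with fibre? F
  ... | no ¬f = contradiction f ¬f
  ... | yes _ = hit-label F (hits? (pair? x y) W F) (covered F F∈P f)

  off-fibre : ∀ {F} → ¬ Fibre F → label F ≡ R.label F
  off-fibre {F} ¬f with fibre? F
  ... | yes f = contradiction f ¬f
  ... | no _  = refl

  just≢nothing : ∀ {A : Set} {a : A} {m} → m ≡ just a → m ≡ nothing → ⊥
  just≢nothing refl ()

  Core : Tuple n k → Set
  Core F = F ∈ P × label F ≡ nothing

  core⇒ : ∀ {F} → Core F → R.Core F
  core⇒ {F} (F∈P , eq) with fibre? F in f?
  ... | no ¬f = P′⁺ F∈P ¬f , eq
  ... | yes f = let _ , _ , lab , _ = fibre-hit F∈P f in
    ⊥-elim (just≢nothing lab (trans (cong (labelBy F) f?) eq))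

  core⇐ : ∀ {F} → R.Core F → Core F
  core⇐ (F∈P′ , eq) = P′⊆P F∈P′ , trans (off-fibre (proj₂ (∈-filter⁻ (¬? ∘ fibre?) {xs = P} F∈P′))) eq

  core-rich : ∀ {x y} → (x , y) ∈ J → Rich s Core (Pair x y)
  core-rich xy∈J F F∈ V = let F′ , F′∈ , rest = R.core-rich xy∈J F (core⇒ F∈) V in F′ , core⇐ F′∈ , rest

  just-bin : ∀ {x y b j x′ y′ b′ j′} →
    just ((x , y) , (b , j)) ≡ just {A = Bin k s} ((x′ , y′) , (b′ , j′)) → x ≡ x′ × y ≡ y′ × b ≡ b′ × j ≡ j′
  just-bin refl = refl , refl , refl , refl

  bin-valid : ∀ {F x y b j} → F ∈ P → label F ≡ just ((x , y) , (b , j)) → (x , y) ∈ J × Pair x y b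
  bin-valid {F} F∈P eq with fibre? F in f?
  ... | no ¬f = R.bin-valid (P′⁺ F∈P ¬f) eq
  ... | yes f with fibre-hit F∈P f
  ... | c , j , lab , Xc , _ with just-bin (trans (sym (trans (cong (labelBy F) (sym f?)) lab)) eq)
  ... | refl , refl , refl , refl = xy∈J , Xc

  -- Tuples that agree off {u, v} lie in the same fibre, so a tuple deleted now and one deleted
  -- later cannot share the label. If both are deleted now, both coordinates equal the same entry of
  -- `W`.
  bin-dep : ∀ {u v b j} → Dep (λ F → F ∈ P × label F ≡ just ((u , v) , (b , j))) u v b
  bin-dep F F′ (F∈P , eq) (F′∈P , eq′) ag = byFibre (fibre? F) (fibre? F′)
    where
    byFibre : Dec (Fibre F) → Dec (Fibre F′) → lookup F _ ≡ lookup F′ _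
    byFibre (no ¬f) (no ¬f′) = R.bin-dep F F′ (P′⁺ F∈P ¬f , trans (sym (off-fibre ¬f)) eq)
                                              (P′⁺ F′∈P ¬f′ , trans (sym (off-fibre ¬f′)) eq′) ag
    byFibre (yes f) (no ¬f′) with fibre-hit F∈P f
    ... | c , j , lab , _ with just-bin (trans (sym lab) eq)
    ... | refl , refl , refl , refl = contradiction (agree-trans f ag) ¬f′
    byFibre (no ¬f) (yes f′) with fibre-hit F′∈P f′
    ... | c , j , lab , _ with just-bin (trans (sym lab) eq′)
    ... | refl , refl , refl , refl = contradiction (agree-trans f′ (agree-sym ag)) ¬f
    byFibre (yes f) (yes f′) with fibre-hit F∈P f | fibre-hit F′∈P f′
    ... | c , j , lab , _ , hit | c′ , j′ , lab′ , _ , hit′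
      with just-bin (trans (sym lab) eq) | just-bin (trans (sym lab′) eq′)
    ... | refl , refl , refl , refl | refl , refl , refl , refl = trans hit (sym hit′)

  -- If `R` met the fibre, its richness would produce a member of that fibre avoiding `W`, contrary
  -- to `covered`. So `R` survives the deletion intact.
  core-maximal : ∀ (R : Tuple n k → Set) → (∀ {F} → R F → F ∈ P) →
    (∀ {x y} → (x , y) ∈ J → Rich s R (Pair x y)) → ∀ {F} → R F → label F ≡ nothing
  core-maximal R R⊆P rich RF = trans (off-fibre (avoid RF)) (R.core-maximal R (λ RF → P′⁺ (R⊆P RF) (avoid RF)) rich RF)
    where
    avoid : ∀ {F} → R F → ¬ Fibre F
    avoid RF f with rich xy∈J _ RF W
    ... | F′ , RF′ , ag , av with covered F′ (R⊆P RF′) (agree-trans f ag)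
    ... | c , j , Xc , eq = av c Xc j eq

_≟ᵇ_ : ∀ {k s} → DecidableEquality (Maybe (Bin k s))
_≟ᵇ_ = Maybe.≡-dec (Prod.≡-dec (Prod.≡-dec Fin._≟_ Fin._≟_) (Prod.≡-dec Fin._≟_ Fin._≟_))

bins : ∀ {k} s → List (Fin k × Fin k) → List (Bin k s)
bins {k} s J = cartesianProduct J (cartesianProduct (allFin k) (allFin s))

length-bins : ∀ {k} s (J : List (Fin k × Fin k)) → length (bins s J) ≡ length J * (k * s)
length-bins {k} s J = trans (length-cartesianProductWith _,_ J _) (cong (length J *_)
  (trans (length-cartesianProductWith _,_ (allFin k) (allFin s)) (cong₂ _*_ (length-allFin k) (length-allFin s))))

∈-bins : ∀ {k s J} {x y : Fin k} {b j} → (x , y) ∈ J → ((x , y) , (b , j)) ∈ bins s J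
∈-bins xy∈J = ∈-cartesianProduct⁺ xy∈J (∈-cartesianProduct⁺ (∈-allFin _) (∈-allFin _))

Dichotomous : ∀ {n k} → ℕ → (Tuple n k → Set) → Fin k × Fin k → Set
Dichotomous s P (x , y) = Rich s P (Pair x y) ⊎ Dep P x y x ⊎ Dep P x y y

Dependent : ∀ {n k} → (Tuple n k → Set) → Fin k × Fin k → Set
Dependent P (x , y) = Dep P x y x ⊎ Dep P x y y

dep-⊆ : ∀ {n k} {P Q : Tuple n k → Set} → (∀ {F} → P F → Q F) → ∀ xy → Dependent Q xy → Dependent P xy
dep-⊆ P⊆Q _ (inj₁ dep) = inj₁ λ F F′ PF PF′ → dep F F′ (P⊆Q PF) (P⊆Q PF′)
dep-⊆ P⊆Q _ (inj₂ dep) = inj₂ λ F F′ PF PF′ → dep F F′ (P⊆Q PF) (P⊆Q PF′)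

opaque

  -- With i pairs left, a family splits into 1 + i k s parts: the core, and one bin for each pair,
  -- coordinate and index into the covering vector.
  lossFactor : ℕ → ℕ → ℕ → ℕ
  lossFactor k s zero    = 1
  lossFactor k s (suc ℓ) = suc (suc ℓ * (k * s)) * lossFactor k s ℓ

  lossFactor≥1 : ∀ k s ℓ → 1 ≤ lossFactor k s ℓ
  lossFactor≥1 k s zero    = ≤-refl
  lossFactor≥1 k s (suc ℓ) = ≤-trans (lossFactor≥1 k s ℓ) (m≤m+n _ _)

  -- A core is rich for all pairs still in `J`. A bin has acquired a dependency for its pair, which
  -- every subfamily inherits, so it is cleaned again for the other pairs only; the depth of the
  -- recursion is the number of pairs.
  dichotomy : ∀ {n k} s ℓ (J : List (Fin k × Fin k)) → length J ≡ ℓ → (B : ℕ) (G : List (Tuple n k)) → Unique G →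
    (∀ P → Unique P → (∀ {F} → F ∈ P → F ∈ G) → (∀ xy → xy ∈ J → Dichotomous s (_∈ P) xy) → length P ≤ B) →
    length G ≤ lossFactor k s ℓ * B
  dichotomy s zero [] eq B G uG small = ≤-trans (small G uG id λ _ ()) (≤-reflexive (sym (*-identityˡ B)))
  dichotomy {n} {k} s (suc ℓ) J eqJ B G uG small = begin
    length G ≤⟨ fibre-upper _≟ᵇ_ L.label (nothing ∷ map just (bins s J)) uG into part ⟩
    length (nothing ∷ map just (bins s J)) * (lossFactor k s ℓ * B)
      ≡⟨ cong (λ z → suc z * (lossFactor k s ℓ * B)) (trans (length-map just (bins s J)) (length-bins s J)) ⟩
    suc (length J * (k * s)) * (lossFactor k s ℓ * B)
      ≡⟨ cong (λ z → suc (z * (k * s)) * (lossFactor k s ℓ * B)) eqJ ⟩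
    suc (suc ℓ * (k * s)) * (lossFactor k s ℓ * B)
      ≡⟨ sym (*-assoc (suc (suc ℓ * (k * s))) (lossFactor k s ℓ) B) ⟩
    lossFactor k s (suc ℓ) * B ∎
    where
    open ≤-Reasoning
    module L = Cleaning (clean s J (length G) G ≤-refl)
    into : ∀ {F} → F ∈ G → L.label F ∈ nothing ∷ map just (bins s J)
    into {F} F∈G with L.label F in eq
    ... | nothing = here refl
    ... | just ((x , y) , (b , j)) = there (∈-map⁺ just (∈-bins (proj₁ (L.bin-valid F∈G eq))))
    part : ∀ b → b ∈ nothing ∷ map just (bins s J) → ∀ ys → Unique ys →
      (∀ {F} → F ∈ ys → F ∈ G × L.label F ≡ b) → length ys ≤ lossFactor k s ℓ * B
    part nothing b∈ ys uys sub = begin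
      length ys                 ≤⟨ unique-⊆-length uys (λ F∈ → let F∈G , lab = sub F∈ in ∈-filter⁺ core? F∈G lab) ⟩
      length core               ≤⟨ small core (Uniq.filter⁺ core? uG) (proj₁ ∘ core⁻) (λ { (x , y) xy∈J → inj₁ (rich xy∈J) }) ⟩
      B                         ≡⟨ sym (*-identityˡ B) ⟩
      1 * B                     ≤⟨ *-monoˡ-≤ B (lossFactor≥1 k s ℓ) ⟩
      lossFactor k s ℓ * B      ∎
      where
      core? : ∀ F → Dec (L.label F ≡ nothing)
      core? F = L.label F ≟ᵇ nothing
      core : List (Tuple n k)
      core = filter core? G
      core⁻ : ∀ {F} → F ∈ core → F ∈ G × L.label F ≡ nothing
      core⁻ = ∈-filter⁻ core? {xs = G}
      rich : ∀ {x y} → (x , y) ∈ J → Rich s (_∈ core) (Pair x y)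
      rich xy∈J F F∈ W = let F′ , (F′∈ , lab) , rest = L.core-rich xy∈J F (core⁻ F∈) W in
        F′ , ∈-filter⁺ core? F′∈ lab , rest
    part (just ((x , y) , (b , j))) b∈ [] uys sub = z≤n
    part (just ((x , y) , (b , j))) b∈ ys@(F₀ ∷ _) uys sub
      with L.bin-valid (proj₁ (sub (here refl))) (proj₂ (sub (here refl)))
    ... | xy∈J , b∈xy with ∈-∃++ xy∈J
    ... | J₁ , J₂ , refl = dichotomy s ℓ (J₁ ++ J₂) (suc-injective (trans (sym length-J) eqJ)) B ys uys λ P uP P⊆ys dich →
      small P uP (λ F∈ → proj₁ (sub (P⊆ys F∈))) (extend P P⊆ys dich)
      where
      length-J : length (J₁ ++ (x , y) ∷ J₂) ≡ suc (length (J₁ ++ J₂))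
      length-J = trans (length-++ J₁) (trans (+-suc (length J₁) _) (cong suc (sym (length-++ J₁))))
      dependent : Pair x y b → Dependent (_∈ ys) (x , y)
      dependent (inj₁ refl) = inj₁ λ F F′ F∈ F′∈ → L.bin-dep F F′ (sub F∈) (sub F′∈)
      dependent (inj₂ refl) = inj₂ λ F F′ F∈ F′∈ → L.bin-dep F F′ (sub F∈) (sub F′∈)
      extend : ∀ P → (∀ {F} → F ∈ P → F ∈ ys) → (∀ xy → xy ∈ J₁ ++ J₂ → Dichotomous s (_∈ P) xy) →
        ∀ xy → xy ∈ J₁ ++ (x , y) ∷ J₂ → Dichotomous s (_∈ P) xy
      extend P P⊆ys dich uv uv∈ with ∈-++⁻ J₁ uv∈
      ... | inj₁ uv∈J₁         = dich uv (∈-++⁺ˡ uv∈J₁)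
      ... | inj₂ (there uv∈J₂) = dich uv (∈-++⁺ʳ J₁ uv∈J₂)
      ... | inj₂ (here refl)   = inj₂ (dep-⊆ P⊆ys (x , y) (dependent b∈xy))

-- Rich families of tuples

rich-resp : ∀ {n k} s {P : Tuple n k → Set} {X X′ : Fin k → Set} →
  (∀ c → X c → X′ c) → (∀ c → X′ c → X c) → Rich s P X → Rich s P X′
rich-resp s to from rich F PF W = let F′ , PF′ , ag , av = rich F PF W in
  F′ , PF′ , agreeing (λ c ¬X′c → agree ag c (¬X′c ∘ to c)) , λ c X′c → av c (from c X′c)

rich-∅ : ∀ {n k} s {P : Tuple n k → Set} {X : Fin k → Set} → (∀ c → ¬ X c) → Rich s P X
rich-∅ s empty F PF W = F , PF , agree-refl , λ c Xc → contradiction Xc (empty c)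

-- The two replacements are made in succession. The second may overwrite values chosen by the first,
-- but only at positions of `X′`, where it avoids `W` itself.
rich-∪ : ∀ {n k} s {P : Tuple n k → Set} {X X′ : Fin k → Set} → Decidable X′ →
  Rich s P X → Rich s P X′ → Rich s P (λ c → X c ⊎ X′ c)
rich-∪ s {X = X} {X′} X′? rich rich′ F PF W with rich F PF W
... | F′ , PF′ , ag , av with rich′ F′ PF′ W
... | F″ , PF″ , ag′ , av′ = F″ , PF″ ,
  agreeing (λ c ¬X → trans (agree ag c (¬X ∘ inj₁)) (agree ag′ c (¬X ∘ inj₂))) , avoid
  where
  avoid : Avoids (λ c → X c ⊎ X′ c) F″ W
  avoid c Xc j eq with X′? c | Xc
  ... | yes X′c | _        = av′ c X′c j eq
  ... | no ¬X′c | inj₁ Xc  = av c Xc j (trans (agree ag′ c ¬X′c) eq)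
  ... | no ¬X′c | inj₂ X′c = ¬X′c X′c

-- Reduces arbitrary sets of positions to the pairs that cleaning controls: `u` and `v` choose, for
-- each position of `X`, a rich pair inside `X` containing it, and `X` is the union of these pairs.
rich-from-pairs : ∀ {n k} s {P : Tuple n k → Set} {X : Fin k → Set} → Decidable X → (u v : Fin k → Fin k) →
  (∀ b → X b → Pair (u b) (v b) b × (∀ c → Pair (u b) (v b) c → X c) × Rich s P (Pair (u b) (v b))) →
  Rich s P X
rich-from-pairs {n} {k} s {P} {X} X? u v pieces =
  rich-resp s (λ c → sound (allFin k)) (λ c → complete (∈-allFin c)) (richUnion (allFin k))
  where
  Union : List (Fin k) → Fin k → Set
  Union []       c = ⊥
  Union (b ∷ bs) c = Union bs c ⊎ (X b × Pair (u b) (v b) c)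
  richUnion : ∀ bs → Rich s P (Union bs)
  richUnion []       = rich-∅ s λ _ ()
  richUnion (b ∷ bs) = rich-∪ s (λ c → X? b ×-dec pair? (u b) (v b) c) (richUnion bs) (piece (X? b))
    where
    piece : Dec (X b) → Rich s P (λ c → X b × Pair (u b) (v b) c)
    piece (yes Xb) = rich-resp s (λ c p → Xb , p) (λ c → proj₂) (proj₂ (proj₂ (pieces b Xb)))
    piece (no ¬Xb) = rich-∅ s λ c → ¬Xb ∘ proj₁
  sound : ∀ {c} bs → Union bs c → X c
  sound (b ∷ bs) (inj₁ Uc)       = sound bs Uc
  sound (b ∷ bs) (inj₂ (Xb , p)) = proj₁ (proj₂ (pieces b Xb)) _ p
  complete : ∀ {c bs} → c ∈ bs → X c → Union bs c
  complete (here refl) Xc = inj₂ (Xc , proj₁ (pieces _ Xc))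
  complete (there c∈)  Xc = inj₁ (complete c∈ Xc)

-- `X` is the set of positions omitted from the kernel. Accordingly `RichOver` and `RichOff` below
-- are the cases (i) and (ii) of the overview, and here every restriction is a kernel.
FullyRich : ∀ {n k} → ℕ → (Tuple n k → Set) → Set₁
FullyRich s P = ∀ X → Decidable X → Rich s P X

RichOver : ∀ {n k} → ℕ → (Tuple n k → Set) → Fin k → Fin k → Set₁
RichOver s P y y′ = ∀ X → Decidable X → X y → X y′ → Rich s P X

RichOff : ∀ {n k} → ℕ → (Tuple n k → Set) → Fin k → Set₁
RichOff s P z = ∀ X → Decidable X → ¬ X z → Rich s P X

singles-rich : ∀ {n k} s {P : Tuple n k → Set} (X : Fin k → Set) → Decidable X →
  (∀ b → X b → Rich s P (Pair b b)) → Rich s P X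
singles-rich s X X? rich = rich-from-pairs s X? id id λ b Xb →
  inj₁ refl , (λ { c (inj₁ refl) → Xb ; c (inj₂ refl) → Xb }) , rich b Xb

removeAt-≡⇒agree : ∀ {n k} {F F′ : Tuple n (suc k)} x → removeAt F x ≡ removeAt F′ x → AgreeOff (Pair x x) F F′
removeAt-≡⇒agree {F = F} {F′} x eq = agreeing λ c c∉ → let x≢c = λ x≡c → c∉ (inj₁ (sym x≡c)) in
  trans (sym (removeAt-punchOut F x≢c)) (trans (cong (λ V → lookup V (punchOut x≢c)) eq) (removeAt-punchOut F′ x≢c))

lookup-removeAt : ∀ {A : Set} {k} (F : Vec A (suc k)) x i → lookup (removeAt F x) i ≡ lookup F (punchIn x i)
lookup-removeAt F x i = trans (cong (lookup (removeAt F x)) (sym (Fin.punchOut-punchIn x)))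
  (removeAt-punchOut F (Fin.punchInᵢ≢i x i ∘ sym))

agree⇒removeAt-≡ : ∀ {n k} {F F′ : Tuple n (suc k)} x → AgreeOff (Pair x x) F F′ → removeAt F x ≡ removeAt F′ x
agree⇒removeAt-≡ {F = F} {F′} x ag = lookup-ext λ i → trans (lookup-removeAt F x i)
  (trans (agree ag _ λ { (inj₁ eq) → Fin.punchInᵢ≢i x i eq ; (inj₂ eq) → Fin.punchInᵢ≢i x i eq })
    (sym (lookup-removeAt F′ x i)))

determined-length : ∀ {n k} (b : Fin (suc k)) (P : List (Tuple n (suc k))) → Unique P →
  Dep (_∈ P) b b b → length P ≤ n ^ k
determined-length {n} {k} b P uP dep = subst (length P ≤_) (length-all-vectors n k)
  (injection-length (λ F → removeAt F b) uP inj λ _ → ∈-all-vectors _)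
  where
  inj : ∀ {F F′} → F ∈ P → F′ ∈ P → removeAt F b ≡ removeAt F′ b → F ≡ F′
  inj {F} {F′} F∈ F′∈ eq = lookup-ext pointwise
    where
    ag = removeAt-≡⇒agree b eq
    pointwise : ∀ c → lookup F c ≡ lookup F′ c
    pointwise c with c Fin.≟ b
    ... | yes refl = dep F F′ F∈ F′∈ ag
    ... | no  c≢b  = agree ag c λ { (inj₁ e) → c≢b e ; (inj₂ e) → c≢b e }

-- The positions other than x and y already determine the tuple: the first dependency recovers
-- coordinate x from them, and only then does the second, which needs coordinate x, recover
-- coordinate y.
doubly-determined-length : ∀ {n k} {x y : Fin (suc (suc k))} → x ≢ y → (P : List (Tuple n (suc (suc k)))) → Unique P →
  Dep (_∈ P) x y x → Dep (_∈ P) y y y → length P ≤ n ^ k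
doubly-determined-length {n} {k} {x} {y} x≢y P uP depx depy = subst (length P ≤_) (length-all-vectors n k)
  (injection-length (λ F → removeAt (removeAt F x) (punchOut x≢y)) uP inj λ _ → ∈-all-vectors _)
  where
  inj : ∀ {F F′} → F ∈ P → F′ ∈ P →
    removeAt (removeAt F x) (punchOut x≢y) ≡ removeAt (removeAt F′ x) (punchOut x≢y) → F ≡ F′
  inj {F} {F′} F∈ F′∈ eq = lookup-ext pointwise
    where
    off : ∀ c → c ≢ x → c ≢ y → lookup F c ≡ lookup F′ c
    off c c≢x c≢y = trans (sym (removeAt-punchOut F x≢c))
      (trans (agree (removeAt-≡⇒agree {F = removeAt F x} {removeAt F′ x} (punchOut x≢y) eq) (punchOut x≢c) λ { (inj₁ e) → ne e ; (inj₂ e) → ne e })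
        (removeAt-punchOut F′ x≢c))
      where
      x≢c : x ≢ c
      x≢c = c≢x ∘ sym
      ne : punchOut x≢c ≢ punchOut x≢y
      ne e = c≢y (Fin.punchOut-injective x≢c x≢y e)
    at-x : lookup F x ≡ lookup F′ x
    at-x = depx F F′ F∈ F′∈ (agreeing λ c c∉ → off c (c∉ ∘ inj₁) (c∉ ∘ inj₂))
    off-y : ∀ c → c ≢ y → lookup F c ≡ lookup F′ c
    off-y c c≢y with c Fin.≟ x
    ... | yes refl = at-x
    ... | no  c≢x  = off c c≢x c≢y
    pointwise : ∀ c → lookup F c ≡ lookup F′ c
    pointwise c with c Fin.≟ y
    ... | yes refl = depy F F′ F∈ F′∈ (agreeing λ c c∉ → off-y c (c∉ ∘ inj₁))
    ... | no  c≢y  = off-y c c≢y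

nonempty-if : ∀ {A : Set} {m} (P : List A) → ¬ length P ≤ m → ∃[ x ] (x ∈ P)
nonempty-if []      ¬le = contradiction z≤n ¬le
nonempty-if (x ∷ _) ¬le = x , here refl

-- Only single positions are cleaned. In a part with more than n^k tuples no coordinate is
-- determined by the others, so each position is rich, and unions give all sets of positions.
fully-rich-free-length : ∀ {n k} s (G : List (Tuple n (suc k))) → Unique G →
  (∀ P → (∀ {F} → F ∈ P → F ∈ G) → ∀ {F} → F ∈ P → ¬ FullyRich s (_∈ P)) →
  length G ≤ lossFactor (suc k) s (suc k) * n ^ k
fully-rich-free-length {n} {k} s G uG none =
  dichotomy s (suc k) J (trans (length-map (λ b → b , b) (allFin (suc k))) (length-allFin (suc k))) (n ^ k) G uG λ P uP P⊆G dich →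
    decidable-stable (length P ≤? n ^ k) λ ¬le →
      none P P⊆G (proj₂ (nonempty-if P ¬le)) λ X X? → singles-rich s X X? λ b _ → single P uP ¬le b (dich (b , b) (b∈J b))
  where
  J : List (Fin (suc k) × Fin (suc k))
  J = map (λ b → b , b) (allFin (suc k))
  b∈J : ∀ b → (b , b) ∈ J
  b∈J b = ∈-map⁺ (λ b → b , b) (∈-allFin b)
  single : ∀ P → Unique P → ¬ length P ≤ n ^ k → ∀ b → Dichotomous s (_∈ P) (b , b) → Rich s (_∈ P) (Pair b b)
  single P uP ¬le b (inj₁ rich)       = rich
  single P uP ¬le b (inj₂ (inj₁ dep)) = contradiction (determined-length b P uP dep) ¬le
  single P uP ¬le b (inj₂ (inj₂ dep)) = contradiction (determined-length b P uP dep) ¬le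

-- All pairs are cleaned, which leaves parts where each position is rich or determined by the
-- others. In a part with more than n^q tuples, at most one determined position gives `RichOff`
-- there, and two of them give `RichOver`.
typed-free-length : ∀ {n q} s (G : List (Tuple n (suc (suc q)))) → Unique G →
  (∀ P → (∀ {F} → F ∈ P → F ∈ G) → ∀ {F} → F ∈ P → ∀ y y′ → y ≢ y′ → ¬ RichOver s (_∈ P) y y′) →
  (∀ P → (∀ {F} → F ∈ P → F ∈ G) → ∀ {F} → F ∈ P → ∀ z → ¬ RichOff s (_∈ P) z) →
  length G ≤ lossFactor (suc (suc q)) s (suc (suc q) * suc (suc q)) * n ^ q
typed-free-length {n} {q} s G uG noOver noOff = dichotomy s (k * k) J
  (trans (length-cartesianProductWith _,_ (allFin k) (allFin k)) (cong₂ _*_ (length-allFin k) (length-allFin k)))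
  (n ^ q) G uG λ P uP P⊆G dich → decidable-stable (length P ≤? n ^ q) λ ¬le →
    contra P uP P⊆G (λ x y → dich (x , y) (∈-cartesianProduct⁺ (∈-allFin x) (∈-allFin y))) ¬le
  where
  k = suc (suc q)
  J = cartesianProduct (allFin k) (allFin k)
  module _ (P : List (Tuple n k)) (uP : Unique P) (P⊆G : ∀ {F} → F ∈ P → F ∈ G)
           (dich : ∀ x y → Dichotomous s (_∈ P) (x , y)) (¬le : ¬ length P ≤ n ^ q) where
    R D : Fin k → Set
    R b = Rich s (_∈ P) (Pair b b)
    D b = Dep (_∈ P) b b b
    single : ∀ b → R b ⊎ D b
    single b with dich b b
    ... | inj₁ rich       = inj₁ rich
    ... | inj₂ (inj₁ dep) = inj₂ dep
    ... | inj₂ (inj₂ dep) = inj₂ dep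
    dep-swap : ∀ {x y b} → Dep (_∈ P) x y b → Dep (_∈ P) y x b
    dep-swap dep F F′ F∈ F′∈ ag = dep F F′ F∈ F′∈ (agreeing λ c c∉ → agree ag c λ where
      (inj₁ e) → c∉ (inj₂ e)
      (inj₂ e) → c∉ (inj₁ e))
    -- A dependency inside the pair, followed by the dependency of the other position on all the
    -- rest, would leave at most n^q tuples.
    pair-rich : ∀ {x y} → x ≢ y → D x → D y → Rich s (_∈ P) (Pair x y)
    pair-rich {x} {y} x≢y Dx Dy with dich x y
    ... | inj₁ rich       = rich
    ... | inj₂ (inj₁ dep) = contradiction (doubly-determined-length x≢y P uP dep Dy) ¬le
    ... | inj₂ (inj₂ dep) = contradiction (doubly-determined-length (x≢y ∘ sym) P uP (dep-swap dep) Dx) ¬le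
    two : ∀ y y′ → y ≢ y′ → D y → D y′ → RichOver s (_∈ P) y y′
    two y y′ y≢y′ Dy Dy′ X X? Xy Xy′ =
      rich-from-pairs s X? (λ b → proj₁ (piece b)) (λ b → proj₁ (proj₂ (piece b))) λ b Xb →
        let _ , _ , b∈ , sub , rich = piece b in b∈ , sub Xb , rich
      where
      -- A rich position is covered by itself, the position y by {y, y′}, and any other determined
      -- position b by {y, b}. This is why `X` has to contain both y and y′.
      piece : ∀ b → ∃[ u ] ∃[ v ] (Pair u v b × (X b → ∀ c → Pair u v c → X c) × Rich s (_∈ P) (Pair u v))
      piece b with single b | b Fin.≟ y
      ... | inj₁ Rb | _ = b , b , inj₁ refl , (λ { Xb c (inj₁ refl) → Xb ; Xb c (inj₂ refl) → Xb }) , Rb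
      ... | inj₂ _  | yes refl = y , y′ , inj₁ refl , (λ { _ c (inj₁ refl) → Xy ; _ c (inj₂ refl) → Xy′ }) ,
        pair-rich y≢y′ Dy Dy′
      ... | inj₂ Db | no b≢y = y , b , inj₂ refl , (λ { Xb c (inj₁ refl) → Xy ; Xb c (inj₂ refl) → Xb }) ,
        pair-rich (b≢y ∘ sym) Dy Db
    one : ∀ z → (∀ b → b ≢ z → R b) → RichOff s (_∈ P) z
    one z rich X X? ¬Xz = singles-rich s X X? λ b Xb → rich b λ { refl → ¬Xz Xb }
    contra : ⊥
    contra with all-or-any {P = R} {Q = D} (allFin k) single
    -- With every position rich, any position may serve as z.
    ... | inj₁ allR = noOff P P⊆G (proj₂ (nonempty-if P ¬le)) zero (one zero λ b _ → allR b (∈-allFin b))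
    ... | inj₂ (y , _ , Dy) with all-or-any {P = λ b → b ≡ y ⊎ R b} {Q = λ b → b ≢ y × D b} (allFin k) other
      where
      other : ∀ b → (b ≡ y ⊎ R b) ⊎ (b ≢ y × D b)
      other b with b Fin.≟ y | single b
      ... | yes e | _       = inj₁ (inj₁ e)
      ... | no _  | inj₁ Rb = inj₁ (inj₂ Rb)
      ... | no ne | inj₂ Db = inj₂ (ne , Db)
    ... | inj₁ rest = noOff P P⊆G (proj₂ (nonempty-if P ¬le)) y (one y λ b b≢y → pick b≢y (rest b (∈-allFin b)))
      where
      pick : ∀ {b} → b ≢ y → b ≡ y ⊎ R b → R b
      pick b≢y (inj₁ e)  = contradiction e b≢y
      pick b≢y (inj₂ Rb) = Rb
    ... | inj₂ (y′ , _ , y′≢y , Dy′) =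
      noOver P P⊆G (proj₂ (nonempty-if P ¬le)) y y′ (y′≢y ∘ sym) (two y y′ (y′≢y ∘ sym) Dy Dy′)

-- Colouring and embedding hypergraph trees

-- The edges are lists in tree order, with no demand of uniformity or distinctness. This lets the
-- embeddings below truncate the edges of the host tree.
Tree : ∀ {M t} → (Fin M → List (Fin t)) → Set
Tree S = ∀ i → 0 < toℕ i → ∃[ α ] (toℕ α < toℕ i ×
  (∀ x → x ∈ S i → (∃[ j ] (toℕ j < toℕ i × x ∈ S j)) → x ∈ S α))

InjectiveOn : ∀ {A B : Set} → (A → B) → List A → Set
InjectiveOn f xs = ∀ x y → x ∈ xs → y ∈ xs → f x ≡ f y → x ≡ y

extend-colouring : ∀ {t k} (χ : Fin t → Fin k) (xs ys : List (Fin t)) → Unique xs →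
  (∀ {x} → x ∈ xs → x ∉ ys) → length xs + length ys ≤ k → InjectiveOn χ ys →
  ∃[ χ′ ] ((∀ x → x ∉ xs → χ′ x ≡ χ x) × InjectiveOn χ′ (xs ++ ys))
extend-colouring χ [] ys u disj le inj = χ , (λ _ _ → refl) , inj
extend-colouring {t} {k} χ (x ∷ xs) ys u@(_ ∷ u′) disj le inj
  with fresh (map χ ys) (subst (_< k) (sym (length-map χ ys)) (≤-trans (s≤s (m≤n+m (length ys) (length xs))) le))
... | c , c∉ = step (extend-colouring χ₁ xs (x ∷ ys) u′ disj₁ le₁ inj₁′)
  where
  colour : ∀ u → Dec (u ≡ x) → Fin k
  colour u (yes _) = c
  colour u (no _)  = χ u
  χ₁ : Fin t → Fin k
  χ₁ u = colour u (u Fin.≟ x)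
  χ₁-x : χ₁ x ≡ c
  χ₁-x with x Fin.≟ x
  ... | yes _ = refl
  ... | no ne = contradiction refl ne
  χ₁-off : ∀ {u} → u ≢ x → χ₁ u ≡ χ u
  χ₁-off {u} u≢x with u Fin.≟ x
  ... | yes e = contradiction e u≢x
  ... | no _  = refl
  disj₁ : ∀ {u} → u ∈ xs → u ∉ x ∷ ys
  disj₁ u∈ (here refl)  = Unique[x∷xs]⇒x∉xs u u∈
  disj₁ u∈ (there u∈ys) = disj (there u∈) u∈ys
  le₁ : length xs + suc (length ys) ≤ k
  le₁ = subst (_≤ k) (sym (+-suc (length xs) (length ys))) le
  ≢x : ∀ {u} → u ∈ ys → u ≢ x
  ≢x u∈ refl = disj (here refl) u∈
  inj₁′ : InjectiveOn χ₁ (x ∷ ys)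
  inj₁′ a b (here refl) (here refl) eq = refl
  inj₁′ a b (here refl) (there b∈)  eq =
    contradiction (subst (_∈ map χ ys) (trans (sym (χ₁-off (≢x b∈))) (trans (sym eq) χ₁-x)) (∈-map⁺ χ b∈)) c∉
  inj₁′ a b (there a∈)  (here refl) eq =
    contradiction (subst (_∈ map χ ys) (trans (sym (χ₁-off (≢x a∈))) (trans eq χ₁-x)) (∈-map⁺ χ a∈)) c∉
  inj₁′ a b (there a∈)  (there b∈)  eq = inj a b a∈ b∈ (trans (sym (χ₁-off (≢x a∈))) (trans eq (χ₁-off (≢x b∈))))
  step : ∃[ χ′ ] ((∀ u → u ∉ xs → χ′ u ≡ χ₁ u) × InjectiveOn χ′ (xs ++ x ∷ ys)) →
    ∃[ χ′ ] ((∀ u → u ∉ x ∷ xs → χ′ u ≡ χ u) × InjectiveOn χ′ (x ∷ xs ++ ys))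
  step (χ′ , off , inj′) = χ′ ,
    (λ u u∉ → trans (off u (u∉ ∘ there)) (χ₁-off (u∉ ∘ here))) ,
    λ a b a∈ b∈ → inj′ a b (move a∈) (move b∈)
    where
    move : ∀ {u} → u ∈ x ∷ xs ++ ys → u ∈ xs ++ x ∷ ys
    move (here refl) = ∈-++⁺ʳ xs (here refl)
    move (there u∈) with ∈-++⁻ xs u∈
    ... | inj₁ u∈xs = ∈-++⁺ˡ u∈xs
    ... | inj₂ u∈ys = ∈-++⁺ʳ xs (there u∈ys)

below-suc : ∀ {M b} (i : Fin M) (b<M : b < M) → toℕ i < suc b → toℕ i < b ⊎ i ≡ fromℕ< b<M
below-suc i b<M i< with m≤n⇒m<n∨m≡n (≤-pred i<)
... | inj₁ i<b = inj₁ i<b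
... | inj₂ i≡b = inj₂ (Fin.toℕ-injective (trans i≡b (sym (Fin.toℕ-fromℕ< b<M))))

-- Edges are coloured in tree order. A new edge meets the earlier ones only inside one edge `S α`,
-- where the colouring is injective already; its other vertices are new and take colours not yet
-- present on it.
tree-colouring : ∀ {M t k} (S : Fin M → List (Fin t)) → Tree S → (∀ i → Unique (S i)) →
  (∀ i → length (S i) ≤ suc k) → ∃[ χ ] (∀ i → InjectiveOn {B = Fin (suc k)} χ (S i))
tree-colouring {M} {t} {k} S tree uS small =
  let χ , inj = prefix M ≤-refl in χ , λ i → inj i (Fin.toℕ<n i)
  where
  Good : ℕ → (Fin t → Fin (suc k)) → Set
  Good b χ = ∀ i → toℕ i < b → InjectiveOn χ (S i)
  prefix : ∀ b → b ≤ M → ∃[ χ ] Good b χ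
  prefix zero    _   = (λ _ → zero) , λ _ ()
  prefix (suc b) b<M with prefix b (<⇒≤ b<M)
  ... | χ , good = χ′ , good′
    where
    i₀ : Fin M
    i₀ = fromℕ< b<M
    earlier : ∀ {j} → toℕ j < b → toℕ j < toℕ i₀
    earlier = subst (_ <_) (sym (Fin.toℕ-fromℕ< b<M))
    -- The first edge has nothing to agree with, so its anchor is empty.
    anchor : ∃[ A ] ((∀ x → x ∈ S i₀ → (∃[ j ] (toℕ j < toℕ i₀ × x ∈ S j)) → x ∈ A) × InjectiveOn χ A)
    anchor with 0 <? toℕ i₀
    ... | no ¬pos = [] , (λ { x _ (j , j< , _) → contradiction (≤-trans (s≤s z≤n) j<) ¬pos }) , λ _ _ ()
    ... | yes pos = let α , α< , absorb = tree i₀ pos in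
      S α , absorb , good α (subst (toℕ α <_) (Fin.toℕ-fromℕ< b<M) α<)
    A = proj₁ anchor
    absorb = proj₁ (proj₂ anchor)
    A? : ∀ x → Dec (x ∈ A)
    A? x = ∈-dec Fin._≟_ x A
    old new : List (Fin t)
    old = filter A? (S i₀)
    new = filter (¬? ∘ A?) (S i₀)
    extension : ∃[ χ′ ] ((∀ x → x ∉ new → χ′ x ≡ χ x) × InjectiveOn χ′ (new ++ old))
    extension = extend-colouring χ new old (Uniq.filter⁺ (¬? ∘ A?) (uS i₀))
      (λ x∈new x∈old → proj₂ (∈-filter⁻ (¬? ∘ A?) {xs = S i₀} x∈new) (proj₂ (∈-filter⁻ A? {xs = S i₀} x∈old)))
      (subst (_≤ suc k) (trans (length-filter-split A? (S i₀)) (+-comm (length old) (length new))) (small i₀))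
      (λ x y x∈ y∈ → proj₂ (proj₂ anchor) x y (proj₂ (∈-filter⁻ A? {xs = S i₀} x∈)) (proj₂ (∈-filter⁻ A? {xs = S i₀} y∈)))
    χ′ = proj₁ extension
    keep : ∀ {j x} → toℕ j < b → x ∈ S j → χ′ x ≡ χ x
    keep j<b x∈ = proj₁ (proj₂ extension) _ λ x∈new →
      let x∈S , x∉A = ∈-filter⁻ (¬? ∘ A?) {xs = S i₀} x∈new in x∉A (absorb _ x∈S (_ , earlier j<b , x∈))
    locate : ∀ {x} → x ∈ S i₀ → x ∈ new ++ old
    locate {x} x∈ with A? x
    ... | yes x∈A = ∈-++⁺ʳ new (∈-filter⁺ A? x∈ x∈A)
    ... | no  x∉A = ∈-++⁺ˡ (∈-filter⁺ (¬? ∘ A?) x∈ x∉A)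
    good′ : Good (suc b) χ′
    good′ i i< x y x∈ y∈ eq with below-suc i b<M i<
    ... | inj₁ i<b  = good i i<b x y x∈ y∈ (trans (sym (keep i<b x∈)) (trans eq (keep i<b y∈)))
    ... | inj₂ refl = proj₂ (proj₂ extension) x y (locate x∈) (locate y∈) eq

-- The positions to be altered when a tuple placed on the edge `B` is turned into one for the edge
-- `A`. The kernel consists of the colours of common vertices.
Unshared : ∀ {t k} → (Fin t → Fin k) → List (Fin t) → List (Fin t) → Fin k → Set
Unshared χ A B c = ∀ x → x ∈ A → x ∈ B → χ x ≢ c

unshared? : ∀ {t k} (χ : Fin t → Fin k) A B → Decidable (Unshared χ A B)
unshared? χ A B c = Fin.all? λ x → ∈-dec Fin._≟_ x A →-dec (∈-dec Fin._≟_ x B →-dec ¬? (χ x Fin.≟ c))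

LookupInjective : ∀ {n k} → Tuple n k → Set
LookupInjective F = ∀ {c d} → lookup F c ≡ lookup F d → c ≡ d

entries : ∀ {n k M} → (Fin M → Tuple n k) → List (Fin n)
entries {M = M} F = concatMap (toList ∘ F) (allFin M)

length-entries : ∀ {n k M} (F : Fin M → Tuple n k) → length (entries F) ≡ M * k
length-entries {n} {k} {M} F = trans (go (allFin M)) (cong (_* k) (length-allFin M))
  where
  go : ∀ is → length (concatMap (toList ∘ F) is) ≡ length is * k
  go []       = refl
  go (i ∷ is) = trans (length-++ (toList (F i))) (cong₂ _+_ (Vec.length-toList (F i)) (go is))

lookup∈toList : ∀ {A : Set} {k} (V : Vec A k) c → lookup V c ∈ toList V
lookup∈toList (x ∷ V) zero    = here refl
lookup∈toList (x ∷ V) (suc c) = there (lookup∈toList V c)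

∈-entries : ∀ {n k M} (F : Fin M → Tuple n k) i c → lookup (F i) c ∈ entries F
∈-entries {M = M} F i c = ∈-concatMap⁺ (toList ∘ F) {xs = allFin M} (lose (∈-allFin i) (lookup∈toList (F i) c))

-- The colour of a vertex is the position it occupies in the tuples of the edges containing it. Each
-- new tuple arises from that of its anchor by altering the unshared positions so as to avoid all
-- vertices used so far; M tuples have M (k + 1) entries, whence the bound on s.
tree-embedding : ∀ {M t n k} s (S : Fin M → List (Fin t)) → Tree S → (χ : Fin t → Fin (suc k)) →
  (∀ i → InjectiveOn χ (S i)) → (P : Tuple n (suc k) → Set) → (∀ {F} → P F → LookupInjective F) →
  ∃[ F₀ ] P F₀ → (∀ i α → toℕ α < toℕ i → Rich s P (Unshared χ (S i) (S α))) → M * suc k ≤ s →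
  ∃[ F ] ((∀ i → P (F i)) × (∀ i j x y → x ∈ S i → y ∈ S j →
    (lookup (F i) (χ x) ≡ lookup (F j) (χ y) → x ≡ y) × (x ≡ y → lookup (F i) (χ x) ≡ lookup (F j) (χ y))))
tree-embedding {M} {t} {n} {k} s S tree χ χ-inj P P-inj (F₀ , PF₀) rich le =
  let F , PF , cons = prefix M ≤-refl in F , PF , λ i j → cons i j (Fin.toℕ<n i) (Fin.toℕ<n j)
  where
  T = Tuple n (suc k)
  Consistent : T → T → List (Fin t) → List (Fin t) → Set
  Consistent V W A B = ∀ x y → x ∈ A → y ∈ B →
    (lookup V (χ x) ≡ lookup W (χ y) → x ≡ y) × (x ≡ y → lookup V (χ x) ≡ lookup W (χ y))
  consistent-sym : ∀ V W A B → Consistent V W A B → Consistent W V B A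
  consistent-sym V W A B cons y x y∈ x∈ = (λ eq → sym (proj₁ (cons x y x∈ y∈) (sym eq))) , λ eq → sym (proj₂ (cons x y x∈ y∈) (sym eq))
  Good : ℕ → (Fin M → T) → Set
  Good b F = ∀ i j → toℕ i < b → toℕ j < b → Consistent (F i) (F j) (S i) (S j)
  prefix : ∀ b → b ≤ M → ∃[ F ] ((∀ i → P (F i)) × Good b F)
  prefix zero    _   = (λ _ → F₀) , (λ _ → PF₀) , λ _ _ ()
  prefix (suc b) b<M with prefix b (<⇒≤ b<M)
  ... | F , PF , good = F′ , PF′ , good′
    where
    i₀ : Fin M
    i₀ = fromℕ< b<M
    earlier : ∀ {j} → toℕ j < b → toℕ j < toℕ i₀
    earlier = subst (_ <_) (sym (Fin.toℕ-fromℕ< b<M))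
    next : ∃[ V ] (P V × (∀ j → toℕ j < b → Consistent V (F j) (S i₀) (S j)))
    next with 0 <? toℕ i₀
    ... | no ¬pos = F₀ , PF₀ , λ j j<b → contradiction (≤-trans (s≤s z≤n) (earlier j<b)) ¬pos
    ... | yes pos with tree i₀ pos
    -- The vector lists the entries of all M tuples, those of edges not yet reached being still
    -- `F₀`, so the same s serves in every round.
    ... | α , α<i₀ , absorb with rich i₀ α α<i₀ (F α) (PF α) (pad (lookup F₀ zero) (entries F) s)
    ... | V , PV , ag , av = V , PV , λ j j<b x y x∈ y∈ → old-or-new j j<b x y x∈ y∈ (∈-dec Fin._≟_ x (S α))
      where
      α<b : toℕ α < b
      α<b = subst (toℕ α <_) (Fin.toℕ-fromℕ< b<M) α<i₀
      -- A vertex shared with the anchor keeps its image. Any other vertex of the edge is new to the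
      -- tree, and its position is unshared because `χ` is injective on the edge; hence its image is
      -- fresh.
      old-or-new : ∀ j → toℕ j < b → ∀ x y → x ∈ S i₀ → y ∈ S j → Dec (x ∈ S α) →
        (lookup V (χ x) ≡ lookup (F j) (χ y) → x ≡ y) × (x ≡ y → lookup V (χ x) ≡ lookup (F j) (χ y))
      old-or-new j j<b x y x∈ y∈ (yes x∈α) =
        subst (λ z → (z ≡ lookup (F j) (χ y) → x ≡ y) × (x ≡ y → z ≡ lookup (F j) (χ y)))
          (agree ag (χ x) λ unsh → unsh x x∈ x∈α refl) (good α j α<b j<b x y x∈α y∈)
      old-or-new j j<b x y x∈ y∈ (no x∉α) =
        (λ eq → let l , e = ∈-pad (lookup F₀ zero) s (∈-entries F j (χ y)) (≤-trans (≤-reflexive (length-entries F)) le)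
                in contradiction (trans eq (sym e)) (av (χ x) unshared l)) ,
        (λ { refl → contradiction (absorb x x∈ (j , earlier j<b , y∈)) x∉α })
        where
        unshared : Unshared χ (S i₀) (S α) (χ x)
        unshared x′ x′∈ x′∈α eq = x∉α (subst (_∈ S α) (χ-inj i₀ x′ x x′∈ x∈ eq) x′∈α)
    V = proj₁ next
    PV = proj₁ (proj₂ next)
    choose : ∀ i → Dec (i ≡ i₀) → T
    choose i (yes _) = V
    choose i (no _)  = F i
    F′ : Fin M → T
    F′ i = choose i (i Fin.≟ i₀)
    F′-new : F′ i₀ ≡ V
    F′-new with i₀ Fin.≟ i₀
    ... | yes _ = refl
    ... | no ne = contradiction refl ne
    F′-old : ∀ {i} → toℕ i < b → F′ i ≡ F i
    F′-old {i} i<b with i Fin.≟ i₀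
    ... | yes refl = contradiction (earlier i<b) (<-irrefl refl)
    ... | no _     = refl
    PF′ : ∀ i → P (F′ i)
    PF′ i with i Fin.≟ i₀
    ... | yes _ = PV
    ... | no _  = PF i
    good′ : Good (suc b) F′
    good′ i j i< j< with below-suc i b<M i< | below-suc j b<M j<
    ... | inj₁ i<b  | inj₁ j<b  rewrite F′-old i<b | F′-old j<b = good i j i<b j<b
    ... | inj₂ refl | inj₁ j<b  rewrite F′-new | F′-old j<b = proj₂ (proj₂ next) j j<b
    ... | inj₁ i<b  | inj₂ refl rewrite F′-new | F′-old i<b = consistent-sym V (F i) (S i₀) (S i) (proj₂ (proj₂ next) i i<b)
    ... | inj₂ refl | inj₂ refl rewrite F′-new = λ x y x∈ y∈ → (λ eq → χ-inj i₀ x y x∈ y∈ (P-inj PV eq)) , λ { refl → refl }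

-- Subsets as lists, and completion of partial embeddings

elements : ∀ {n} → Subset n → List (Fin n)
elements []          = []
elements (true ∷ p)  = zero ∷ map suc (elements p)
elements (false ∷ p) = map suc (elements p)

length-elements : ∀ {n} (p : Subset n) → length (elements p) ≡ ∣ p ∣
length-elements []          = refl
length-elements (true ∷ p)  = cong suc (trans (length-map suc (elements p)) (length-elements p))
length-elements (false ∷ p) = trans (length-map suc (elements p)) (length-elements p)

zero∉map-suc : ∀ {n} {xs : List (Fin n)} → Fin.zero ∉ map suc xs
zero∉map-suc {n} z∈ with ∈-map⁻ {A = Fin n} suc z∈
... | _ , _ , ()

unique-elements : ∀ {n} (p : Subset n) → Unique (elements p)
unique-elements []          = []
unique-elements (true ∷ p)  = ∉-unique zero∉map-suc (Uniq.map⁺ Fin.suc-injective (unique-elements p))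
unique-elements (false ∷ p) = Uniq.map⁺ Fin.suc-injective (unique-elements p)

∈-elements⁺ : ∀ {n} {p : Subset n} {x} → x Sub.∈ p → x ∈ elements p
∈-elements⁺ {p = true ∷ p}  {zero}  x∈ = here refl
∈-elements⁺ {p = false ∷ p} {zero}  ()
∈-elements⁺ {p = true ∷ p}  {suc x} x∈ = there (∈-map⁺ suc (∈-elements⁺ (drop-there x∈)))
∈-elements⁺ {p = false ∷ p} {suc x} x∈ = ∈-map⁺ suc (∈-elements⁺ (drop-there x∈))

∈-elements⁻ : ∀ {n} {p : Subset n} {x} → x ∈ elements p → x Sub.∈ p
∈-elements⁻ {p = true ∷ p}  (here refl) = Vec.here
∈-elements⁻ {p = true ∷ p}  (there x∈) with ∈-map⁻ suc x∈
... | y , y∈ , refl = Vec.there (∈-elements⁻ y∈)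
∈-elements⁻ {p = false ∷ p} x∈ with ∈-map⁻ suc x∈
... | y , y∈ , refl = Vec.there (∈-elements⁻ y∈)

fresh-vector : ∀ {n} m (L : List (Fin n)) → m + length L ≤ n →
  ∃[ g ] ((∀ i → lookup {n = m} g i ∉ L) × LookupInjective g)
fresh-vector zero    L le = [] , (λ ()) , λ { {()} }
fresh-vector {n} (suc m) L le with fresh L (≤-trans (s≤s (m≤n+m (length L) m)) le)
... | c , c∉ with fresh-vector m (c ∷ L) (subst (_≤ n) (sym (+-suc m (length L))) le)
... | g , avoid , inj = c ∷ g , avoid′ , inj′
  where
  avoid′ : ∀ i → lookup (c ∷ g) i ∉ L
  avoid′ zero    = c∉
  avoid′ (suc i) = avoid i ∘ there
  inj′ : LookupInjective (c ∷ g)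
  inj′ {zero}  {zero}  eq = refl
  inj′ {zero}  {suc j} eq = contradiction (here (sym eq)) (avoid j)
  inj′ {suc i} {zero}  eq = contradiction (here eq) (avoid i)
  inj′ {suc i} {suc j} eq = cong suc (inj eq)

-- Vertices of H of degree 0 are sent to unused vertices of G; this is what v + v ≤ n is for.
partial-embedding : ∀ {v n r} (H : Hypergraph v) (G : Hypergraph n) → Uniform r H → Uniform r G → v + v ≤ n →
  (f : Fin v → Fin n) →
  (∀ i j x y → x Sub.∈ edge H i → y Sub.∈ edge H j → f x ≡ f y → x ≡ y) →
  (∀ i → ∃[ E ] (IsEdge G E × (∀ x → x Sub.∈ edge H i → f x Sub.∈ E))) →
  Embeds H G
partial-embedding {v} {n} {r} H G uH uG le f inj onEdges
  with fresh-vector v (map f (allFin v)) (subst (λ l → v + l ≤ n) (sym (trans (length-map f (allFin v)) (length-allFin v))) le)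
... | g , avoid , g-inj = f′ , f′-inj , image
  where
  Covered : Fin v → Set
  Covered x = ∃[ i ] (x Sub.∈ edge H i)
  covered? : Decidable Covered
  covered? x = Fin.any? λ i → x ∈? edge H i
  choose : ∀ x → Dec (Covered x) → Fin n
  choose x (yes _) = f x
  choose x (no _)  = lookup g x
  f′ : Fin v → Fin n
  f′ x = choose x (covered? x)
  g≢f : ∀ x y → lookup g x ≢ f y
  g≢f x y eq = avoid x (subst (_∈ map f (allFin v)) (sym eq) (∈-map⁺ f (∈-allFin y)))
  f′-inj : ∀ {x y} → f′ x ≡ f′ y → x ≡ y
  f′-inj {x} {y} eq with covered? x | covered? y
  ... | yes (i , x∈) | yes (j , y∈) = inj i j x y x∈ y∈ eq
  ... | yes _        | no _         = contradiction (sym eq) (g≢f y x)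
  ... | no _         | yes _        = contradiction eq (g≢f x y)
  ... | no _         | no _         = g-inj eq
  f′-covered : ∀ {i x} → x Sub.∈ edge H i → f′ x ≡ f x
  f′-covered {i} {x} x∈ with covered? x
  ... | yes _ = refl
  ... | no ¬c = contradiction (i , x∈) ¬c
  image : ∀ i → ∃[ E ] (ImageIs f′ (edge H i) E × IsEdge G E)
  image i with onEdges i
  ... | E , (e , refl) , into = E , (λ y → mk⇔ (onto y) λ { (x , x∈ , refl) → subst (Sub._∈ E) (sym (f′-covered x∈)) (into x x∈) }) , e , refl
    where
    images = map f (elements (edge H i))
    onto : ∀ y → y Sub.∈ E → ∃[ x ] (x Sub.∈ edge H i × f′ x ≡ y)
    -- The r images are distinct and lie in the r-element set `E`, so they exhaust it; this turns
    -- inclusion into `ImageIs`.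
    onto y y∈ with ∈-map⁻ f (⊆-unique-length⇒⊇ Fin._≟_ {images} {elements E}
        (map-unique f (λ x∈ x′∈ → inj i i _ _ (∈-elements⁻ x∈) (∈-elements⁻ x′∈)) (unique-elements (edge H i)))
        (λ z∈ → let x , x∈ , eq = ∈-map⁻ f z∈ in subst (_∈ elements E) (sym eq) (∈-elements⁺ (into x (∈-elements⁻ x∈))))
        (≤-reflexive (trans (length-elements E) (trans (uG e) (sym (trans (length-map f (elements (edge H i)))
          (trans (length-elements (edge H i)) (uH i)))))))
        (∈-elements⁺ y∈))
    ... | x , x∈ , eq = x , ∈-elements⁻ x∈ , trans (f′-covered (∈-elements⁻ x∈)) (sym eq)

-- Embedding H into rich families of edges

-- Deleting the vertices with a prescribed colour from every edge leaves a tree, which is coloured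
-- with the remaining colours, enumerated by `ι`.
reserved-colouring : ∀ {M t k K} (S : Fin M → List (Fin t)) → Tree S → (∀ i → Unique (S i)) →
  (ψ : Fin t → Maybe (Fin K)) (ι : Fin (suc k) → Fin K) → (∀ {a b} → ι a ≡ ι b → a ≡ b) →
  (∀ x c → ψ x ≢ just (ι c)) → (∀ i x y a → x ∈ S i → y ∈ S i → ψ x ≡ just a → ψ y ≡ just a → x ≡ y) →
  (ψ? : ∀ x → Dec (ψ x ≡ nothing)) → (∀ i → length (filter ψ? (S i)) ≤ suc k) →
  ∃[ χ ] ((∀ i → InjectiveOn {B = Fin K} χ (S i)) × (∀ x a → ψ x ≡ just a → χ x ≡ a))
reserved-colouring {M} {t} {k} {K} S tree uS ψ ι ι-inj ι≢ψ ψ-inj ψ? small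
  with tree-colouring (λ i → filter ψ? (S i)) tree′ (λ i → Uniq.filter⁺ ψ? (uS i)) small
  where
  tree′ : Tree (λ i → filter ψ? (S i))
  tree′ i pos = let α , α< , absorb = tree i pos in α , α< , λ where
    x x∈ (j , j< , x∈j) → ∈-filter⁺ ψ?
      (absorb x (proj₁ (∈-filter⁻ ψ? {xs = S i} x∈)) (j , j< , proj₁ (∈-filter⁻ ψ? {xs = S j} x∈j)))
      (proj₂ (∈-filter⁻ ψ? {xs = S i} x∈))
... | χ₀ , χ₀-inj = χ , χ-inj , χ-reserved
  where
  colour : Maybe (Fin K) → Fin t → Fin K
  colour (just a) x = a
  colour nothing  x = ι (χ₀ x)
  χ : Fin t → Fin K
  χ x = colour (ψ x) x
  χ-reserved : ∀ x a → ψ x ≡ just a → χ x ≡ a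
  χ-reserved x a eq = cong (λ m → colour m x) eq
  χ-inj : ∀ i → InjectiveOn χ (S i)
  χ-inj i x y x∈ y∈ eq with ψ x in eqx | ψ y in eqy
  ... | just a  | just b  = ψ-inj i x y a x∈ y∈ eqx (trans eqy (cong just (sym eq)))
  ... | just a  | nothing = contradiction (trans eqx (cong just eq)) (ι≢ψ x _)
  ... | nothing | just b  = contradiction (trans eqy (cong just (sym eq))) (ι≢ψ y _)
  ... | nothing | nothing = χ₀-inj i x y (∈-filter⁺ ψ? x∈ eqx) (∈-filter⁺ ψ? y∈ eqy) (ι-inj eq)

-- Inclusion in an edge is enough: for k = r an injective tuple fills it, and for the final
-- embedding `partial-embedding` supplies equality.
EdgeTuple : ∀ {n k} → Hypergraph n → Tuple n k → Set
EdgeTuple G F = LookupInjective F × ∃[ E ] (IsEdge G E × (∀ c → lookup F c Sub.∈ E))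

-- The tree `S` is a parameter and may be a modified host, as long as it still contains the images
-- of the edges of `H`.
coloured-embedding : ∀ {v n t M r k} s (H : Hypergraph v) (G : Hypergraph n) → Uniform r H → Uniform r G → v + v ≤ n →
  (S : Fin M → List (Fin t)) → Tree S → (χ : Fin t → Fin (suc k)) → (∀ i → InjectiveOn χ (S i)) →
  (g : Fin v → Fin t) → (∀ {x y} → g x ≡ g y → x ≡ y) →
  (pos : Fin (m H) → Fin M) → (∀ i x → x Sub.∈ edge H i → g x ∈ S (pos i)) →
  (P : Tuple n (suc k) → Set) → (∀ {F} → P F → EdgeTuple G F) → ∃[ F₀ ] P F₀ →
  (∀ i α → toℕ α < toℕ i → Rich s P (Unshared χ (S i) (S α))) → M * suc k ≤ s → Embeds H G
coloured-embedding {v} {n} {t} {M} {r} {k} s H G uH uG le S tree χ χ-inj g g-inj pos into P P-edge (F₀ , PF₀) rich les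
  with tree-embedding s S tree χ χ-inj P (λ PF → proj₁ (P-edge PF)) (F₀ , PF₀) rich les
... | F , PF , cons = partial-embedding H G uH uG le f f-inj onEdges
  where
  choose : ∀ x → Dec (∃[ i ] (g x ∈ S i)) → Fin n
  choose x (yes (i , _)) = lookup (F i) (χ (g x))
  choose x (no _)        = lookup F₀ zero
  f : Fin v → Fin n
  f x = choose x (Fin.any? λ i → ∈-dec Fin._≟_ (g x) (S i))
  f-at : ∀ i x → x Sub.∈ edge H i → f x ≡ lookup (F (pos i)) (χ (g x))
  f-at i x x∈ with Fin.any? (λ i → ∈-dec Fin._≟_ (g x) (S i))
  ... | yes (j , gx∈) = proj₂ (cons j (pos i) (g x) (g x) gx∈ (into i x x∈)) refl
  ... | no ¬c         = contradiction (pos i , into i x x∈) ¬c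
  f-inj : ∀ i j x y → x Sub.∈ edge H i → y Sub.∈ edge H j → f x ≡ f y → x ≡ y
  f-inj i j x y x∈ y∈ eq = g-inj (proj₁ (cons (pos i) (pos j) (g x) (g y) (into i x x∈) (into j y y∈))
    (trans (sym (f-at i x x∈)) (trans eq (f-at j y y∈))))
  onEdges : ∀ i → ∃[ E ] (IsEdge G E × (∀ x → x Sub.∈ edge H i → f x Sub.∈ E))
  onEdges i with P-edge (PF (pos i))
  ... | _ , E , isE , entries∈ = E , isE , λ x x∈ → subst (Sub._∈ E) (sym (f-at i x x∈)) (entries∈ (χ (g x)))

record Host {v} (r : ℕ) (H : Hypergraph v) : Set where
  field
    {t M}     : ℕ
    S         : Fin M → List (Fin t)
    tree      : Tree S
    unique    : ∀ i → Unique (S i)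
    size      : ∀ i → length (S i) ≡ r
    d d′      : Fin M → Fin t
    d∈        : ∀ i → d i ∈ S i
    d′∈       : ∀ i → d′ i ∈ S i
    d≢d′      : ∀ i → d i ≢ d′ i
    d-own     : ∀ {i j} → d i ∈ S j → i ≡ j
    d′-own    : ∀ {i j} → d′ i ∈ S j → i ≡ j
    g         : Fin v → Fin t
    g-inj     : ∀ {x y} → g x ≡ g y → x ≡ y
    pos       : Fin (m H) → Fin M
    pos⁺      : ∀ i x → x Sub.∈ edge H i → g x ∈ S (pos i)
    pos⁻      : ∀ i y → y ∈ S (pos i) → ∃[ x ] (x Sub.∈ edge H i × g x ≡ y)

two-members : ∀ {A : Set} {xs : List A} → Unique xs → 2 ≤ length xs → ∃[ a ] ∃[ b ] (a ∈ xs × b ∈ xs × a ≢ b)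
two-members {xs = _ ∷ []}    u (s≤s ())
two-members {xs = a ∷ b ∷ _} ((a≢b ∷ _) ∷ _) _ = a , b , here refl , there (here refl) , a≢b

length-one-≡ : ∀ {A : Set} {xs : List A} {a b} → length xs ≡ 1 → a ∈ xs → b ∈ xs → a ≡ b
length-one-≡ {xs = _ ∷ []} _ (here refl) (here refl) = refl

∣p∣≡1⇒≡ : ∀ {n} {p : Subset n} {a b} → ∣ p ∣ ≡ 1 → a Sub.∈ p → b Sub.∈ p → a ≡ b
∣p∣≡1⇒≡ {p = p} eq a∈ b∈ = length-one-≡ (trans (length-elements p) eq) (∈-elements⁺ a∈) (∈-elements⁺ b∈)

∈-tabulate-lookup : ∀ {v} (T : Hypergraph v) x i → x Sub.∈ edge T i → i Sub.∈ tabulate (λ i → lookup (edge T i) x)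
∈-tabulate-lookup T x i x∈ = Vec.lookup⇒[]= i _ (trans (Vec.lookup∘tabulate _ i) (Vec.[]=⇒lookup x∈))

degOne-own : ∀ {v} (T : Hypergraph v) {x i j} → x Sub.∈ degOne T → x Sub.∈ edge T i → x Sub.∈ edge T j → i ≡ j
degOne-own T {x} {i} {j} x∈ x∈i x∈j =
  ∣p∣≡1⇒≡ (≡ᵇ⇒≡ (degree T x) 1 (Equivalence.from T-≡ (trans (sym (Vec.lookup∘tabulate _ x)) (Vec.[]=⇒lookup x∈))))
    (∈-tabulate-lookup T x i x∈i) (∈-tabulate-lookup T x j x∈j)

host : ∀ {v} r (H : Hypergraph v) → EmbeddableIn2RedRTree r H → Host r H
host {v} r H (t , T , (uT , π , tree) , red , g , g-inj , emb) = record
  { S      = S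
  ; tree   = λ i pos → let α , α< , absorb = tree i pos in α , α< ,
               λ { x x∈ (j , j< , x∈j) → ∈-elements⁺ (absorb x (∈-elements⁻ x∈) (j , j< , ∈-elements⁻ x∈j)) }
  ; unique = λ i → unique-elements (E i)
  ; size   = λ i → trans (length-elements (E i)) (uT (π ⟨$⟩ʳ i))
  ; d      = λ i → proj₁ (ends i)
  ; d′     = λ i → proj₁ (proj₂ (ends i))
  ; d∈     = λ i → inE i (proj₁ (proj₂ (proj₂ (ends i))))
  ; d′∈    = λ i → inE i (proj₁ (proj₂ (proj₂ (proj₂ (ends i)))))
  ; d≢d′   = λ i → proj₂ (proj₂ (proj₂ (proj₂ (ends i))))
  ; d-own  = λ {i} {j} → own i j (proj₁ (proj₂ (proj₂ (ends i))))
  ; d′-own = λ {i} {j} → own i j (proj₁ (proj₂ (proj₂ (proj₂ (ends i)))))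
  ; g      = g
  ; g-inj  = g-inj
  ; pos    = λ i → π ⟨$⟩ˡ target i
  ; pos⁺   = λ i x x∈ → ∈-elements⁺ (subst (g x Sub.∈_) (sym (E-target i))
               (Equivalence.from (proj₁ (proj₂ (emb i)) (g x)) (x , x∈ , refl)))
  ; pos⁻   = λ i y y∈ → Equivalence.to (proj₁ (proj₂ (emb i)) y) (subst (y Sub.∈_) (E-target i) (∈-elements⁻ y∈))
  }
  where
  E : Fin (m T) → Subset t
  E i = edge T (π ⟨$⟩ʳ i)
  S : Fin (m T) → List (Fin t)
  S i = elements (E i)
  target : Fin (m H) → Fin (m T)
  target i = proj₁ (proj₂ (proj₂ (emb i)))
  E-target : ∀ i → E (π ⟨$⟩ˡ target i) ≡ proj₁ (emb i)
  E-target i = trans (cong (edge T) (inverseʳ π)) (proj₂ (proj₂ (proj₂ (emb i))))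
  D : Fin (m T) → Subset t
  D i = E i Sub.∩ degOne T
  ends : ∀ i → ∃[ a ] ∃[ b ] (a ∈ elements (D i) × b ∈ elements (D i) × a ≢ b)
  ends i = two-members (unique-elements (D i)) (subst (2 ≤_) (sym (length-elements (D i))) (red (π ⟨$⟩ʳ i)))
  inE : ∀ i {a} → a ∈ elements (D i) → a ∈ S i
  inE i a∈ = ∈-elements⁺ (proj₁ (x∈p∩q⁻ (E i) (degOne T) (∈-elements⁻ a∈)))
  own : ∀ i j {a} → a ∈ elements (D i) → a ∈ S j → i ≡ j
  own i j a∈ a∈j = Injection.injective (↔⇒↣ π)
    (degOne-own T (proj₂ (x∈p∩q⁻ (E i) (degOne T) (∈-elements⁻ a∈))) (∈-elements⁻ (inE i a∈)) (∈-elements⁻ a∈j))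

-- The vertices `d i` and `d′ i` lie on no other edge, so the colours y and y′ never occur on the
-- intersection with an anchor. Hence the embedding uses only kernels omitting both positions.
embed-over : ∀ {v n q} s (H : Hypergraph v) (G : Hypergraph n) → Uniform (3 + q) H → Uniform (3 + q) G → v + v ≤ n →
  (h : Host (3 + q) H) → Host.M h * (3 + q) ≤ s → (P : Tuple n (3 + q) → Set) → (∀ {F} → P F → EdgeTuple G F) →
  ∃[ F₀ ] P F₀ → ∀ y y′ → y ≢ y′ → RichOver s P y y′ → Embeds H G
embed-over {v} {n} {q} s H G uH uG le h les P P-edge F₀ y y′ y≢y′ rich =
  coloured-embedding s H G uH uG le S tree χ χ-inj g g-inj pos pos⁺ P P-edge F₀ rich′ les
  where
  open Host h
  D D′ : Fin t → Set
  D x = ∃[ i ] (x ≡ d i)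
  D′ x = ∃[ i ] (x ≡ d′ i)
  D? : Decidable D
  D? x = Fin.any? λ i → x Fin.≟ d i
  D′? : Decidable D′
  D′? x = Fin.any? λ i → x Fin.≟ d′ i
  tag : ∀ {x} → Dec (D x) → Dec (D′ x) → Maybe (Fin (3 + q))
  tag (yes _) _       = just y
  tag (no _)  (yes _) = just y′
  tag (no _)  (no _)  = nothing
  ψ : Fin t → Maybe (Fin (3 + q))
  ψ x = tag (D? x) (D′? x)
  -- Enumerates the r - 2 colours other than y and y′.
  ι : Fin (suc q) → Fin (3 + q)
  ι c = punchIn y (punchIn (punchOut y≢y′) c)
  ι-inj : ∀ {a b} → ι a ≡ ι b → a ≡ b
  ι-inj eq = Fin.punchIn-injective (punchOut y≢y′) _ _ (Fin.punchIn-injective y _ _ eq)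
  ι≢y : ∀ c → y ≢ ι c
  ι≢y c eq = Fin.punchInᵢ≢i y _ (sym eq)
  ι≢y′ : ∀ c → y′ ≢ ι c
  ι≢y′ c eq = Fin.punchInᵢ≢i (punchOut y≢y′) c
    (Fin.punchIn-injective y _ _ (trans (sym eq) (sym (Fin.punchIn-punchOut y≢y′))))
  ι≢ψ : ∀ x c → ψ x ≢ just (ι c)
  ι≢ψ x c eq with D? x | D′? x
  ... | yes _ | _     = ι≢y c (Maybe.just-injective eq)
  ... | no _  | yes _ = ι≢y′ c (Maybe.just-injective eq)
  D-at : ∀ {i x} → x ∈ S i → D x → x ≡ d i
  D-at x∈ (j , refl) = cong d (d-own x∈)
  D′-at : ∀ {i x} → x ∈ S i → D′ x → x ≡ d′ i
  D′-at x∈ (j , refl) = cong d′ (d′-own x∈)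
  ψ-inj : ∀ i u w a → u ∈ S i → w ∈ S i → ψ u ≡ just a → ψ w ≡ just a → u ≡ w
  ψ-inj i u w a u∈ w∈ eu ew with D? u | D′? u | D? w | D′? w
  ... | yes du | _      | yes dw | _      = trans (D-at u∈ du) (sym (D-at w∈ dw))
  ... | no _   | yes du | no _   | yes dw = trans (D′-at u∈ du) (sym (D′-at w∈ dw))
  ... | yes _  | _      | no _   | yes _  = contradiction (Maybe.just-injective (trans eu (sym ew))) y≢y′
  ... | no _   | yes _  | yes _  | _      = contradiction (Maybe.just-injective (trans ew (sym eu))) y≢y′
  ψ? : ∀ x → Dec (ψ x ≡ nothing)
  ψ? x = Maybe.≡-dec Fin._≟_ (ψ x) nothing
  ψ-d : ∀ i → ψ (d i) ≡ just y
  ψ-d i with D? (d i)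
  ... | yes _ = refl
  ... | no ¬D = contradiction (i , refl) ¬D
  ψ-d′ : ∀ i → ψ (d′ i) ≡ just y′
  ψ-d′ i with D? (d′ i) | D′? (d′ i)
  ... | yes dd | _     = contradiction (sym (D-at (d′∈ i) dd)) (d≢d′ i)
  ... | no _   | yes _ = refl
  ... | no _   | no ¬D = contradiction (i , refl) ¬D
  small : ∀ i → length (filter ψ? (S i)) ≤ suc q
  small i = ≤-pred (≤-pred (subst (2 + length (filter ψ? (S i)) ≤_) (size i) (unique-⊆-length
    (∉-unique d∉ (∉-unique d′∉ (Uniq.filter⁺ ψ? (unique i)))) λ where
      (here refl)         → d∈ i
      (there (here refl)) → d′∈ i
      (there (there x∈))  → proj₁ (∈-filter⁻ ψ? {xs = S i} x∈))))
    where
    reserved∉ : ∀ {x a} → ψ x ≡ just a → x ∉ filter ψ? (S i)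
    reserved∉ eq x∈ with trans (sym eq) (proj₂ (∈-filter⁻ ψ? {xs = S i} x∈))
    ... | ()
    d′∉ : d′ i ∉ filter ψ? (S i)
    d′∉ = reserved∉ (ψ-d′ i)
    d∉ : d i ∉ d′ i ∷ filter ψ? (S i)
    d∉ (here eq)  = d≢d′ i eq
    d∉ (there d∈) = reserved∉ (ψ-d i) d∈
  colouring : ∃[ χ ] ((∀ i → InjectiveOn {B = Fin (3 + q)} χ (S i)) × (∀ x a → ψ x ≡ just a → χ x ≡ a))
  colouring = reserved-colouring S tree unique ψ ι ι-inj ι≢ψ ψ-inj ψ? small
  χ = proj₁ colouring
  χ-inj = proj₁ (proj₂ colouring)
  χ-ψ = proj₂ (proj₂ colouring)
  rich′ : ∀ i α → toℕ α < toℕ i → Rich s P (Unshared χ (S i) (S α))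
  rich′ i α α<i = rich _ (unshared? χ (S i) (S α))
    (λ x x∈ x∈α eq → <⇒≢ α<i (sym (cong toℕ (d-own (subst (_∈ S α) (χ-inj i x (d i) x∈ (d∈ i) (trans eq (sym (χ-ψ _ y (ψ-d i))))) x∈α)))))
    (λ x x∈ x∈α eq → <⇒≢ α<i (sym (cong toℕ (d′-own (subst (_∈ S α) (χ-inj i x (d′ i) x∈ (d′∈ i) (trans eq (sym (χ-ψ _ y′ (ψ-d′ i))))) x∈α)))))

-- Kernels must contain position z, so consecutive edges have to share the vertex coloured z. Host
-- edges that miss the common vertex c are not images of edges of `H` and are shrunk to c alone;
-- then c lies on every edge.
embed-star : ∀ {v n q} s (H : Hypergraph v) (G : Hypergraph n) → Uniform (3 + q) H → Uniform (3 + q) G → v + v ≤ n →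
  (h : Host (3 + q) H) → Host.M h * (3 + q) ≤ s → (c₀ : Fin v) → (∀ i → c₀ Sub.∈ edge H i) →
  (P : Tuple n (3 + q) → Set) → (∀ {F} → P F → EdgeTuple G F) →
  ∃[ F₀ ] P F₀ → ∀ z → RichOff s P z → Embeds H G
embed-star {v} {n} {q} s H G uH uG le h les c₀ c₀∈ P P-edge F₀ z rich =
  coloured-embedding s H G uH uG le S′ tree′ χ χ-inj g g-inj pos
    (λ i x x∈ → through (pos⁺ i c₀ (c₀∈ i)) (pos⁺ i x x∈)) P P-edge F₀ rich′ les
  where
  open Host h
  c : Fin t
  c = g c₀
  pick : ∀ i → Dec (c ∈ S i) → List (Fin t)
  pick i (yes _) = S i
  pick i (no _)  = c ∷ []
  c? : ∀ i → Dec (c ∈ S i)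
  c? i = ∈-dec Fin._≟_ c (S i)
  S′ : Fin M → List (Fin t)
  S′ i = pick i (c? i)
  c∈S′ : ∀ i → c ∈ S′ i
  c∈S′ i with c? i
  ... | yes c∈ = c∈
  ... | no _   = here refl
  through : ∀ {i x} → c ∈ S i → x ∈ S i → x ∈ S′ i
  through {i} c∈ x∈ with c? i
  ... | yes _ = x∈
  ... | no ¬c = contradiction c∈ ¬c
  S′⁻ : ∀ {i x} → x ∈ S′ i → x ≡ c ⊎ (c ∈ S i × x ∈ S i)
  S′⁻ {i} x∈ with c? i
  S′⁻ x∈          | yes c∈ = inj₂ (c∈ , x∈)
  S′⁻ (here refl) | no _   = inj₁ refl
  unique′ : ∀ i → Unique (S′ i)
  unique′ i with c? i
  ... | yes _ = unique i
  ... | no _  = [] ∷ []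
  -- If two edges share a vertex other than c, neither was shrunk, so both contain c; then the
  -- anchor contains c as well and was not shrunk either.
  tree′ : Tree S′
  tree′ i 0<i with tree i 0<i
  ... | α , α< , absorb = α , α< , go
    where
    go : ∀ x → x ∈ S′ i → (∃[ j ] (toℕ j < toℕ i × x ∈ S′ j)) → x ∈ S′ α
    go x x∈ (j , j< , x∈j) with S′⁻ {i} x∈ | S′⁻ {j} x∈j
    ... | inj₁ refl        | _                 = c∈S′ α
    ... | inj₂ _           | inj₁ refl         = c∈S′ α
    ... | inj₂ (c∈i , x∈i) | inj₂ (c∈j , x∈j′) =
      through (absorb c c∈i (j , j< , c∈j)) (absorb x x∈i (j , j< , x∈j′))
  tag : ∀ {x} → Dec (x ≡ c) → Maybe (Fin (3 + q))
  tag (yes _) = just z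
  tag (no _)  = nothing
  ψ : Fin t → Maybe (Fin (3 + q))
  ψ x = tag (x Fin.≟ c)
  ψ⁻ : ∀ {x a} → ψ x ≡ just a → x ≡ c × z ≡ a
  ψ⁻ {x} eq with x Fin.≟ c
  ... | yes e = e , Maybe.just-injective eq
  ψ-c : ψ c ≡ just z
  ψ-c with c Fin.≟ c
  ... | yes _ = refl
  ... | no ne = contradiction refl ne
  ψ? : ∀ x → Dec (ψ x ≡ nothing)
  ψ? x = Maybe.≡-dec Fin._≟_ (ψ x) nothing
  size′ : ∀ i → length (S′ i) ≤ 3 + q
  size′ i with c? i
  ... | yes _ = ≤-reflexive (size i)
  ... | no _  = s≤s z≤n
  small : ∀ i → length (filter ψ? (S′ i)) ≤ 2 + q
  small i = ≤-pred (≤-trans (unique-⊆-length (∉-unique c∉ (Uniq.filter⁺ ψ? (unique′ i))) λ where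
      (here refl) → c∈S′ i
      (there x∈)  → proj₁ (∈-filter⁻ ψ? {xs = S′ i} x∈)) (size′ i))
    where
    c∉ : c ∉ filter ψ? (S′ i)
    c∉ c∈ with trans (sym ψ-c) (proj₂ (∈-filter⁻ ψ? {xs = S′ i} c∈))
    ... | ()
  colouring : ∃[ χ ] ((∀ i → InjectiveOn {B = Fin (3 + q)} χ (S′ i)) × (∀ x a → ψ x ≡ just a → χ x ≡ a))
  colouring = reserved-colouring S′ tree′ unique′ ψ (punchIn z) (Fin.punchIn-injective z _ _)
    (λ x a eq → Fin.punchInᵢ≢i z a (sym (proj₂ (ψ⁻ {x} eq))))
    (λ i x y a _ _ ex ey → trans (proj₁ (ψ⁻ ex)) (sym (proj₁ (ψ⁻ ey)))) ψ? small
  χ = proj₁ colouring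
  χ-inj = proj₁ (proj₂ colouring)
  rich′ : ∀ i α → toℕ α < toℕ i → Rich s P (Unshared χ (S′ i) (S′ α))
  rich′ i α _ = rich _ (unshared? χ (S′ i) (S′ α)) λ unsh → unsh c (c∈S′ i) (c∈S′ α) (proj₂ (proj₂ colouring) c z ψ-c)

crosscut-meets : ∀ {v} (H : Hypergraph v) (X : Subset v) → CrossCut H X → ∀ i → ∃[ x ] (x Sub.∈ X × x Sub.∈ edge H i)
crosscut-meets H X cross i with elements (X Sub.∩ edge H i) in eq
... | []    = contradiction (trans (sym (cong length eq)) (trans (length-elements (X Sub.∩ edge H i)) (cross i))) λ ()
... | x ∷ _ = x , x∈p∩q⁻ X (edge H i) (∈-elements⁻ (subst (x ∈_) (sym eq) (here refl)))

-- The map `τ` places the cross-cut, and the members of `P` form edges with each of its images.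
-- Removing the cross-cut from the host leaves a tree whose edges, once cut down to r - 1 vertices,
-- are placed on members of `P`; no colour needs to be reserved because every restriction is a
-- kernel.
embed-crosscut : ∀ {v n q} s (H : Hypergraph v) (G : Hypergraph n) → Uniform (3 + q) H → Uniform (3 + q) G → v + v ≤ n →
  (h : Host (3 + q) H) → Host.M h * (2 + q) ≤ s → (X : Subset v) → CrossCut H X →
  (τ : Fin v → Fin n) → (∀ {x y} → x Sub.∈ X → y Sub.∈ X → τ x ≡ τ y → x ≡ y) →
  (P : Tuple n (2 + q) → Set) → (∀ {F} → P F → LookupInjective F) →
  (∀ {F x} → P F → x Sub.∈ X → EdgeTuple G (τ x ∷ F)) →
  ∃[ F₀ ] P F₀ → FullyRich s P → Embeds H G
embed-crosscut {v} {n} {q} s H G uH uG le h les X cross τ τ-inj P P-inj P-edge (F₀ , PF₀) rich = result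
  where
  open Host h
  C′ : Fin t → Set
  C′ y = ∃[ x ] (x Sub.∈ X × g x ≡ y)
  C′? : Decidable C′
  C′? y = Fin.any? λ x → (x ∈? X) ×-dec (g x Fin.≟ y)
  cut? : ∀ i → Dec (∃[ y ] (y ∈ S i × C′ y))
  cut? i = Fin.any? λ y → ∈-dec Fin._≟_ y (S i) ×-dec C′? y
  pick : ∀ i → Dec (∃[ y ] (y ∈ S i × C′ y)) → Fin t
  pick i (yes (y , _)) = y
  pick i (no _)        = d i
  -- The vertex removed from E_i even if no cross-cut vertex lies on it, to leave at most r − 1 vertices.
  u : Fin M → Fin t
  u i = pick i (cut? i)
  u∈ : ∀ i → u i ∈ S i
  u∈ i with cut? i
  ... | yes (_ , y∈ , _) = y∈
  ... | no _             = d∈ i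
  u-cases : ∀ i → C′ (u i) ⊎ ((∀ y → y ∈ S i → ¬ C′ y) × u i ≡ d i)
  u-cases i with cut? i
  ... | yes (_ , _ , Cy) = inj₁ Cy
  ... | no none          = inj₂ ((λ y y∈ Cy → none (y , y∈ , Cy)) , refl)
  Keep : Fin M → Fin t → Set
  Keep i x = (¬ C′ x) × x ≢ u i
  keep? : ∀ i → Decidable (Keep i)
  keep? i x = ¬? (C′? x) ×-dec ¬? (x Fin.≟ u i)
  S′ : Fin M → List (Fin t)
  S′ i = filter (keep? i) (S i)
  S′⁻ : ∀ {i x} → x ∈ S′ i → x ∈ S i × Keep i x
  S′⁻ {i} = ∈-filter⁻ (keep? i) {xs = S i}
  unique′ : ∀ i → Unique (S′ i)
  unique′ i = Uniq.filter⁺ (keep? i) (unique i)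
  small : ∀ i → length (S′ i) ≤ 2 + q
  small i = ≤-pred (subst (suc (length (S′ i)) ≤_) (size i)
    (unique-⊆-length (∉-unique (λ u∈′ → proj₂ (proj₂ (S′⁻ u∈′)) refl) (unique′ i)) λ where
      (here refl) → u∈ i
      (there x∈)  → proj₁ (S′⁻ x∈)))
  tree′ : Tree S′
  tree′ i 0<i with tree i 0<i
  ... | α , α< , absorb = α , α< , go
    where
    go : ∀ x → x ∈ S′ i → (∃[ j ] (toℕ j < toℕ i × x ∈ S′ j)) → x ∈ S′ α
    go x x∈ (j , j< , x∈j) with S′⁻ x∈
    ... | x∈i , ¬Cx , _ = ∈-filter⁺ (keep? α) (absorb x x∈i (j , j< , proj₁ (S′⁻ x∈j))) (¬Cx , x≢u)
      where
      -- If `u α` is a cross-cut vertex, it was removed from every edge; otherwise it is `d α`,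
      -- which lies on no other edge.
      x≢u : x ≢ u α
      x≢u refl with u-cases α
      ... | inj₁ Cu       = ¬Cx Cu
      ... | inj₂ (_ , eq) = <⇒≢ α< (cong toℕ (d-own (subst (_∈ S i) eq x∈i)))
  coloured : ∃[ χ ] (∀ i → InjectiveOn {B = Fin (2 + q)} χ (S′ i))
  coloured = tree-colouring S′ tree′ unique′ small
  χ = proj₁ coloured
  embedded : ∃[ F ] ((∀ i → P (F i)) × (∀ i j x y → x ∈ S′ i → y ∈ S′ j →
    (lookup (F i) (χ x) ≡ lookup (F j) (χ y) → x ≡ y) × (x ≡ y → lookup (F i) (χ x) ≡ lookup (F j) (χ y))))
  embedded = tree-embedding s S′ tree′ χ (proj₂ coloured) P P-inj (F₀ , PF₀) (λ i α _ → rich _ (unshared? χ (S′ i) (S′ α))) les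
  F = proj₁ embedded
  PF = proj₁ (proj₂ embedded)
  cons = proj₂ (proj₂ embedded)
  into : ∀ {i x} → x Sub.∈ edge H i → ¬ x Sub.∈ X → g x ∈ S′ (pos i)
  into {i} {x} x∈ x∉X = ∈-filter⁺ (keep? (pos i)) (pos⁺ i x x∈) (¬C′ , ≢u)
    where
    ¬C′ : ¬ C′ (g x)
    ¬C′ (x′ , x′∈C , eq) = x∉X (subst (Sub._∈ X) (g-inj eq) x′∈C)
    ≢u : g x ≢ u (pos i)
    ≢u eq with u-cases (pos i)
    ... | inj₁ Cu         = ¬C′ (subst C′ (sym eq) Cu)
    ... | inj₂ (none , _) = let w , w∈X , w∈ = crosscut-meets H X cross i in none (g w) (pos⁺ i w w∈) (w , w∈X , refl)
  choose : ∀ x → Dec (x Sub.∈ X) → Dec (∃[ i ] (g x ∈ S′ i)) → Fin n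
  choose x (yes _) _             = τ x
  choose x (no _)  (yes (i , _)) = lookup (F i) (χ (g x))
  choose x (no _)  (no _)        = lookup F₀ zero
  f : Fin v → Fin n
  f x = choose x (x ∈? X) (Fin.any? λ i → ∈-dec Fin._≟_ (g x) (S′ i))
  f-in : ∀ {x} → x Sub.∈ X → f x ≡ τ x
  f-in {x} x∈X with x ∈? X
  ... | yes _ = refl
  ... | no ¬C = contradiction x∈X ¬C
  f-out : ∀ {i x} → x Sub.∈ edge H i → ¬ x Sub.∈ X → f x ≡ lookup (F (pos i)) (χ (g x))
  f-out {i} {x} x∈ x∉X = outside (x ∈? X) (Fin.any? λ i → ∈-dec Fin._≟_ (g x) (S′ i))
    where
    outside : ∀ d d′ → choose x d d′ ≡ lookup (F (pos i)) (χ (g x))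
    outside (yes x∈X) _              = contradiction x∈X x∉X
    outside (no _)    (yes (j , gx∈)) = proj₂ (cons j (pos i) (g x) (g x) gx∈ (into x∈ x∉X)) refl
    outside (no _)    (no ¬c)         = contradiction (pos i , into x∈ x∉X) ¬c
  -- Every `τ x` forms an edge with every member of `P`, including those placed on edges not
  -- containing x; so it differs from all entries of the tuples.
  τ≢F : ∀ {x i c} → x Sub.∈ X → τ x ≢ lookup (F i) c
  τ≢F {x} {i} {c} x∈X eq = contradiction (proj₁ (P-edge (PF i) x∈X) {zero} {suc c} eq) λ ()
  f-inj : ∀ i j x y → x Sub.∈ edge H i → y Sub.∈ edge H j → f x ≡ f y → x ≡ y
  f-inj i j x y x∈ y∈ eq = byCut (x ∈? X) (y ∈? X)
    where
    byCut : Dec (x Sub.∈ X) → Dec (y Sub.∈ X) → x ≡ y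
    byCut (yes x∈X) (yes y∈X) = τ-inj x∈X y∈X (trans (sym (f-in x∈X)) (trans eq (f-in y∈X)))
    byCut (yes x∈X) (no y∉X)  = contradiction (trans (sym (f-in x∈X)) (trans eq (f-out {j} y∈ y∉X))) (τ≢F {x} {pos j} {χ (g y)} x∈X)
    byCut (no x∉X)  (yes y∈X) = contradiction (trans (sym (f-in y∈X)) (trans (sym eq) (f-out {i} x∈ x∉X))) (τ≢F {y} {pos i} {χ (g x)} y∈X)
    byCut (no x∉X)  (no y∉X)  = g-inj (proj₁ (cons (pos i) (pos j) (g x) (g y) (into x∈ x∉X) (into y∈ y∉X))
      (trans (sym (f-out x∈ x∉X)) (trans eq (f-out y∈ y∉X))))
  onEdges : ∀ i → ∃[ E ] (IsEdge G E × (∀ x → x Sub.∈ edge H i → f x Sub.∈ E))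
  onEdges i = E , proj₁ (proj₂ (proj₂ edgeTuple)) , λ x x∈ → byCut x x∈ (x ∈? X)
    where
    w = proj₁ (crosscut-meets H X cross i)
    w∈X = proj₁ (proj₂ (crosscut-meets H X cross i))
    w∈ = proj₂ (proj₂ (crosscut-meets H X cross i))
    edgeTuple : EdgeTuple G (τ w ∷ F (pos i))
    edgeTuple = P-edge (PF (pos i)) w∈X
    E : Subset n
    E = proj₁ (proj₂ edgeTuple)
    entries∈ : ∀ c → lookup (τ w ∷ F (pos i)) c Sub.∈ E
    entries∈ = proj₂ (proj₂ (proj₂ edgeTuple))
    byCut : ∀ x → x Sub.∈ edge H i → Dec (x Sub.∈ X) → f x Sub.∈ E
    byCut x x∈ (yes x∈X) = subst (Sub._∈ E) (sym (trans (cong f x≡w) (f-in w∈X))) (entries∈ zero)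
      where
      x≡w : x ≡ w
      x≡w = ∣p∣≡1⇒≡ (cross i) (x∈p∩q⁺ (x∈X , x∈)) (x∈p∩q⁺ (w∈X , w∈))
    byCut x x∈ (no x∉X)  = subst (Sub._∈ E) (sym (f-out x∈ x∉X)) (entries∈ (suc (χ (g x))))
  result : Embeds H G
  result = partial-embedding H G uH uG le f f-inj onEdges

-- The case σ = 1 and the lower bound

unique-lookup-injective : ∀ {A : Set} {xs : List A} → Unique xs → ∀ {i j} → List.lookup xs i ≡ List.lookup xs j → i ≡ j
unique-lookup-injective {xs = x ∷ xs} u {zero}  {zero}  eq = refl
unique-lookup-injective {xs = x ∷ xs} u {zero}  {suc j} eq =
  contradiction (subst (_∈ xs) (sym eq) (∈-lookup j)) (Unique[x∷xs]⇒x∉xs u)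
unique-lookup-injective {xs = x ∷ xs} u {suc i} {zero}  eq =
  contradiction (subst (_∈ xs) eq (∈-lookup i)) (Unique[x∷xs]⇒x∉xs u)
unique-lookup-injective {xs = x ∷ xs} (_ ∷ u) {suc i} {suc j} eq = cong suc (unique-lookup-injective u eq)

listTuple : ∀ {n k} (xs : List (Fin n)) → length xs ≡ k → Tuple n k
listTuple xs refl = Vec.tabulate (List.lookup xs)

listTuple-injective : ∀ {n k} {xs : List (Fin n)} (eq : length xs ≡ k) → Unique xs → LookupInjective (listTuple xs eq)
listTuple-injective {xs = xs} refl u {c} {d} e = unique-lookup-injective u
  (trans (sym (Vec.lookup∘tabulate (List.lookup xs) c)) (trans e (Vec.lookup∘tabulate (List.lookup xs) d)))

listTuple-∈ : ∀ {n k} {xs : List (Fin n)} (eq : length xs ≡ k) c → lookup (listTuple xs eq) c ∈ xs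
listTuple-∈ {xs = xs} refl c = subst (_∈ xs) (sym (Vec.lookup∘tabulate (List.lookup xs) c)) (∈-lookup c)

listTuple-onto : ∀ {n k} {xs : List (Fin n)} (eq : length xs ≡ k) {x} → x ∈ xs → ∃[ c ] (lookup (listTuple xs eq) c ≡ x)
listTuple-onto {xs = xs} refl x∈ =
  Any.index x∈ , trans (Vec.lookup∘tabulate (List.lookup xs) (Any.index x∈)) (sym (lookup-index x∈))

subsetTuple : ∀ {n k} (p : Subset n) → ∣ p ∣ ≡ k → Tuple n k
subsetTuple p eq = listTuple (elements p) (trans (length-elements p) eq)

subsetTuple-injective : ∀ {n k} (p : Subset n) (eq : ∣ p ∣ ≡ k) → LookupInjective (subsetTuple p eq)
subsetTuple-injective p eq = listTuple-injective (trans (length-elements p) eq) (unique-elements p)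

subsetTuple-∈ : ∀ {n k} (p : Subset n) (eq : ∣ p ∣ ≡ k) c → lookup (subsetTuple p eq) c Sub.∈ p
subsetTuple-∈ p eq c = ∈-elements⁻ (listTuple-∈ (trans (length-elements p) eq) c)

subsetTuple-onto : ∀ {n k} (p : Subset n) (eq : ∣ p ∣ ≡ k) {x} → x Sub.∈ p → ∃[ c ] (lookup (subsetTuple p eq) c ≡ x)
subsetTuple-onto p eq x∈ = listTuple-onto (trans (length-elements p) eq) (∈-elements⁺ x∈)

subsetTuple-reflects : ∀ {n k} {p p′ : Subset n} (eq : ∣ p ∣ ≡ k) (eq′ : ∣ p′ ∣ ≡ k) →
  subsetTuple p eq ≡ subsetTuple p′ eq′ → p ≡ p′
subsetTuple-reflects {n} eq eq′ e = ⊆-antisym (half eq eq′ e) (half eq′ eq (sym e))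
  where
  half : ∀ {k} {p p′ : Subset n} (eq : ∣ p ∣ ≡ k) (eq′ : ∣ p′ ∣ ≡ k) → subsetTuple p eq ≡ subsetTuple p′ eq′ →
    p Sub.⊆ p′
  half {p = p} {p′} eq eq′ e {x} x∈ with subsetTuple-onto p eq x∈
  ... | c , refl = subst (Sub._∈ p′) (cong (λ F → lookup F c) (sym e)) (subsetTuple-∈ p′ eq′ c)

-- One ordering per edge is fixed, here the increasing one; which ordering it is does not matter.
edgeTuples : ∀ {n r} (G : Hypergraph n) → Uniform r G → List (Tuple n r)
edgeTuples G uG = map (λ i → subsetTuple (edge G i) (uG i)) (allFin (m G))

edgeTuples⁻ : ∀ {n r} (G : Hypergraph n) (uG : Uniform r G) {F} → F ∈ edgeTuples G uG →
  ∃[ i ] (F ≡ subsetTuple (edge G i) (uG i))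
edgeTuples⁻ G uG F∈ = let i , _ , eq = ∈-map⁻ (λ i → subsetTuple (edge G i) (uG i)) F∈ in i , eq

edgeTuples-edge : ∀ {n r} (G : Hypergraph n) (uG : Uniform r G) {F} → F ∈ edgeTuples G uG → EdgeTuple G F
edgeTuples-edge G uG F∈ with edgeTuples⁻ G uG F∈
... | i , refl = subsetTuple-injective (edge G i) (uG i) , edge G i , (i , refl) , subsetTuple-∈ (edge G i) (uG i)

unique-edgeTuples : ∀ {n r} (G : Hypergraph n) (uG : Uniform r G) → Unique (edgeTuples G uG)
unique-edgeTuples G uG = Uniq.map⁺ (λ {i} {j} eq → edge-inj G (subsetTuple-reflects (uG i) (uG j) eq)) (Uniq.allFin⁺ (m G))

length-edgeTuples : ∀ {n r} (G : Hypergraph n) (uG : Uniform r G) → length (edgeTuples G uG) ≡ m G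
length-edgeTuples G uG = trans (length-map (λ i → subsetTuple (edge G i) (uG i)) (allFin (m G))) (length-allFin (m G))

-- A one-element cross-cut is a vertex common to all edges. With it `embed-star` excludes parts of
-- type (ii), and `embed-over` excludes those of type (i).
star-bound : ∀ {v q} (H : Hypergraph v) → Uniform (3 + q) H → Fin (m H) → Host (3 + q) H → IsSigma H 1 →
  ∃[ K ] ∃[ N ] (∀ n → N ≤ n → ExAtMost (3 + q) H n (K * n ^ suc q))
star-bound {v} {q} H uH i₀ h ((X , cross , ∣X∣≡1) , _) = K , v + v , bound
  where
  s K : ℕ
  s = Host.M h * (3 + q)
  K = lossFactor (3 + q) s ((3 + q) * (3 + q))
  c₀ : Fin v
  c₀ = proj₁ (crosscut-meets H X cross i₀)
  c₀∈ : ∀ i → c₀ Sub.∈ edge H i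
  c₀∈ i with crosscut-meets H X cross i
  ... | x , x∈C , x∈ = subst (Sub._∈ edge H i) (∣p∣≡1⇒≡ {p = X} ∣X∣≡1 x∈C (proj₁ (proj₂ (crosscut-meets H X cross i₀)))) x∈
  bound : ∀ n → v + v ≤ n → ExAtMost (3 + q) H n (K * n ^ suc q)
  bound n le G (uG , free) = subst (_≤ K * n ^ suc q) (length-edgeTuples G uG)
    (typed-free-length s (edgeTuples G uG) (unique-edgeTuples G uG)
      (λ P P⊆ F∈ y y′ y≢y′ over → free (embed-over s H G uH uG le h ≤-refl (_∈ P)
        (λ F∈ → edgeTuples-edge G uG (P⊆ F∈)) (_ , F∈) y y′ y≢y′ over))
      (λ P P⊆ F∈ z off → free (embed-star s H G uH uG le h ≤-refl c₀ c₀∈ (_∈ P)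
        (λ F∈ → edgeTuples-edge G uG (P⊆ F∈)) (_ , F∈) z off)))

-- Binomial coefficients and the transversal construction

subsetsOfSize : ∀ n (k : ℕ) → List (Subset n)
subsetsOfSize n       zero    = Sub.⊥ ∷ []
subsetsOfSize zero    (suc k) = []
subsetsOfSize (suc n) (suc k) = map (true ∷_) (subsetsOfSize n k) ++ map (false ∷_) (subsetsOfSize n (suc k))

nC0≡1 : ∀ n → n C 0 ≡ 1
nC0≡1 n = trans (nCk≡nC[n∸k] {0} {n} z≤n) (nCn≡1 n)

length-subsetsOfSize : ∀ n k → length (subsetsOfSize n k) ≡ n C k
length-subsetsOfSize n       zero    = sym (nC0≡1 n)
length-subsetsOfSize zero    (suc k) = sym (k>n⇒nCk≡0 {0} {suc k} (s≤s z≤n))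
length-subsetsOfSize (suc n) (suc k) = trans (length-++ (map (true ∷_) (subsetsOfSize n k)))
  (trans (cong₂ _+_ (trans (length-map (true ∷_) (subsetsOfSize n k)) (length-subsetsOfSize n k))
                    (trans (length-map (false ∷_) (subsetsOfSize n (suc k))) (length-subsetsOfSize n (suc k))))
         (nCk+nC[k+1]≡[n+1]C[k+1] n k))

subsetsOfSize-size : ∀ n k {p} → p ∈ subsetsOfSize n k → ∣ p ∣ ≡ k
subsetsOfSize-size n       zero    (here refl) = ∣⊥∣≡0 n
subsetsOfSize-size (suc n) (suc k) p∈ with ∈-++⁻ (map (true ∷_) (subsetsOfSize n k)) p∈
... | inj₁ p∈₁ with ∈-map⁻ (true ∷_) p∈₁
... | p′ , p′∈ , refl = cong suc (subsetsOfSize-size n k p′∈)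
subsetsOfSize-size (suc n) (suc k) p∈ | inj₂ p∈₂ with ∈-map⁻ (false ∷_) p∈₂
... | p′ , p′∈ , refl = subsetsOfSize-size n (suc k) p′∈

∈-subsetsOfSize : ∀ {n} k {p : Subset n} → ∣ p ∣ ≡ k → p ∈ subsetsOfSize n k
∈-subsetsOfSize zero    {[]} eq = here refl
∈-subsetsOfSize {suc n} zero {false ∷ p} eq with ∈-subsetsOfSize {n} zero {p} eq
... | here refl = here refl
∈-subsetsOfSize (suc k) {true ∷ p}  eq = ∈-++⁺ˡ (∈-map⁺ (true ∷_) (∈-subsetsOfSize k (suc-injective eq)))
∈-subsetsOfSize {suc n} (suc k) {false ∷ p} eq =
  ∈-++⁺ʳ (map (true ∷_) (subsetsOfSize n k)) (∈-map⁺ (false ∷_) (∈-subsetsOfSize (suc k) eq))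

unique-subsetsOfSize : ∀ n k → Unique (subsetsOfSize n k)
unique-subsetsOfSize n       zero    = [] ∷ []
unique-subsetsOfSize zero    (suc k) = []
unique-subsetsOfSize (suc n) (suc k) = Uniq.++⁺
  (Uniq.map⁺ Vec.∷-injectiveʳ (unique-subsetsOfSize n k))
  (Uniq.map⁺ Vec.∷-injectiveʳ (unique-subsetsOfSize n (suc k)))
  λ { (p∈ , p∈′) → disjoint (∈-map⁻ (true ∷_) p∈) (∈-map⁻ (false ∷_) p∈′) }
  where
  disjoint : ∀ {p : Subset (suc n)} {P Q : Subset n → Set} →
    ∃[ p₁ ] (P p₁ × p ≡ true ∷ p₁) → ∃[ p₂ ] (Q p₂ × p ≡ false ∷ p₂) → ⊥
  disjoint (_ , _ , refl) (_ , _ , ())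

nCk≤n^k : ∀ n k → n C k ≤ n ^ k
nCk≤n^k n       zero    = ≤-reflexive (nC0≡1 n)
nCk≤n^k zero    (suc k) = ≤-reflexive (k>n⇒nCk≡0 {0} {suc k} (s≤s z≤n))
nCk≤n^k (suc n) (suc k) = begin
  suc n C suc k         ≡⟨ sym (nCk+nC[k+1]≡[n+1]C[k+1] n k) ⟩
  n C k + n C suc k     ≤⟨ +-mono-≤ (nCk≤n^k n k) (nCk≤n^k n (suc k)) ⟩
  n ^ k + n * n ^ k     ≤⟨ *-monoʳ-≤ (suc n) (^-monoˡ-≤ k (n≤1+n n)) ⟩
  suc n * suc n ^ k     ∎
  where open ≤-Reasoning

-- Pascal's rule, applied a times. It compares sets chosen among all vertices with sets chosen among
-- those outside the a special ones of the construction.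
C-shift : ∀ a n k → (a + n) C suc k ≤ n C suc k + a * (a + n) ^ k
C-shift zero    n k = ≤-reflexive (sym (+-identityʳ (n C suc k)))
C-shift (suc a) n k = begin
  suc (a + n) C suc k                                     ≡⟨ sym (nCk+nC[k+1]≡[n+1]C[k+1] (a + n) k) ⟩
  (a + n) C k + (a + n) C suc k                           ≤⟨ +-mono-≤ (nCk≤n^k (a + n) k) (C-shift a n k) ⟩
  (a + n) ^ k + (n C suc k + a * (a + n) ^ k)             ≤⟨ +-mono-≤ up (+-monoʳ-≤ (n C suc k) (*-monoʳ-≤ a up)) ⟩
  suc (a + n) ^ k + (n C suc k + a * suc (a + n) ^ k)     ≡⟨ x∙yz≈y∙xz (suc (a + n) ^ k) (n C suc k) _ ⟩
  n C suc k + suc a * suc (a + n) ^ k                     ∎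
  where
  open ≤-Reasoning
  up : (a + n) ^ k ≤ suc (a + n) ^ k
  up = ^-monoˡ-≤ k (n≤1+n (a + n))

∣p++q∣ : ∀ {a n} (p : Subset a) (q : Subset n) → ∣ p Vec.++ q ∣ ≡ ∣ p ∣ + ∣ q ∣
∣p++q∣ []          q = refl
∣p++q∣ (true ∷ p)  q = cong suc (∣p++q∣ p q)
∣p++q∣ (false ∷ p) q = ∣p++q∣ p q

∈-++ˡ⁺ : ∀ {a n} {p : Subset a} {q : Subset n} {x} → x Sub.∈ p → (x ↑ˡ n) Sub.∈ p Vec.++ q
∈-++ˡ⁺ {p = p} {q} {x} x∈ = Vec.lookup⇒[]= _ _ (trans (Vec.lookup-++ˡ p q x) (Vec.[]=⇒lookup x∈))

∈-++ˡ⁻ : ∀ {a n} {p : Subset a} {q : Subset n} {x} → (x ↑ˡ n) Sub.∈ p Vec.++ q → x Sub.∈ p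
∈-++ˡ⁻ {p = p} {q} {x} x∈ = Vec.lookup⇒[]= _ _ (trans (sym (Vec.lookup-++ˡ p q x)) (Vec.[]=⇒lookup x∈))

transversalSets : ∀ a n k → List (Subset (a + n))
transversalSets a n k = cartesianProductWith (λ x p → Sub.⁅ x ⁆ Vec.++ p) (allFin a) (subsetsOfSize n k)

-- All sets meeting the first a vertices exactly once. With a = σ(H) - 1 this is the extremal
-- example for the lower bound.
transversalGraph : ∀ a n k → Hypergraph (a + n)
transversalGraph a n k = record
  { m        = length (transversalSets a n k)
  ; edge     = List.lookup (transversalSets a n k)
  ; edge-inj = unique-lookup-injective (Uniq.cartesianProductWith⁺ (λ x p → Sub.⁅ x ⁆ Vec.++ p) inj (Uniq.allFin⁺ a) (unique-subsetsOfSize n k))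
  }
  where
  inj : ∀ {w x : Fin a} {y z : Subset n} → Sub.⁅ w ⁆ Vec.++ y ≡ Sub.⁅ x ⁆ Vec.++ z → w ≡ x × y ≡ z
  inj {w} {x} eq with Vec.++-injective Sub.⁅ w ⁆ Sub.⁅ x ⁆ eq
  ... | eqˡ , eqʳ = x∈⁅y⁆⇒x≡y x (subst (w Sub.∈_) eqˡ (x∈⁅x⁆ w)) , eqʳ

transversalGraph-edge : ∀ a n k (i : Fin (m (transversalGraph a n k))) → ∃[ x ] ∃[ p ] (∣ p ∣ ≡ k × edge (transversalGraph a n k) i ≡ Sub.⁅ x ⁆ Vec.++ p)
transversalGraph-edge a n k i with ∈-cartesianProductWith⁻ (λ x p → Sub.⁅ x ⁆ Vec.++ p) (allFin a) (subsetsOfSize n k)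
  (∈-lookup {xs = transversalSets a n k} i)
... | x , p , _ , p∈ , eq = x , p , subsetsOfSize-size n k p∈ , eq

transversalGraph-uniform : ∀ a n k → Uniform (suc k) (transversalGraph a n k)
transversalGraph-uniform a n k i with transversalGraph-edge a n k i
... | x , p , size , eq = trans (cong ∣_∣ eq) (trans (∣p++q∣ Sub.⁅ x ⁆ p) (cong₂ _+_ (∣⁅x⁆∣≡1 x) size))

∣p∣≡1 : ∀ {n} {p : Subset n} {x} → x Sub.∈ p → (∀ {y} → y Sub.∈ p → y ≡ x) → ∣ p ∣ ≡ 1
∣p∣≡1 {p = p} {x} x∈ only = trans (sym (length-elements p)) (≤-antisym
  (unique-⊆-length {ys = x ∷ []} (unique-elements p) (λ y∈ → here (only (∈-elements⁻ y∈))))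
  (unique-⊆-length {xs = x ∷ []} ([] ∷ []) λ { (here refl) → ∈-elements⁺ x∈ }))

from-does : ∀ {P : Set} (d : Dec P) → Dec.does d ≡ true → P
from-does (yes p) _ = p

-- The preimage of the a special vertices under an embedding of H would be a cross-cut of H with at most a vertices.
transversalGraph-free : ∀ {v a n k} (H : Hypergraph v) → (∀ X → CrossCut H X → a < ∣ X ∣) →
  ¬ Embeds H (transversalGraph a n k)
transversalGraph-free {v} {a} {n} {k} H large (f , f-inj , image) = <⇒≱ (large X cross) small
  where
  X : Subset v
  X = Vec.tabulate λ x → Dec.does (toℕ (f x) <? a)
  X⁺ : ∀ {x} → toℕ (f x) < a → x Sub.∈ X
  X⁺ {x} lt = Vec.lookup⇒[]= x X (trans (Vec.lookup∘tabulate (λ x → Dec.does (toℕ (f x) <? a)) x) (Dec.dec-true (toℕ (f x) <? a) lt))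
  X⁻ : ∀ {x} → x Sub.∈ X → toℕ (f x) < a
  X⁻ {x} x∈ = from-does (toℕ (f x) <? a)
    (trans (sym (Vec.lookup∘tabulate (λ x → Dec.does (toℕ (f x) <? a)) x)) (Vec.[]=⇒lookup x∈))
  small : ∣ X ∣ ≤ a
  small = subst (_≤ a) (length-elements X) (subst (length (elements X) ≤_) (length-upTo a)
    (injection-length (toℕ ∘ f) (unique-elements X) (λ _ _ eq → f-inj (Fin.toℕ-injective eq))
      (λ x∈ → ∈-upTo⁺ (X⁻ (∈-elements⁻ x∈)))))
  cross : CrossCut H X
  cross i with image i
  ... | E , E-image , e , refl with transversalGraph-edge a n k e
  ... | j , p , _ , eq = meet (Equivalence.to (E-image (j ↑ˡ n)) (subst ((j ↑ˡ n) Sub.∈_) (sym eq) (∈-++ˡ⁺ {q = p} (x∈⁅x⁆ j))))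
    where
    meet : ∃[ x ] (x Sub.∈ edge H i × f x ≡ j ↑ˡ n) → ∣ X Sub.∩ edge H i ∣ ≡ 1
    meet (x , x∈ , fx≡) = ∣p∣≡1
      (x∈p∩q⁺ (X⁺ (subst (_< a) (sym (trans (cong toℕ fx≡) (Fin.toℕ-↑ˡ j n))) (Fin.toℕ<n j)) , x∈))
      λ {y} y∈ → let y∈C , y∈i = x∈p∩q⁻ X (edge H i) y∈ in f-inj (trans (special y (X⁻ y∈C) y∈i) (sym fx≡))
      where
      special : ∀ y → toℕ (f y) < a → y Sub.∈ edge H i → f y ≡ j ↑ˡ n
      special y lt y∈i = trans fy≡ (cong (_↑ˡ n) (x∈⁅y⁆⇒x≡y j (∈-++ˡ⁻ {q = p} (subst₂ Sub._∈_ fy≡ eq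
        (Equivalence.from (E-image (f y)) (y , y∈i , refl))))))
        where
        fy≡ : f y ≡ fromℕ< lt ↑ˡ n
        fy≡ = Fin.toℕ-injective (trans (sym (Fin.toℕ-fromℕ< lt)) (sym (Fin.toℕ-↑ˡ (fromℕ< lt) n)))

lower-bound : ∀ {v a q} (H : Hypergraph v) → (∀ X → CrossCut H X → a < ∣ X ∣) →
  ∃[ K ] ∃[ N ] (∀ n → N ≤ n → ∃[ k ] (ExAtLeast (2 + q) H n k × a * (n C suc q) ≤ k + K * n ^ q))
-- Each of the a special vertices loses at most a n^(r-2) edges by `C-shift`, whence the constant; n
-- must leave room for the special vertices.
lower-bound {v} {a} {q} H large = a * a , a , bound
  where
  bound : ∀ n → a ≤ n → ∃[ k ] (ExAtLeast (2 + q) H n k × a * (n C suc q) ≤ k + a * a * n ^ q)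
  bound n a≤n with m≤n⇒∃[o]m+o≡n a≤n
  ... | n′ , refl = length (transversalSets a n′ (suc q)) ,
    (transversalGraph a n′ (suc q) , (transversalGraph-uniform a n′ (suc q) , transversalGraph-free {n = n′} {suc q} H large) , ≤-refl) , (begin
    a * ((a + n′) C suc q)                               ≤⟨ *-monoʳ-≤ a (C-shift a n′ q) ⟩
    a * (n′ C suc q + a * (a + n′) ^ q)                  ≡⟨ *-distribˡ-+ a (n′ C suc q) _ ⟩
    a * (n′ C suc q) + a * (a * (a + n′) ^ q)            ≡⟨ cong₂ _+_ (sym count) (sym (*-assoc a a _)) ⟩
    length (transversalSets a n′ (suc q)) + a * a * (a + n′) ^ q ∎)
    where
    open ≤-Reasoning
    count : length (transversalSets a n′ (suc q)) ≡ a * (n′ C suc q)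
    count = trans (length-cartesianProductWith (λ x p → Sub.⁅ x ⁆ Vec.++ p) (allFin a) (subsetsOfSize n′ (suc q)))
      (cong₂ _*_ (length-allFin a) (length-subsetsOfSize n′ (suc q)))

-- Cores, shadows and stars with many petals

record CoreList {n k} (s : ℕ) (J : List (Fin k × Fin k)) (P : List (Tuple n k)) : Set₁ where
  field
    core    : List (Tuple n k)
    unique  : Unique core
    core⊆   : ∀ {F} → F ∈ core → F ∈ P
    rich    : ∀ {x y} → (x , y) ∈ J → Rich s (_∈ core) (Pair x y)
    maximal : ∀ (R : Tuple n k → Set) → (∀ {F} → R F → F ∈ P) →
              (∀ {x y} → (x , y) ∈ J → Rich s R (Pair x y)) → ∀ {F} → R F → F ∈ core
    loss    : ∀ {c} → (∀ {x y b} ys → (x , y) ∈ J → Pair x y b → Unique ys → (∀ {F} → F ∈ ys → F ∈ P) →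
                Dep (_∈ ys) x y b → length ys ≤ c) →
              ∀ zs → Unique zs → (∀ {F} → F ∈ zs → F ∈ P × F ∉ core) → length zs ≤ length J * (k * s) * c

opaque

  coreList : ∀ {n k} s (J : List (Fin k × Fin k)) (P : List (Tuple n k)) → Unique P → CoreList s J P
  coreList {n} {k} s J P uP = record
    { core    = core
    ; unique  = Uniq.filter⁺ core? uP
    ; core⊆   = λ F∈ → proj₁ (core⁻ F∈)
    ; rich    = λ xy∈J F F∈ W → let F′ , (F′∈P , lab) , rest = L.core-rich xy∈J F (core⁻ F∈) W in
                  F′ , core⁺ F′∈P lab , rest
    ; maximal = λ R R⊆ rich RF → core⁺ (R⊆ RF) (L.core-maximal R R⊆ rich RF)
    ; loss    = loss
    }
    where
    module L = Cleaning (clean s J (length P) P ≤-refl)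
    core? : ∀ F → Dec (L.label F ≡ nothing)
    core? F = L.label F ≟ᵇ nothing
    core : List (Tuple n k)
    core = filter core? P
    core⁺ : ∀ {F} → F ∈ P → L.label F ≡ nothing → F ∈ core
    core⁺ = ∈-filter⁺ core?
    core⁻ : ∀ {F} → F ∈ core → F ∈ P × L.label F ≡ nothing
    core⁻ = ∈-filter⁻ core? {xs = P}
    loss : ∀ {c} → (∀ {x y b} ys → (x , y) ∈ J → Pair x y b → Unique ys → (∀ {F} → F ∈ ys → F ∈ P) →
             Dep (_∈ ys) x y b → length ys ≤ c) →
           ∀ zs → Unique zs → (∀ {F} → F ∈ zs → F ∈ P × F ∉ core) → length zs ≤ length J * (k * s) * c
    loss {c} small zs uzs sub = subst (λ l → length zs ≤ l * c) (trans (length-map just (bins s J)) (length-bins s J))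
      (fibre-upper _≟ᵇ_ L.label (map just (bins s J)) uzs into part)
      where
      into : ∀ {F} → F ∈ zs → L.label F ∈ map just (bins s J)
      into {F} F∈ with L.label F in eq
      ... | nothing                  = contradiction (core⁺ (proj₁ (sub F∈)) eq) (proj₂ (sub F∈))
      ... | just ((x , y) , (b , j)) = ∈-map⁺ just (∈-bins (proj₁ (L.bin-valid (proj₁ (sub F∈)) eq)))
      part : ∀ b → b ∈ map just (bins s J) → ∀ ys → Unique ys → (∀ {F} → F ∈ ys → F ∈ zs × L.label F ≡ b) → length ys ≤ c
      part nothing b∈ ys uys ys⊆ with ∈-map⁻ just b∈
      ... | _ , _ , ()
      part (just _) b∈ [] uys ys⊆ = z≤n
      part (just ((x , y) , (b , j))) b∈ ys@(_ ∷ _) uys ys⊆ =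
        let first = ys⊆ (here refl); xy∈J , b∈xy = L.bin-valid (proj₁ (sub (proj₁ first))) (proj₂ first) in
        small ys xy∈J b∈xy uys (λ F∈ → proj₁ (sub (proj₁ (ys⊆ F∈))))
          λ F F′ F∈ F′∈ → L.bin-dep F F′ (proj₁ (sub (proj₁ (ys⊆ F∈))) , proj₂ (ys⊆ F∈))
                                         (proj₁ (sub (proj₁ (ys⊆ F′∈))) , proj₂ (ys⊆ F′∈))

_≟ᵗ_ : ∀ {n k} → DecidableEquality (Tuple n k)
_≟ᵗ_ = Vec.≡-dec Fin._≟_

shadow : ∀ {n k} → Fin (suc k) → List (Tuple n (suc k)) → List (Tuple n k)
shadow y Q = deduplicate _≟ᵗ_ (map (λ F → removeAt F y) Q)

unique-shadow : ∀ {n k} (y : Fin (suc k)) (Q : List (Tuple n (suc k))) → Unique (shadow y Q)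
unique-shadow y Q = DecUniq.deduplicate-! _≟ᵗ_ (map (λ F → removeAt F y) Q)

∈-shadow⁺ : ∀ {n k} (y : Fin (suc k)) {Q : List (Tuple n (suc k))} {F} → F ∈ Q → removeAt F y ∈ shadow y Q
∈-shadow⁺ y F∈ = ∈-deduplicate⁺ _≟ᵗ_ (∈-map⁺ (λ F → removeAt F y) F∈)

∈-shadow⁻ : ∀ {n k} (y : Fin (suc k)) {Q : List (Tuple n (suc k))} {K} → K ∈ shadow y Q →
  ∃[ F ] (F ∈ Q × K ≡ removeAt F y)
∈-shadow⁻ y {Q} K∈ = ∈-map⁻ (λ F → removeAt F y) (∈-deduplicate⁻ _≟ᵗ_ (map (λ F → removeAt F y) Q) K∈)

-- A fully rich part P of the shadow is lifted to Q by restoring coordinate y.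
lift-rich : ∀ {n k} s (Q : List (Tuple n (suc k))) (y : Fin (suc k)) → Rich s (_∈ Q) (Pair y y) →
  (P : List (Tuple n k)) → (∀ {K} → K ∈ P → K ∈ shadow y Q) → FullyRich s (_∈ P) →
  ∀ X → Decidable X → X y → Rich s (λ F → F ∈ Q × removeAt F y ∈ P) X
lift-rich {n} {k} s Q y y-rich P P⊆ full X X? Xy F (F∈Q , K∈P) W
  with full (X ∘ punchIn y) (X? ∘ punchIn y) (removeAt F y) K∈P W
... | K′ , K′∈P , ag , av with ∈-shadow⁻ y (P⊆ K′∈P)
-- The restored value at y may hit `W`; richness at y moves it away without altering the
-- restriction.
... | F₁ , F₁∈Q , refl with y-rich F₁ F₁∈Q W
... | F₂ , F₂∈Q , ag₂ , av₂ =
  F₂ , (F₂∈Q , subst (_∈ P) (agree⇒removeAt-≡ y ag₂) K′∈P) , agreeing same , avoid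
  where
  at : ∀ {c} → (y≢c : y ≢ c) → lookup (removeAt F₁ y) (punchOut y≢c) ≡ lookup F₂ c
  at {c} y≢c = trans (removeAt-punchOut F₁ y≢c) (agree ag₂ c λ { (inj₁ e) → y≢c (sym e) ; (inj₂ e) → y≢c (sym e) })
  same : ∀ c → ¬ X c → lookup F c ≡ lookup F₂ c
  same c ¬Xc = trans (sym (removeAt-punchOut F y≢c))
    (trans (agree ag (punchOut y≢c) (λ Xc → ¬Xc (subst X (Fin.punchIn-punchOut y≢c) Xc))) (at y≢c))
    where
    y≢c : y ≢ c
    y≢c refl = ¬Xc Xy
  avoid : Avoids X F₂ W
  avoid c Xc j eq with y Fin.≟ c
  ... | yes refl = av₂ y (inj₁ refl) j eq
  ... | no y≢c   = av (punchOut y≢c) (subst X (sym (Fin.punchIn-punchOut y≢c)) Xc) j (trans (at y≢c) eq)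

-- Each round avoids the values found so far, so a threshold of t produces t different values at
-- position b.
spread : ∀ {n k} t (P : Tuple n k → Set) b → Rich t P (Pair b b) → ∀ F → P F → ∀ i → i ≤ t →
  ∃[ vals ] (Unique vals × length vals ≡ i ×
    (∀ {β} → β ∈ vals → ∃[ V ] (P V × AgreeOff (Pair b b) F V × lookup V b ≡ β)))
spread t P b rich F PF zero    _ = [] , [] , refl , λ ()
spread t P b rich F PF (suc i) i<t with spread t P b rich F PF i (<⇒≤ i<t)
... | vals , u , len , realise with rich F PF (pad (lookup F b) vals t)
... | V , PV , ag , av = lookup V b ∷ vals , ∉-unique new u , cong suc len , λ where
    (here refl) → V , PV , ag , refl
    (there β∈)  → realise β∈
  where
  new : lookup V b ∉ vals
  new v∈ = let j , eq = ∈-pad (lookup F b) t v∈ (subst (_≤ t) (sym len) (<⇒≤ i<t)) in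
    av b (inj₁ refl) j (sym eq)

-- A branching process with t choices at each position of `bs`. Later choices leave coordinate b
-- untouched, so tuples from different branches differ there.
grow : ∀ {n k} t (P : Tuple n k → Set) (bs : List (Fin k)) → Unique bs → (∀ {b} → b ∈ bs → Rich t P (Pair b b)) →
  ∀ F → P F → ∃[ Vs ] (Unique Vs × (∀ {V} → V ∈ Vs → P V × AgreeOff (_∈ bs) F V) × t ^ length bs ≤ length Vs)
grow t P [] _ rich F PF = F ∷ [] , [] ∷ [] , (λ { (here refl) → PF , agree-refl }) , ≤-refl
grow t P (b ∷ bs) u@(_ ∷ ubs) rich F PF with spread t P b (rich (here refl)) F PF t ≤-refl
... | vals , uvals , len , realise =
  let Vs , uVs , sub , le = fibre-collect (λ V → lookup V b) {Q = λ V → P V × AgreeOff (_∈ b ∷ bs) F V} vals uvals branch in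
  Vs , uVs , (λ V∈ → proj₁ (sub V∈)) , subst (λ l → l * t ^ length bs ≤ length Vs) len le
  where
  branch : ∀ {β} → β ∈ vals → ∃[ Vs ] (Unique Vs ×
    (∀ {V} → V ∈ Vs → (P V × AgreeOff (_∈ b ∷ bs) F V) × lookup V b ≡ β) × t ^ length bs ≤ length Vs)
  branch β∈ with realise β∈
  ... | V₀ , PV₀ , ag₀ , refl with grow t P bs ubs (rich ∘ there) V₀ PV₀
  ... | Vs , uVs , sub , le = Vs , uVs , (λ {V} V∈ → (proj₁ (sub V∈) ,
      agreeing λ c c∉ → trans (agree ag₀ c λ { (inj₁ e) → c∉ (here e) ; (inj₂ e) → c∉ (here e) })
                              (agree (proj₂ (sub V∈)) c (c∉ ∘ there))) ,
      sym (agree (proj₂ (sub V∈)) b (Unique[x∷xs]⇒x∉xs u))) , le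

setOf : ∀ {n k} → Tuple n k → Subset n
setOf F = Vec.tabulate λ x → Dec.does (Fin.any? λ c → lookup F c Fin.≟ x)

∈-setOf⁺ : ∀ {n k} (F : Tuple n k) c → lookup F c Sub.∈ setOf F
∈-setOf⁺ F c = Vec.lookup⇒[]= _ _ (trans (Vec.lookup∘tabulate _ (lookup F c))
  (Dec.dec-true (Fin.any? λ d → lookup F d Fin.≟ lookup F c) (c , refl)))

∈-setOf⁻ : ∀ {n k} (F : Tuple n k) {x} → x Sub.∈ setOf F → ∃[ c ] (lookup F c ≡ x)
∈-setOf⁻ F {x} x∈ = from-does (Fin.any? λ c → lookup F c Fin.≟ x)
  (trans (sym (Vec.lookup∘tabulate (λ x → Dec.does (Fin.any? λ c → lookup F c Fin.≟ x)) x)) (Vec.[]=⇒lookup x∈))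

∣setOf∣ : ∀ {n k} (F : Tuple n k) → LookupInjective F → ∣ setOf F ∣ ≡ k
∣setOf∣ {n} {k} F inj = trans (sym (length-elements (setOf F))) (≤-antisym
  (subst (length (elements (setOf F)) ≤_) length-image
    (unique-⊆-length (unique-elements (setOf F)) λ x∈ → let c , eq = ∈-setOf⁻ F (∈-elements⁻ x∈) in
      subst (_∈ image) eq (∈-map⁺ (lookup F) (∈-allFin c))))
  (subst (_≤ length (elements (setOf F))) length-image
    (unique-⊆-length (Uniq.map⁺ inj (Uniq.allFin⁺ k)) λ x∈ → let c , _ , eq = ∈-map⁻ (lookup F) x∈ in
      ∈-elements⁺ (subst (Sub._∈ setOf F) (sym eq) (∈-setOf⁺ F c)))))
  where
  image : List (Fin n)
  image = map (lookup F) (allFin k)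
  length-image : length image ≡ k
  length-image = trans (length-map (lookup F) (allFin k)) (length-allFin k)

removeAt-injective : ∀ {n k} (F : Tuple n (suc k)) z → LookupInjective F → LookupInjective (removeAt F z)
removeAt-injective F z inj {c} {d} eq = Fin.punchIn-injective z c d
  (inj (trans (sym (lookup-removeAt F z c)) (trans eq (lookup-removeAt F z d))))

subsetTuples : ∀ {n k} (ys : List (Subset n)) → (∀ {Y} → Y ∈ ys → ∣ Y ∣ ≡ k) → List (Tuple n k)
subsetTuples []       size = []
subsetTuples (Y ∷ ys) size = subsetTuple Y (size (here refl)) ∷ subsetTuples ys (size ∘ there)

length-subsetTuples : ∀ {n k} (ys : List (Subset n)) (size : ∀ {Y} → Y ∈ ys → ∣ Y ∣ ≡ k) →
  length (subsetTuples ys size) ≡ length ys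
length-subsetTuples []       size = refl
length-subsetTuples (Y ∷ ys) size = cong suc (length-subsetTuples ys (size ∘ there))

∈-subsetTuples⁻ : ∀ {n k} (ys : List (Subset n)) (size : ∀ {Y} → Y ∈ ys → ∣ Y ∣ ≡ k) {K} →
  K ∈ subsetTuples ys size → ∃[ Y ] ∃[ eq ] (Y ∈ ys × K ≡ subsetTuple Y eq)
∈-subsetTuples⁻ (Y ∷ ys) size (here refl) = Y , size (here refl) , here refl , refl
∈-subsetTuples⁻ (Y ∷ ys) size (there K∈)  = let Y′ , eq , Y′∈ , e = ∈-subsetTuples⁻ ys (size ∘ there) K∈ in
  Y′ , eq , there Y′∈ , e

unique-subsetTuples : ∀ {n k} (ys : List (Subset n)) (size : ∀ {Y} → Y ∈ ys → ∣ Y ∣ ≡ k) → Unique ys →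
  Unique (subsetTuples ys size)
unique-subsetTuples []       size u = []
unique-subsetTuples (Y ∷ ys) size u@(_ ∷ u′) = ∉-unique new (unique-subsetTuples ys (size ∘ there) u′)
  where
  new : subsetTuple Y (size (here refl)) ∉ subsetTuples ys (size ∘ there)
  new K∈ with ∈-subsetTuples⁻ ys (size ∘ there) K∈
  ... | Y′ , eq , Y′∈ , e = Unique[x∷xs]⇒x∉xs u (subst (_∈ ys) (sym (subsetTuple-reflects (size (here refl)) eq e)) Y′∈)

length-concatMap-* : ∀ {A B : Set} (f : A → List B) a b (xs : List A) → (∀ x → length (f x) * a ≤ b) →
  length (concatMap f xs) * a ≤ length xs * b
length-concatMap-* f a b []       le = z≤n
length-concatMap-* f a b (x ∷ xs) le = begin
  length (f x ++ concatMap f xs) * a              ≡⟨ cong (_* a) (length-++ (f x)) ⟩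
  (length (f x) + length (concatMap f xs)) * a    ≡⟨ *-distribʳ-+ a (length (f x)) _ ⟩
  length (f x) * a + length (concatMap f xs) * a  ≤⟨ +-mono-≤ (le x) (length-concatMap-* f a b xs le) ⟩
  b + length xs * b                               ∎
  where open ≤-Reasoning

-- The upper bound

module _ {v n q : ℕ} (H : Hypergraph v) (uH : Uniform (3 + q) H) (h : Host (3 + q) H) (le : v + v ≤ n)
         (G : Hypergraph n) (uG : Uniform (3 + q) G) (free : ¬ Embeds H G) where

  private
    -- The number s counts the entries of all tuples placed on the host. The bound `c₁` is for edge
    -- families without a part of type (i) or (ii), and `c₂` is for families of (r - 1)-tuples
    -- without a fully rich part.
    s c₁ c₂ : ℕ
    s = Host.M h * (3 + q)
    c₁ = lossFactor (3 + q) s ((3 + q) * (3 + q)) * n ^ suc q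
    c₂ = lossFactor (2 + q) s (2 + q) * n ^ suc q

    family : List (Tuple n (3 + q))
    family = edgeTuples G uG

    -- Richness for these diagonal pairs is richness at each single position other than z; by unions
    -- this amounts to `RichOff` at z.
    J : Fin (3 + q) → List (Fin (3 + q) × Fin (3 + q))
    J z = map (λ b → punchIn z b , punchIn z b) (allFin (2 + q))

    length-J : ∀ z → length (J z) ≡ 2 + q
    length-J z = trans (length-map (λ b → punchIn z b , punchIn z b) (allFin (2 + q))) (length-allFin (2 + q))

    ∈-J⁺ : ∀ z {b} → z ≢ b → (b , b) ∈ J z
    ∈-J⁺ z z≢b = subst (λ b → (b , b) ∈ J z) (Fin.punchIn-punchOut z≢b)
      (∈-map⁺ (λ b → punchIn z b , punchIn z b) (∈-allFin (punchOut z≢b)))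

    ∈-J⁻ : ∀ z {x y} → (x , y) ∈ J z → z ≢ x × x ≡ y
    ∈-J⁻ z xy∈ with ∈-map⁻ (λ b → punchIn z b , punchIn z b) xy∈
    ... | b , _ , refl = (λ eq → Fin.punchInᵢ≢i z b (sym eq)) , refl

    module Q (z : Fin (3 + q)) = CoreList (coreList s (J z) family (unique-edgeTuples G uG))

  -- A part of type (i) would embed `H`, and a part of type (ii) would lie in some `Q.core z` by
  -- maximality; the given edges admit neither.
  rest-bound : ∀ zs → Unique zs → (∀ {F} → F ∈ zs → F ∈ family × (∀ z → F ∉ Q.core z)) → length zs ≤ c₁
  rest-bound zs uzs sub = typed-free-length s zs uzs
    (λ P P⊆ F∈ y y′ y≢y′ over → free (embed-over s H G uH uG le h ≤-refl (_∈ P)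
      (λ F∈ → edgeTuples-edge G uG (proj₁ (sub (P⊆ F∈)))) (_ , F∈) y y′ y≢y′ over))
    (λ P P⊆ F∈ z off → proj₂ (sub (P⊆ F∈)) z (Q.maximal z (_∈ P) (λ F∈ → proj₁ (sub (P⊆ F∈)))
      (λ {x} {y} xy∈ → off (Pair x y) (pair? x y) (off-z z xy∈)) F∈))
    where
    off-z : ∀ z {x y} → (x , y) ∈ J z → ¬ Pair x y z
    off-z z xy∈ z∈ with ∈-J⁻ z xy∈ | z∈
    ... | z≢x , refl | inj₁ z≡x = z≢x z≡x
    ... | z≢x , refl | inj₂ z≡x = z≢x z≡x

  -- A fully rich part of the shadow lifts to a subfamily of `Q.core z` that is rich for every set
  -- containing y, in particular for those containing y and z. These two positions then receive the
  -- degree-1 vertices of the host.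
  shadow-bound : ∀ z y → z ≢ y → length (shadow y (Q.core z)) ≤ c₂
  shadow-bound z y z≢y = fully-rich-free-length s (shadow y (Q.core z)) (unique-shadow y (Q.core z)) none
    where
    none : ∀ P → (∀ {K} → K ∈ P → K ∈ shadow y (Q.core z)) → ∀ {K} → K ∈ P → ¬ FullyRich s (_∈ P)
    none P P⊆ {K} K∈ full = free (embed-over s H G uH uG le h ≤-refl
      (λ F → F ∈ Q.core z × removeAt F y ∈ P) (λ F∈ → edgeTuples-edge G uG (Q.core⊆ z (proj₁ F∈)))
      (let F , F∈ , eq = ∈-shadow⁻ y (P⊆ K∈) in F , F∈ , subst (_∈ P) eq K∈)
      y z (z≢y ∘ sym)
      λ X X? Xy _ → lift-rich s (Q.core z) y (Q.rich z (∈-J⁺ z z≢y)) P P⊆ full X X? Xy)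

  module _ (t : ℕ) where

    private
      -- A second cleaning with t in place of s: what survives can be altered at each position other
      -- than z while avoiding any t vertices.
      module Qᵗ (z : Fin (3 + q)) = CoreList (coreList t (J z) (Q.core z) (Q.unique z))

    -- The second cleaning has a number of bins linear in t. In a bin for position x, coordinate x
    -- is determined by the others, so the bin injects into the shadow omitting x and has at most
    -- `c₂` members.
    light-at-bound : ∀ z zs → Unique zs → (∀ {F} → F ∈ zs → F ∈ Q.core z × F ∉ Qᵗ.core z) →
      length zs ≤ (2 + q) * ((3 + q) * t) * c₂
    light-at-bound z zs uzs sub = subst (λ l → length zs ≤ l * ((3 + q) * t) * c₂) (length-J z)
      (Qᵗ.loss z determined zs uzs sub)
      where
      determined : ∀ {x y b} ys → (x , y) ∈ J z → Pair x y b → Unique ys → (∀ {F} → F ∈ ys → F ∈ Q.core z) →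
        Dep (_∈ ys) x y b → length ys ≤ c₂
      determined {x} {y} {b} ys xy∈ b∈ uys ys⊆ dep with ∈-J⁻ z xy∈
      ... | z≢x , refl = ≤-trans (injection-length (λ F → removeAt F x) uys inj (λ F∈ → ∈-shadow⁺ x (ys⊆ F∈)))
                                 (shadow-bound z x z≢x)
        where
        b≡x : ∀ {b} → Pair x x b → b ≡ x
        b≡x (inj₁ e) = e
        b≡x (inj₂ e) = e
        inj : ∀ {F F′} → F ∈ ys → F′ ∈ ys → removeAt F x ≡ removeAt F′ x → F ≡ F′
        inj {F} {F′} F∈ F′∈ eq = lookup-ext pointwise
          where
          ag : AgreeOff (Pair x x) F F′
          ag = removeAt-≡⇒agree x eq
          pointwise : ∀ c → lookup F c ≡ lookup F′ c
          pointwise c with c Fin.≟ x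
          ... | yes refl = subst (λ c → lookup F c ≡ lookup F′ c) (b≡x b∈) (dep F F′ F∈ F′∈ ag)
          ... | no  c≢x  = agree ag c (c≢x ∘ b≡x)

    centresAt : Fin (3 + q) → List (Fin n)
    centresAt z = deduplicate Fin._≟_ (map (λ F → lookup F z) (Qᵗ.core z))

    -- Every centre in position z carries at least t ^ (r − 2) members of the shadow of Q z.
    centresAt-bound : ∀ z → length (centresAt z) * t ^ suc q ≤ c₂
    centresAt-bound z = ≤-trans
      (fibre-lower (λ K → lookup K (punchOut y≢z)) {c = t ^ suc q} (centresAt z) {xs = shadow y (Q.core z)}
        (DecUniq.deduplicate-! Fin._≟_ (map (λ F → lookup F z) (Qᵗ.core z))) branch)
      (shadow-bound z y z≢y)
      where
      y : Fin (3 + q)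
      y = punchIn z zero
      y≢z : y ≢ z
      y≢z = Fin.punchInᵢ≢i z zero
      z≢y : z ≢ y
      z≢y = y≢z ∘ sym
      -- Apart from y, which the shadow omits, and z, which holds the centre, there are r - 2
      -- positions; `grow` varies these. As coordinate y stays fixed, omitting it loses no tuple.
      ι : Fin (suc q) → Fin (3 + q)
      ι c = punchIn y (punchIn (punchOut y≢z) c)
      ι≢y : ∀ c → y ≢ ι c
      ι≢y c eq = Fin.punchInᵢ≢i y _ (sym eq)
      ι≢z : ∀ c → z ≢ ι c
      ι≢z c eq = Fin.punchInᵢ≢i (punchOut y≢z) c
        (Fin.punchIn-injective y _ _ (trans (sym eq) (sym (Fin.punchIn-punchOut y≢z))))
      bs : List (Fin (3 + q))
      bs = map ι (allFin (suc q))
      length-bs : length bs ≡ suc q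
      length-bs = trans (length-map ι (allFin (suc q))) (length-allFin (suc q))
      ∈-bs : ∀ {b} → b ∈ bs → ∃[ c ] (b ≡ ι c)
      ∈-bs b∈ = let c , _ , eq = ∈-map⁻ ι b∈ in c , eq
      unique-bs : Unique bs
      unique-bs = Uniq.map⁺ (λ eq → Fin.punchIn-injective (punchOut y≢z) _ _ (Fin.punchIn-injective y _ _ eq))
        (Uniq.allFin⁺ (suc q))
      y∉bs : y ∉ bs
      y∉bs y∈ = let c , eq = ∈-bs y∈ in ι≢y c eq
      z∉bs : z ∉ bs
      z∉bs z∈ = let c , eq = ∈-bs z∈ in ι≢z c eq
      bs-rich : ∀ {b} → b ∈ bs → Rich t (_∈ Qᵗ.core z) (Pair b b)
      bs-rich {b} b∈ = Qᵗ.rich z (∈-J⁺ z (λ z≡b → z∉bs (subst (_∈ bs) (sym z≡b) b∈)))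
      branch : ∀ {a} → a ∈ centresAt z → ∃[ ys ] (Unique ys ×
        (∀ {K} → K ∈ ys → K ∈ shadow y (Q.core z) × lookup K (punchOut y≢z) ≡ a) × t ^ suc q ≤ length ys)
      branch a∈ = let F , F∈ , eq = ∈-map⁻ (λ F → lookup F z) (∈-deduplicate⁻ Fin._≟_ (map (λ F → lookup F z) (Qᵗ.core z)) a∈) in
        subst Many (sym eq) (fromTuple F F∈)
        where
        Many : Fin n → Set
        Many a = ∃[ ys ] (Unique ys ×
          (∀ {K} → K ∈ ys → K ∈ shadow y (Q.core z) × lookup K (punchOut y≢z) ≡ a) × t ^ suc q ≤ length ys)
        fromTuple : ∀ F → F ∈ Qᵗ.core z → Many (lookup F z)
        fromTuple F F∈ = map drop-y Vs , map-unique drop-y inj uVs , member ,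
          subst₂ _≤_ (cong (t ^_) length-bs) (sym (length-map drop-y Vs)) (proj₂ (proj₂ (proj₂ grown)))
          where
          drop-y : Tuple n (3 + q) → Tuple n (2 + q)
          drop-y V = removeAt V y
          grown : ∃[ Vs ] (Unique Vs × (∀ {V} → V ∈ Vs → V ∈ Qᵗ.core z × AgreeOff (_∈ bs) F V) ×
            t ^ length bs ≤ length Vs)
          grown = grow t (_∈ Qᵗ.core z) bs unique-bs bs-rich F F∈
          Vs : List (Tuple n (3 + q))
          Vs = proj₁ grown
          uVs : Unique Vs
          uVs = proj₁ (proj₂ grown)
          sub : ∀ {V} → V ∈ Vs → V ∈ Qᵗ.core z × AgreeOff (_∈ bs) F V
          sub = proj₁ (proj₂ (proj₂ grown))
          inj : ∀ {V V′} → V ∈ Vs → V′ ∈ Vs → drop-y V ≡ drop-y V′ → V ≡ V′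
          inj {V} {V′} V∈ V′∈ eq = lookup-ext λ c → pointwise c (c Fin.≟ y)
            where
            pointwise : ∀ c → Dec (c ≡ y) → lookup V c ≡ lookup V′ c
            pointwise c (yes refl) = trans (sym (agree (proj₂ (sub V∈)) y y∉bs)) (agree (proj₂ (sub V′∈)) y y∉bs)
            pointwise c (no  c≢y)  = agree (removeAt-≡⇒agree {F = V} {V′} y eq) c λ { (inj₁ e) → c≢y e ; (inj₂ e) → c≢y e }
          member : ∀ {K} → K ∈ map drop-y Vs → K ∈ shadow y (Q.core z) × lookup K (punchOut y≢z) ≡ lookup F z
          member K∈ = let V , V∈ , eq = ∈-map⁻ drop-y K∈ in
            subst (λ K → K ∈ shadow y (Q.core z) × lookup K (punchOut y≢z) ≡ lookup F z) (sym eq)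
              (∈-shadow⁺ y (Qᵗ.core⊆ z (proj₁ (sub V∈))) ,
               trans (removeAt-punchOut V y≢z) (sym (agree (proj₂ (sub V∈)) z z∉bs)))

    -- A vertex may be listed once for each position; only upper bounds on the length are drawn from
    -- this list.
    centres : List (Fin n)
    centres = concatMap centresAt (allFin (3 + q))

    centres-bound : length centres * t ^ suc q ≤ (3 + q) * c₂
    centres-bound = subst (λ l → length centres * t ^ suc q ≤ l * c₂) (length-allFin (3 + q))
      (length-concatMap-* centresAt (t ^ suc q) c₂ (allFin (3 + q)) centresAt-bound)

    Heavy : Tuple n (3 + q) → Set
    Heavy F = ∃[ z ] (F ∈ Qᵗ.core z)

    heavy? : Decidable Heavy
    heavy? F = Fin.any? λ z → ∈-dec _≟ᵗ_ F (Qᵗ.core z)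

    heavy light : List (Tuple n (3 + q))
    heavy = filter heavy? family
    light = filter (¬? ∘ heavy?) family

    heavy⁻ : ∀ {F} → F ∈ heavy → F ∈ family × Heavy F
    heavy⁻ = ∈-filter⁻ heavy? {xs = family}

    -- A light edge either lies in some `Q.core z` and was deleted by the second cleaning there, or
    -- lies in none and is counted by `rest-bound`.
    light-bound : length light ≤ (3 + q) * ((2 + q) * ((3 + q) * t) * c₂) + c₁
    light-bound = begin
      length light
        ≡⟨ length-filter-split inQ? light ⟩
      length (filter inQ? light) + length (filter (¬? ∘ inQ?) light)
        ≤⟨ +-mono-≤ (subst (λ l → length (filter inQ? light) ≤ l * B) (length-allFin (3 + q))
             (fibre-upper Fin._≟_ type (allFin (3 + q)) (Uniq.filter⁺ inQ? unique-light) (λ _ → ∈-allFin _)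
               λ z _ ys uys sub → light-at-bound z ys uys λ F∈ → let F∈f , eq = sub F∈ in
                 subst (λ z → _ ∈ Q.core z) eq (type-∈ (proj₂ (inQ⁻ F∈f))) ,
                 λ F∈Qᵗ → proj₂ (light⁻ (proj₁ (inQ⁻ F∈f))) (z , F∈Qᵗ)))
             (rest-bound _ (Uniq.filter⁺ (¬? ∘ inQ?) unique-light) λ F∈ →
               let F∈l , none = ∈-filter⁻ (¬? ∘ inQ?) {xs = light} F∈ in
               proj₁ (light⁻ F∈l) , λ z F∈Q → none (z , F∈Q)) ⟩
      (3 + q) * B + c₁ ∎
      where
      open ≤-Reasoning
      B : ℕ
      B = (2 + q) * ((3 + q) * t) * c₂
      light⁻ : ∀ {F} → F ∈ light → F ∈ family × ¬ Heavy F
      light⁻ = ∈-filter⁻ (¬? ∘ heavy?) {xs = family}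
      unique-light : Unique light
      unique-light = Uniq.filter⁺ (¬? ∘ heavy?) (unique-edgeTuples G uG)
      InQ : Tuple n (3 + q) → Set
      InQ F = ∃[ z ] (F ∈ Q.core z)
      inQ? : Decidable InQ
      inQ? F = Fin.any? λ z → ∈-dec _≟ᵗ_ F (Q.core z)
      inQ⁻ : ∀ {F} → F ∈ filter inQ? light → F ∈ light × InQ F
      inQ⁻ = ∈-filter⁻ inQ? {xs = light}
      pick : ∀ F → Dec (InQ F) → Fin (3 + q)
      pick F (yes (z , _)) = z
      pick F (no _)        = zero
      type : Tuple n (3 + q) → Fin (3 + q)
      type F = pick F (inQ? F)
      type-∈ : ∀ {F} → InQ F → F ∈ Q.core (type F)
      type-∈ {F} F∈Q = pick-∈ (inQ? F)
        where
        pick-∈ : ∀ d → F ∈ Q.core (pick F d)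
        pick-∈ (yes (_ , F∈)) = F∈
        pick-∈ (no none)      = contradiction F∈Q none

    pickPosition : ∀ F → Dec (Heavy F) → Fin (3 + q)
    pickPosition F (yes (z , _)) = z
    pickPosition F (no _)        = zero

    opaque

      position : Tuple n (3 + q) → Fin (3 + q)
      position F = pickPosition F (heavy? F)

      position-∈ : ∀ {F} → Heavy F → F ∈ Qᵗ.core (position F)
      position-∈ {F} heavyF = pick-∈ (heavy? F)
        where
        pick-∈ : ∀ d → F ∈ Qᵗ.core (pickPosition F d)
        pick-∈ (yes (_ , F∈)) = F∈
        pick-∈ (no none)      = contradiction heavyF none

    centre : Tuple n (3 + q) → Fin n
    centre F = lookup F (position F)

    -- A set rather than a tuple, because edges over the same (r - 1)-set may have their centres in
    -- different positions.
    remainder : Tuple n (3 + q) → Subset n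
    remainder F = setOf (removeAt F (position F))

    centre∈ : ∀ {F} → Heavy F → centre F ∈ centres
    centre∈ {F} heavyF = ∈-concatMap⁺ centresAt (lose (∈-allFin (position F))
      (∈-deduplicate⁺ Fin._≟_ (∈-map⁺ (λ F′ → lookup F′ (position F)) (position-∈ heavyF))))

    family-injective : ∀ {F} → F ∈ family → LookupInjective F
    family-injective F∈ = proj₁ (edgeTuples-edge G uG F∈)

    remainder-size : ∀ {F} → F ∈ family → ∣ remainder F ∣ ≡ 2 + q
    remainder-size {F} F∈ = ∣setOf∣ (removeAt F (position F)) (removeAt-injective F (position F) (family-injective F∈))

    centre-injective : ∀ {F F′} → F ∈ family → F′ ∈ family → remainder F ≡ remainder F′ → centre F ≡ centre F′ → F ≡ F′
    centre-injective F∈ F′∈ = match (edgeTuples⁻ G uG F∈) (edgeTuples⁻ G uG F′∈)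
      where
      tuple : Fin (m G) → Tuple n (3 + q)
      tuple i = subsetTuple (edge G i) (uG i)
      half : ∀ i j → remainder (tuple i) ≡ remainder (tuple j) → centre (tuple i) ≡ centre (tuple j) →
        edge G i Sub.⊆ edge G j
      half i j eqY eqc {x} x∈ = let c , eq = subsetTuple-onto (edge G i) (uG i) x∈ in
        subst (Sub._∈ edge G j) eq (entry∈ c (z Fin.≟ c))
        where
        z z′ : Fin (3 + q)
        z = position (tuple i)
        z′ = position (tuple j)
        entry∈ : ∀ c → Dec (z ≡ c) → lookup (tuple i) c Sub.∈ edge G j
        entry∈ c (yes refl) = subst (Sub._∈ edge G j) (sym eqc) (subsetTuple-∈ (edge G j) (uG j) z′)
        entry∈ c (no z≢c)   =
          let d , eqd = ∈-setOf⁻ (removeAt (tuple j) z′) (subst (lookup (tuple i) c Sub.∈_) eqY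
                (subst (Sub._∈ remainder (tuple i)) (removeAt-punchOut (tuple i) z≢c)
                  (∈-setOf⁺ (removeAt (tuple i) z) (punchOut z≢c)))) in
          subst (Sub._∈ edge G j) (trans (sym (lookup-removeAt (tuple j) z′ d)) eqd)
            (subsetTuple-∈ (edge G j) (uG j) (punchIn z′ d))
      match : ∀ {F F′} → ∃[ i ] (F ≡ tuple i) → ∃[ j ] (F′ ≡ tuple j) →
        remainder F ≡ remainder F′ → centre F ≡ centre F′ → F ≡ F′
      match (i , refl) (j , refl) eqY eqc =
        cong tuple (edge-inj G (⊆-antisym (half i j eqY eqc) (half j i (sym eqY) (sym eqc))))

    -- This means that a is not in Y and that Y together with a is an edge of `G`. The phrasing by
    -- edges and positions makes it decidable and matches `centre` and `remainder`.
    Joined : Fin n → Subset n → Set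
    Joined a Y = ∃[ i ] ∃[ z ] (lookup (subsetTuple (edge G i) (uG i)) z ≡ a ×
      setOf (removeAt (subsetTuple (edge G i) (uG i)) z) ≡ Y)

    joined? : ∀ a Y → Dec (Joined a Y)
    joined? a Y = Fin.any? λ i → Fin.any? λ z → (lookup (subsetTuple (edge G i) (uG i)) z Fin.≟ a) ×-dec
      Vec.≡-dec Data.Bool._≟_ (setOf (removeAt (subsetTuple (edge G i) (uG i)) z)) Y

    joined-edge : ∀ {a Y} (eq : ∣ Y ∣ ≡ 2 + q) → Joined a Y → EdgeTuple G (a ∷ subsetTuple Y eq)
    joined-edge {_} {Y} eq (i , z , refl , refl) = inj , edge G i , (i , refl) , entry∈
      where
      F = subsetTuple (edge G i) (uG i)
      K = subsetTuple Y eq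
      source : ∀ c → ∃[ d ] (lookup F (punchIn z d) ≡ lookup K c)
      source c = let d , e = ∈-setOf⁻ (removeAt F z) (subsetTuple-∈ Y eq c) in d , trans (sym (lookup-removeAt F z d)) e
      z≢ : ∀ c → lookup F z ≢ lookup K c
      z≢ c e = let d , e′ = source c in
        Fin.punchInᵢ≢i z d (subsetTuple-injective (edge G i) (uG i) (trans e′ (sym e)))
      inj : LookupInjective (lookup F z ∷ K)
      inj {zero}  {zero}  e = refl
      inj {zero}  {suc d} e = contradiction e (z≢ d)
      inj {suc c} {zero}  e = contradiction (sym e) (z≢ c)
      inj {suc c} {suc d} e = cong suc (subsetTuple-injective Y eq e)
      entry∈ : ∀ c → lookup (lookup F z ∷ K) c Sub.∈ edge G i
      entry∈ zero    = subsetTuple-∈ (edge G i) (uG i) z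
      entry∈ (suc c) = let d , e = source c in subst (Sub._∈ edge G i) e (subsetTuple-∈ (edge G i) (uG i) (punchIn z d))

    -- From here to `upper-bound`, the size of the cross-cut is `suc σ`, so `σ` is the number of
    -- centres that an unpopular set may still have.
    module _ {σ : ℕ} (X : Subset v) (cross : CrossCut H X) (∣X∣≡σ : ∣ X ∣ ≡ suc σ) where

      Common : Subset n → Tuple n (suc σ) → Set
      Common Y S = (∀ c d → lookup S c ≡ lookup S d → c ≡ d) × (∀ j → Joined (lookup S j) Y)

      common? : ∀ Y → Decidable (Common Y)
      common? Y S = (Fin.all? λ c → Fin.all? λ d → (lookup S c Fin.≟ lookup S d) →-dec (c Fin.≟ d)) ×-dec
        (Fin.all? λ j → joined? (lookup S j) Y)

      common-bound : ∀ S ys → Unique ys → (∀ {Y} → Y ∈ ys → ∣ Y ∣ ≡ 2 + q × Common Y S) → length ys ≤ c₂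
      common-bound S ys uys sub = subst (_≤ c₂) (length-subsetTuples ys size)
        (fully-rich-free-length s (subsetTuples ys size) (unique-subsetTuples ys size uys) none)
        where
        size : ∀ {Y} → Y ∈ ys → ∣ Y ∣ ≡ 2 + q
        size Y∈ = proj₁ (sub Y∈)
        none : ∀ P → (∀ {K} → K ∈ P → K ∈ subsetTuples ys size) → ∀ {K} → K ∈ P → ¬ FullyRich s (_∈ P)
        none P P⊆ {K₀} K₀∈ full = free (embed-crosscut s H G uH uG le h
          (*-monoʳ-≤ (Host.M h) (n≤1+n (2 + q))) X cross τ τ-inj (_∈ P) P-inj P-edge (K₀ , K₀∈) full)
          where
          index : ∀ {x} → x Sub.∈ X → Fin (suc σ)
          index x∈ = proj₁ (subsetTuple-onto X ∣X∣≡σ x∈)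
          choose : ∀ {x} → Dec (x Sub.∈ X) → Fin n
          choose (yes x∈) = lookup S (index x∈)
          choose (no _)   = lookup K₀ zero
          τ : Fin v → Fin n
          τ x = choose (x ∈? X)
          τ-at : ∀ {x} → x Sub.∈ X → ∃[ j ] (lookup (subsetTuple X ∣X∣≡σ) j ≡ x × τ x ≡ lookup S j)
          τ-at {x} x∈ with x ∈? X
          ... | yes x∈′ = index x∈′ , proj₂ (subsetTuple-onto X ∣X∣≡σ x∈′) , refl
          ... | no x∉   = contradiction x∈ x∉
          common : ∀ {K} → K ∈ P → ∃[ Y ] ∃[ eq ] (Common Y S × K ≡ subsetTuple {k = 2 + q} Y eq)
          common K∈ = let Y , eq , Y∈ , e = ∈-subsetTuples⁻ ys size (P⊆ K∈) in Y , eq , proj₂ (sub Y∈) , e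
          τ-inj : ∀ {x y} → x Sub.∈ X → y Sub.∈ X → τ x ≡ τ y → x ≡ y
          τ-inj x∈ y∈ eq = let i , ei , ti = τ-at x∈; j , ej , tj = τ-at y∈; _ , _ , (S-inj , _) , _ = common K₀∈ in
            trans (sym ei) (trans (cong (lookup (subsetTuple X ∣X∣≡σ)) (S-inj i j (trans (sym ti) (trans eq tj)))) ej)
          P-inj : ∀ {K} → K ∈ P → LookupInjective K
          P-inj K∈ with common K∈
          ... | Y , eq , _ , refl = subsetTuple-injective Y eq
          P-edge : ∀ {K x} → K ∈ P → x Sub.∈ X → EdgeTuple G (τ x ∷ K)
          P-edge K∈ x∈ with common K∈ | τ-at x∈
          ... | Y , eq , (_ , joined) , refl | j , _ , tj =
            subst (λ a → EdgeTuple G (a ∷ subsetTuple Y eq)) (sym tj) (joined-edge eq (joined j))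

      Popular : Subset n → Set
      Popular Y = ∃[ S ] (S ∈ vectors centres (suc σ) × Common Y S)

      opaque

        popular? : Decidable Popular
        popular? Y = Dec.map′ find (λ (S , S∈ , common) → lose S∈ common) (any? (common? Y) (vectors centres (suc σ)))

      popularSets : List (Subset n)
      popularSets = filter popular? (subsetsOfSize n (2 + q))

      popularSets-bound : length popularSets ≤ length centres ^ suc σ * c₂
      popularSets-bound = subst (λ l → length popularSets ≤ l * c₂)
        (trans (length-map just (vectors centres (suc σ))) (length-vectors centres (suc σ)))
        (fibre-upper (Maybe.≡-dec _≟ᵗ_) witness (map just (vectors centres (suc σ)))
          (Uniq.filter⁺ popular? (unique-subsetsOfSize n (2 + q)))
          (λ Y∈ → let S , S∈ , _ , eq = witness-∈ (proj₂ (popular⁻ Y∈)) in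
            subst (_∈ map just (vectors centres (suc σ))) (sym eq) (∈-map⁺ just S∈))
          part)
        where
        popular⁻ : ∀ {Y} → Y ∈ popularSets → Y ∈ subsetsOfSize n (2 + q) × Popular Y
        popular⁻ = ∈-filter⁻ popular? {xs = subsetsOfSize n (2 + q)}
        pick : ∀ {Y} → Dec (Popular Y) → Maybe (Tuple n (suc σ))
        pick (yes (S , _)) = just S
        pick (no _)        = nothing
        witness : Subset n → Maybe (Tuple n (suc σ))
        witness Y = pick (popular? Y)
        pick-∈ : ∀ {Y} (d : Dec (Popular Y)) → Popular Y → ∃[ S ] (S ∈ vectors centres (suc σ) × Common Y S × pick d ≡ just S)
        pick-∈ (yes (S , S∈ , common)) _   = S , S∈ , common , refl
        pick-∈ (no none)               pop = contradiction pop none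
        witness-∈ : ∀ {Y} → Popular Y → ∃[ S ] (S ∈ vectors centres (suc σ) × Common Y S × witness Y ≡ just S)
        witness-∈ {Y} = pick-∈ (popular? Y)
        part : ∀ w → w ∈ map just (vectors centres (suc σ)) → ∀ ys → Unique ys →
          (∀ {Y} → Y ∈ ys → Y ∈ popularSets × witness Y ≡ w) → length ys ≤ c₂
        part w w∈ ys uys sub with ∈-map⁻ just w∈
        ... | S , _ , refl = common-bound S ys uys λ {Y} Y∈ →
          let Y∈p , eq = sub Y∈; Y∈s , pop = popular⁻ Y∈p; S′ , _ , common , eq′ = witness-∈ pop in
          subsetsOfSize-size n (2 + q) Y∈s , subst (Common Y) (Maybe.just-injective (trans (sym eq′) eq)) common

      -- A heavy edge is determined by its remainder and its centre. So a popular remainder carries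
      -- at most as many heavy edges as there are centres, and any other remainder carries at most
      -- `σ`.
      heavy-bound : length heavy ≤ length popularSets * length centres + (n C (2 + q)) * σ
      heavy-bound = begin
        length heavy
          ≡⟨ length-filter-split pop? heavy ⟩
        length (filter pop? heavy) + length (filter (¬? ∘ pop?) heavy)
          ≤⟨ +-mono-≤
              (fibre-upper _≟ˢ_ remainder popularSets (Uniq.filter⁺ pop? unique-heavy)
                (λ F∈ → let F∈h , pop = ∈-filter⁻ pop? {xs = heavy} F∈ in
                  ∈-filter⁺ popular? (∈-subsetsOfSize (2 + q) (remainder-size (proj₁ (heavy⁻ F∈h)))) pop)
                λ Y _ ys uys sub → injection-length centre uys
                  (λ F∈ F′∈ → centre-inj (λ F∈ → let F∈p , eq = sub F∈ in proj₁ (∈-filter⁻ pop? {xs = heavy} F∈p) , eq) F∈ F′∈)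
                  (λ F∈ → centre∈ (proj₂ (heavy⁻ (proj₁ (∈-filter⁻ pop? {xs = heavy} (proj₁ (sub F∈))))))))
              (subst (λ l → length (filter (¬? ∘ pop?) heavy) ≤ l * σ) (length-subsetsOfSize n (2 + q))
                (fibre-upper _≟ˢ_ remainder (subsetsOfSize n (2 + q)) (Uniq.filter⁺ (¬? ∘ pop?) unique-heavy)
                  (λ F∈ → ∈-subsetsOfSize (2 + q) (remainder-size (proj₁ (heavy⁻ (proj₁ (∈-filter⁻ (¬? ∘ pop?) {xs = heavy} F∈))))))
                  unpopular)) ⟩
        length popularSets * length centres + (n C (2 + q)) * σ ∎
        where
        open ≤-Reasoning
        _≟ˢ_ : DecidableEquality (Subset n)
        _≟ˢ_ = Vec.≡-dec Data.Bool._≟_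
        pop? : ∀ F → Dec (Popular (remainder F))
        pop? F = popular? (remainder F)
        unique-heavy : Unique heavy
        unique-heavy = Uniq.filter⁺ heavy? (unique-edgeTuples G uG)
        centre-inj : ∀ {Y ys} → (∀ {F} → F ∈ ys → F ∈ heavy × remainder F ≡ Y) →
          ∀ {F F′} → F ∈ ys → F′ ∈ ys → centre F ≡ centre F′ → F ≡ F′
        centre-inj sub F∈ F′∈ = centre-injective (proj₁ (heavy⁻ (proj₁ (sub F∈)))) (proj₁ (heavy⁻ (proj₁ (sub F′∈))))
          (trans (proj₂ (sub F∈)) (sym (proj₂ (sub F′∈))))
        unpopular : ∀ Y → Y ∈ subsetsOfSize n (2 + q) → ∀ ys → Unique ys →
          (∀ {F} → F ∈ ys → F ∈ filter (¬? ∘ pop?) heavy × remainder F ≡ Y) → length ys ≤ σ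
        unpopular Y _ ys uys sub = ≮⇒≥ λ many → many-centres many
          where
          many-centres : ¬ suc σ ≤ length ys
          many-centres many = contradiction popular (subst (λ Y → ¬ Popular Y) (proj₂ (sub (proj₂ first)))
                           (proj₂ (∈-filter⁻ (¬? ∘ pop?) {xs = heavy} (proj₁ (sub (proj₂ first))))))
            where
            first : ∃[ F ] (F ∈ ys)
            first = nonempty-if {m = 0} ys λ none → contradiction (≤-trans many none) λ ()
            sub′ : ∀ {F} → F ∈ ys → F ∈ heavy × remainder F ≡ Y
            sub′ F∈ = let F∈u , eq = sub F∈ in proj₁ (∈-filter⁻ (¬? ∘ pop?) {xs = heavy} F∈u) , eq
            -- Edges over the same remainder have distinct centres, so any `suc σ` of them would
            -- witness that `Y` is popular.
            chosen : List (Fin n)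
            chosen = map centre (take (suc σ) ys)
            length-chosen : length chosen ≡ suc σ
            length-chosen = trans (length-map centre (take (suc σ) ys))
              (trans (length-take (suc σ) ys) (m≤n⇒m⊓n≡m many))
            unique-chosen : Unique chosen
            unique-chosen = map-unique centre (λ F∈ F′∈ → centre-inj sub′ (take-⊆ F∈) (take-⊆ F′∈)) (Uniq.take⁺ (suc σ) uys)
              where
              take-⊆ : ∀ {F} → F ∈ take (suc σ) ys → F ∈ ys
              take-⊆ F∈ = subst (_ ∈_) (take++drop≡id (suc σ) ys) (∈-++⁺ˡ F∈)
            S : Tuple n (suc σ)
            S = listTuple chosen length-chosen
            origin : ∀ j → ∃[ F ] (F ∈ ys × lookup S j ≡ centre F)
            origin j = let F , F∈ , eq = ∈-map⁻ centre {xs = take (suc σ) ys} (listTuple-∈ {xs = chosen} length-chosen j) in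
              F , subst (F ∈_) (take++drop≡id (suc σ) ys) (∈-++⁺ˡ F∈) , eq
            joined : ∀ {F} → F ∈ ys → Joined (centre F) Y
            joined F∈ = match (edgeTuples⁻ G uG (proj₁ (heavy⁻ (proj₁ (sub′ F∈))))) (proj₂ (sub′ F∈))
              where
              match : ∀ {F} → ∃[ i ] (F ≡ subsetTuple (edge G i) (uG i)) → remainder F ≡ Y → Joined (centre F) Y
              match {F} (i , refl) eq = i , position F , refl , eq
            popular : Popular Y
            popular = S ,
              ∈-vectors S (λ j → let F , F∈ , eq = origin j in
                subst (_∈ centres) (sym eq) (centre∈ (proj₂ (heavy⁻ (proj₁ (sub′ F∈)))))) ,
              (λ c d eq → listTuple-injective length-chosen unique-chosen eq) ,
              λ j → let F , F∈ , eq = origin j in subst (λ a → Joined a Y) (sym eq) (joined F∈)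

      edge-count : m G ≤ length centres ^ suc σ * c₂ * length centres + (n C (2 + q)) * σ +
        ((3 + q) * ((2 + q) * ((3 + q) * t) * c₂) + c₁)
      edge-count = begin
        m G                                   ≡⟨ sym (length-edgeTuples G uG) ⟩
        length family                         ≡⟨ length-filter-split heavy? family ⟩
        length heavy + length light     ≤⟨ +-mono-≤ (≤-trans heavy-bound (+-monoˡ-≤ _ (*-monoˡ-≤ (length centres) popularSets-bound)))
                                                   light-bound ⟩
        length centres ^ suc σ * c₂ * length centres + (n C (2 + q)) * σ +
          ((3 + q) * ((2 + q) * ((3 + q) * t) * c₂) + c₁) ∎
        where open ≤-Reasoning

-- Balancing the error terms with integer roots

^-distribʳ-* : ∀ a b d → (a * b) ^ d ≡ a ^ d * b ^ d
^-distribʳ-* a b zero    = refl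
^-distribʳ-* a b (suc d) = trans (cong (a * b *_) (^-distribʳ-* a b d)) (swap a b (a ^ d) (b ^ d))
  where
  swap : ∀ a b c d → a * b * (c * d) ≡ a * c * (b * d)
  swap = solve-∀

^-swap : ∀ a b c → (a ^ b) ^ c ≡ (a ^ c) ^ b
^-swap a b c = trans (^-*-assoc a b c) (trans (cong (a ^_) (*-comm b c)) (sym (^-*-assoc a c b)))

-- Integer parts of roots replace the real powers of n: one root is the threshold t, another the
-- permitted error.
integer-root : ∀ d N → ∃[ t ] (t ^ suc d ≤ N × N < suc t ^ suc d)
integer-root d N with search (suc N)
  where
  search : ∀ b → (∃[ t ] (t ^ suc d ≤ N × N < suc t ^ suc d)) ⊎ b ^ suc d ≤ N
  search zero = inj₂ z≤n
  search (suc b) with search b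
  ... | inj₁ found = inj₁ found
  ... | inj₂ le with suc b ^ suc d ≤? N
  ... | yes le′ = inj₂ le′
  ... | no ¬le′ = inj₁ (b , le , ≰⇒> ¬le′)
... | inj₁ found = found
... | inj₂ le    = contradiction (≤-trans (m≤m*n (suc N) (suc N ^ d) {{m^n≢0 (suc N) d}}) le) (<⇒≱ (n<1+n N))

+-^-≤ : ∀ a b d → (a + b) ^ d ≤ 2 ^ d * (a ^ d + b ^ d)
+-^-≤ a b d with ≤-total a b
... | inj₁ a≤b = begin
  (a + b) ^ d               ≤⟨ ^-monoˡ-≤ d (+-monoˡ-≤ b a≤b) ⟩
  (b + b) ^ d               ≡⟨ cong (λ z → (b + z) ^ d) (sym (+-identityʳ b)) ⟩
  (2 * b) ^ d               ≡⟨ ^-distribʳ-* 2 b d ⟩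
  2 ^ d * b ^ d             ≤⟨ *-monoʳ-≤ (2 ^ d) (m≤n+m (b ^ d) (a ^ d)) ⟩
  2 ^ d * (a ^ d + b ^ d)   ∎
  where open ≤-Reasoning
... | inj₂ b≤a = begin
  (a + b) ^ d               ≤⟨ ^-monoˡ-≤ d (+-monoʳ-≤ a b≤a) ⟩
  (a + a) ^ d               ≡⟨ cong (λ z → (a + z) ^ d) (sym (+-identityʳ a)) ⟩
  (2 * a) ^ d               ≡⟨ ^-distribʳ-* 2 a d ⟩
  2 ^ d * a ^ d             ≤⟨ *-monoʳ-≤ (2 ^ d) (m≤m+n (a ^ d) (b ^ d)) ⟩
  2 ^ d * (a ^ d + b ^ d)   ∎
  where open ≤-Reasoning

-- In real terms h is at most A (n / t)^e, and n / t is about n^(1/D) for D = E + 1. Division is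
-- avoided by taking D-th powers and cancelling n^(E e); the powers of 2 come from t + 1 ≤ 2 t.
few-centres : ∀ e E n t h A → 1 ≤ n → 1 ≤ t → n ^ E < suc t ^ suc E → h * t ^ e ≤ A * n ^ e →
  h ^ suc E ≤ A ^ suc E * (2 ^ suc E) ^ e * n ^ e
few-centres e E n t h A 1≤n 1≤t n< h≤ = *-cancelʳ-≤ _ _ (n ^ (E * e)) {{m^n≢0 n (E * e) {{>-nonZero 1≤n}}}} (begin
  h ^ D * n ^ (E * e)                       ≡⟨ cong (h ^ D *_) (sym (^-*-assoc n E e)) ⟩
  h ^ D * (n ^ E) ^ e                       ≤⟨ *-monoʳ-≤ (h ^ D) (^-monoˡ-≤ e n^E≤) ⟩
  h ^ D * (2 ^ D * t ^ D) ^ e               ≡⟨ cong (h ^ D *_) (^-distribʳ-* (2 ^ D) (t ^ D) e) ⟩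
  h ^ D * ((2 ^ D) ^ e * (t ^ D) ^ e)       ≡⟨ cong (λ z → h ^ D * ((2 ^ D) ^ e * z)) (^-swap t D e) ⟩
  h ^ D * ((2 ^ D) ^ e * (t ^ e) ^ D)       ≡⟨ x*yz (h ^ D) ((2 ^ D) ^ e) ((t ^ e) ^ D) ⟩
  h ^ D * (t ^ e) ^ D * (2 ^ D) ^ e         ≡⟨ cong (_* (2 ^ D) ^ e) (sym (^-distribʳ-* h (t ^ e) D)) ⟩
  (h * t ^ e) ^ D * (2 ^ D) ^ e             ≤⟨ *-monoˡ-≤ ((2 ^ D) ^ e) (^-monoˡ-≤ D h≤) ⟩
  (A * n ^ e) ^ D * (2 ^ D) ^ e             ≡⟨ cong (_* (2 ^ D) ^ e) (^-distribʳ-* A (n ^ e) D) ⟩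
  A ^ D * (n ^ e * (n ^ e) ^ E) * (2 ^ D) ^ e
    ≡⟨ cong (λ z → A ^ D * (n ^ e * z) * (2 ^ D) ^ e) (trans (^-*-assoc n e E) (cong (n ^_) (*-comm e E))) ⟩
  A ^ D * (n ^ e * n ^ (E * e)) * (2 ^ D) ^ e ≡⟨ reorder (A ^ D) (n ^ e) (n ^ (E * e)) ((2 ^ D) ^ e) ⟩
  A ^ D * (2 ^ D) ^ e * n ^ e * n ^ (E * e)   ∎)
  where
  open ≤-Reasoning
  D = suc E
  n^E≤ : n ^ E ≤ 2 ^ D * t ^ D
  n^E≤ = ≤-trans (<⇒≤ n<) (≤-trans
    (^-monoˡ-≤ D (≤-trans (+-monoˡ-≤ t 1≤t) (≤-reflexive (cong (t +_) (sym (+-identityʳ t))))))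
    (≤-reflexive (^-distribʳ-* 2 t D)))
  x*yz : ∀ x y z → x * (y * z) ≡ x * z * y
  x*yz = solve-∀
  reorder : ∀ a b c d → a * (b * c) * d ≡ a * d * b * c
  reorder = solve-∀

-- The choice of E makes the D-th powers of both error terms O(n^E): for t by its definition, and
-- for h^σ because E = e σ. In the application `σ` stands for σ(H) + 1, one factor h for each centre
-- of a common set and one for the centre of the edge counted.
excess-power : ∀ e σ n t h x A B₁ B₂ → let E = e * σ; D = suc E in
  t ^ D ≤ n ^ E → h ^ D ≤ A * n ^ e → x ≤ n ^ e * (B₁ * h ^ σ + B₂ * t) →
  x ^ D ≤ 2 ^ D * (B₁ ^ D * A ^ σ + B₂ ^ D) * n ^ (e * D + E)
excess-power e σ n t h x A B₁ B₂ t≤ h≤ x≤ = begin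
  x ^ D                                                     ≤⟨ ^-monoˡ-≤ D x≤ ⟩
  (n ^ e * (B₁ * h ^ σ + B₂ * t)) ^ D                       ≡⟨ ^-distribʳ-* (n ^ e) _ D ⟩
  (n ^ e) ^ D * (B₁ * h ^ σ + B₂ * t) ^ D                   ≤⟨ *-monoʳ-≤ ((n ^ e) ^ D) (+-^-≤ (B₁ * h ^ σ) (B₂ * t) D) ⟩
  (n ^ e) ^ D * (2 ^ D * ((B₁ * h ^ σ) ^ D + (B₂ * t) ^ D))
    ≡⟨ cong (λ z → (n ^ e) ^ D * (2 ^ D * z)) (cong₂ _+_ (^-distribʳ-* B₁ (h ^ σ) D) (^-distribʳ-* B₂ t D)) ⟩
  (n ^ e) ^ D * (2 ^ D * (B₁ ^ D * (h ^ σ) ^ D + B₂ ^ D * t ^ D))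
    ≤⟨ *-monoʳ-≤ ((n ^ e) ^ D) (*-monoʳ-≤ (2 ^ D) (+-mono-≤ (*-monoʳ-≤ (B₁ ^ D) h^σ≤) (*-monoʳ-≤ (B₂ ^ D) t≤))) ⟩
  (n ^ e) ^ D * (2 ^ D * (B₁ ^ D * (A ^ σ * n ^ E) + B₂ ^ D * n ^ E))
    ≡⟨ collect ((n ^ e) ^ D) (2 ^ D) (B₁ ^ D) (A ^ σ) (n ^ E) (B₂ ^ D) ⟩
  2 ^ D * (B₁ ^ D * A ^ σ + B₂ ^ D) * ((n ^ e) ^ D * n ^ E)
    ≡⟨ cong (2 ^ D * (B₁ ^ D * A ^ σ + B₂ ^ D) *_)
         (trans (cong (_* n ^ E) (^-*-assoc n e D)) (sym (^-distribˡ-+-* n (e * D) E))) ⟩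
  2 ^ D * (B₁ ^ D * A ^ σ + B₂ ^ D) * n ^ (e * D + E)       ∎
  where
  open ≤-Reasoning
  E D : ℕ
  E = e * σ
  D = suc E
  h^σ≤ : (h ^ σ) ^ D ≤ A ^ σ * n ^ E
  h^σ≤ = begin
    (h ^ σ) ^ D         ≡⟨ ^-swap h σ D ⟩
    (h ^ D) ^ σ         ≤⟨ ^-monoˡ-≤ σ h≤ ⟩
    (A * n ^ e) ^ σ     ≡⟨ ^-distribʳ-* A (n ^ e) σ ⟩
    A ^ σ * (n ^ e) ^ σ ≡⟨ cong (A ^ σ *_) (^-*-assoc n e σ) ⟩
    A ^ σ * n ^ E       ∎
  collect : ∀ a b c d f g → a * (b * (c * (d * f) + g * f)) ≡ b * (c * d + g) * (a * f)
  collect = solve-∀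

root-cap : ∀ {x y N} d → x ^ suc d ≤ N → N < suc y ^ suc d → x ≤ y
root-cap {x} {y} d x≤ <y with x ≤? y
... | yes le = le
... | no ¬le = contradiction (≤-trans (^-monoˡ-≤ (suc d) (≰⇒> ¬le)) x≤) (<⇒≱ <y)

excess-bound : ∀ N c₁ c₂ a b h s t → 1 ≤ t →
  h ^ s * (c₂ * N) * h + (a * (b * (a * t) * (c₂ * N)) + c₁ * N) ≤
  N * (c₂ * h ^ suc s + (a * (b * a * c₂) + c₁) * t)
excess-bound N c₁ c₂ a b h s t 1≤t = begin
  h ^ s * (c₂ * N) * h + (a * (b * (a * t) * (c₂ * N)) + c₁ * N)
    -- The term without t is absorbed into the linear one, since t ≥ 1.
    ≤⟨ +-monoʳ-≤ (h ^ s * (c₂ * N) * h) (+-monoʳ-≤ (a * (b * (a * t) * (c₂ * N))) (m≤m*n (c₁ * N) t {{>-nonZero 1≤t}})) ⟩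
  h ^ s * (c₂ * N) * h + (a * (b * (a * t) * (c₂ * N)) + c₁ * N * t)
    ≡⟨ factor (h ^ s) c₂ N h a b t c₁ ⟩
  N * (c₂ * h ^ suc s + (a * (b * a * c₂) + c₁) * t) ∎
  where
  open ≤-Reasoning
  factor : ∀ H c₂ N h a b t c₁ → H * (c₂ * N) * h + (a * (b * (a * t) * (c₂ * N)) + c₁ * N * t) ≡
    N * (c₂ * (h * H) + (a * (b * a * c₂) + c₁) * t)
  factor = solve-∀

upper-bound : ∀ {v q σ} (H : Hypergraph v) → Uniform (3 + q) H → Host (3 + q) H →
  (X : Subset v) → CrossCut H X → ∣ X ∣ ≡ suc σ → let E = suc q * suc (suc σ); D = suc E in
  ∃[ K ] ∃[ N ] (∀ n → N ≤ n → ∃[ k ] (ExAtMost (3 + q) H n k ×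
    (k ∸ σ * (n C (2 + q))) ^ D ≤ K * n ^ (suc q * D + E)))
upper-bound {v} {q} {σ} H uH h X cross ∣X∣≡σ = K , suc (v + v) , bound
  where
  e E D s c₁ c₂ A B₁ B₂ K : ℕ
  e = suc q
  E = e * suc (suc σ)
  D = suc E
  s = Host.M h * (3 + q)
  c₁ = lossFactor (3 + q) s ((3 + q) * (3 + q))
  c₂ = lossFactor (2 + q) s (2 + q)
  A = ((3 + q) * c₂) ^ D * (2 ^ D) ^ e
  B₁ = c₂
  B₂ = (3 + q) * ((2 + q) * (3 + q) * c₂) + c₁
  K = 2 ^ D * (B₁ ^ D * A ^ suc (suc σ) + B₂ ^ D)
  bound : ∀ n → suc (v + v) ≤ n → ∃[ k ] (ExAtMost (3 + q) H n k ×
    (k ∸ σ * (n C (2 + q))) ^ D ≤ K * n ^ (e * D + E))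
  bound n N≤n with integer-root E (n ^ E) | integer-root E (K * n ^ (e * D + E))
  -- The number y is the largest error compatible with the claim, so the resulting bound does not
  -- depend on the graph `G`.
  ... | t , t≤ , <t | y , y≤ , <y = σ * (n C (2 + q)) + y , atMost ,
    subst (λ z → z ^ D ≤ K * n ^ (e * D + E)) (sym (m+n∸m≡n (σ * (n C (2 + q))) y)) y≤
    where
    1≤n : 1 ≤ n
    1≤n = ≤-trans (s≤s z≤n) N≤n
    -- If t were 0, then n^E would be less than 1, although n is positive.
    1≤t : 1 ≤ t
    1≤t = n≢0⇒n>0 λ { refl → contradiction (<-≤-trans <t (≤-reflexive (^-zeroˡ D)))
      (≤⇒≯ (m^n>0 n {{>-nonZero 1≤n}} E)) }
    atMost : ExAtMost (3 + q) H n (σ * (n C (2 + q)) + y)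
    atMost G (uG , free) = ≤-trans (m≤n+m∸n (m G) (σ * (n C (2 + q)))) (+-monoʳ-≤ (σ * (n C (2 + q)))
      (root-cap E (excess-power e (suc (suc σ)) n t z x A B₁ B₂ t≤ z≤ x≤) <y))
      where
      le : v + v ≤ n
      le = ≤-trans (n≤1+n (v + v)) N≤n
      x z : ℕ
      x = m G ∸ σ * (n C (2 + q))
      z = length (centres H uH h le G uG free t)
      z≤ : z ^ D ≤ A * n ^ e
      z≤ = few-centres e E n t z ((3 + q) * c₂) 1≤n 1≤t <t
        (≤-trans (centres-bound H uH h le G uG free t) (≤-reflexive (sym (*-assoc (3 + q) c₂ (n ^ e)))))
      x≤ : x ≤ n ^ e * (B₁ * z ^ suc (suc σ) + B₂ * t)
      x≤ = ≤-trans (m≤n+o⇒m∸n≤o (m G) (σ * (n C (2 + q))) (begin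
          m G ≤⟨ edge-count H uH h le G uG free t X cross ∣X∣≡σ ⟩
          heavyPart + (n C (2 + q)) * σ + lightPart ≡⟨ rearrange heavyPart (n C (2 + q)) σ lightPart ⟩
          σ * (n C (2 + q)) + (heavyPart + lightPart) ∎))
        (excess-bound (n ^ e) c₁ c₂ (3 + q) (2 + q) z (suc σ) t 1≤t)
        where
        open ≤-Reasoning
        heavyPart lightPart : ℕ
        heavyPart = z ^ suc σ * (c₂ * n ^ e) * z
        lightPart = (3 + q) * ((2 + q) * ((3 + q) * t) * (c₂ * n ^ e)) + c₁ * n ^ e
        rearrange : ∀ a c s b → a + c * s + b ≡ s * c + (a + b)
        rearrange = solve-∀

theorem4p1 : ∀ (r v : ℕ) (H : Hypergraph v) (σ : ℕ) →
    4 ≤ r → Uniform r H → 1 ≤ m H → EmbeddableIn2RedRTree r H → IsSigma H σ →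
    let D = (r ∸ 2) * (σ + 1) + 1 in
    (∃[ K ] ∃[ N ] (∀ n → N ≤ n →
    ∃[ k ] (ExAtLeast r H n k × (σ ∸ 1) * (n C (r ∸ 1)) ≤ k + K * n ^ (r ∸ 2))))
    × (∃[ K ] ∃[ N ] (∀ n → N ≤ n →
    ∃[ k ] (ExAtMost r H n k ×
    (k ∸ (σ ∸ 1) * (n C (r ∸ 1))) ^ D ≤ K * n ^ ((r ∸ 1) * D ∸ 1))))
    × (σ ≡ 1 → ∃[ K ] ∃[ N ] (∀ n → N ≤ n → ExAtMost r H n (K * n ^ (r ∸ 2))))
-- The hypergraph has an edge, which the cross-cut meets; so the cross-cut is not empty.
theorem4p1 (suc (suc (suc (suc q)))) v H zero (s≤s (s≤s (s≤s (s≤s _)))) uH 1≤m emb ((X , cross , ∣X∣≡0) , _) =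
  contradiction (crosscut-meets H X cross (fromℕ< 1≤m)) λ (x , x∈X , _) →
    contradiction (unique-⊆-length {xs = x ∷ []} ([] ∷ []) λ { (here refl) → ∈-elements⁺ x∈X })
      (<⇒≱ (s≤s (≤-reflexive (trans (length-elements X) ∣X∣≡0))))
theorem4p1 (suc (suc (suc (suc q)))) v H (suc σ) (s≤s (s≤s (s≤s (s≤s _)))) uH 1≤m emb isSigma@((X , cross , ∣X∣≡σ) , minimal) =
  lower-bound H minimal , upper , λ { refl → star-bound H uH (fromℕ< 1≤m) (host (4 + q) H emb) isSigma }
  where
  D₀ E D : ℕ
  D₀ = (2 + q) * (suc σ + 1) + 1
  E = (2 + q) * suc (suc σ)
  D = suc E
  D₀≡D : D₀ ≡ D
  D₀≡D = trans (+-comm _ 1) (cong (λ s → suc ((2 + q) * s)) (+-comm (suc σ) 1))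
  -- Since D = E + 1, the exponent (r - 2) D + E equals (r - 1) D - 1.
  exponent : (2 + q) * D + E ≡ (3 + q) * D ∸ 1
  exponent = +-comm ((2 + q) * D) E
  upper : ∃[ K ] ∃[ N ] (∀ n → N ≤ n → ∃[ k ] (ExAtMost (4 + q) H n k ×
    (k ∸ σ * (n C (3 + q))) ^ D₀ ≤ K * n ^ ((3 + q) * D₀ ∸ 1)))
  upper = let K , N , bound = upper-bound {σ = σ} H uH (host (4 + q) H emb) X cross ∣X∣≡σ in
    K , N , λ n N≤n → let k , atMost , le = bound n N≤n in k , atMost ,
      subst (λ d → (k ∸ σ * (n C (3 + q))) ^ d ≤ K * n ^ ((3 + q) * d ∸ 1)) (sym D₀≡D)
        (subst (λ x → (k ∸ σ * (n C (3 + q))) ^ D ≤ K * n ^ x) exponent le)
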